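{- For $|q|<1$, $$\sum_{m,k,n\geq0} \frac{q^{T(m)+T(m+k)+n^2}}{(q)_m(q)_k}\begin{bmatrix} \lfloor k/2\rfloor\\ n\end{bmatrix}_q=\frac{(q^{21},q^8,q^{13};q^{21})_\infty}{(q)_\infty}.$$
   Context: For $m$ a nonnegative integer, $(a)_m=(a;q)_m=\prod_{j=0}^{m-1}(1-aq^j)$ (with $(a)_0=1$), $(a;q)_\infty=\prod_{j\ge0}(1-aq^j)$, $(q)_\infty=(q;q)_\infty$, and $(a_1,\ldots,a_r;q)_\infty=(a_1;q)_\infty\cdots(a_r;q)_\infty$. In particular $(q)_m=\prod_{j=1}^m(1-q^j)$. The $q$-binomial coefficient is $\begin{bmatrix} m+n\\ m\end{bmatrix}_q=\frac{(q)_{m+n}}{(q)_m(q)_n}$ if $m,n$ are nonnegative integers, and it is $0$ otherwise (so $\begin{bmatrix} A\\ B\end{bmatrix}_q=0$ unless $0\le B\le A$). $T(j)=\frac{j(j+1)}{2}$. -}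

module Defs where

open import Algebra.Apartness.Bundles using (HeytingField)
open import Algebra.Bundles using (CommutativeRing)
open import Data.List.Base using (List; []; _∷_)
open import Data.List.Relation.Binary.Subset.Propositional using (_⊆_)
open import Data.List.Relation.Unary.Unique.Propositional using (Unique)
open import Data.Nat.Base as ℕ using (ℕ; zero; suc)
import Data.Nat.DivMod as ℕ
import Data.Nat.Properties as ℕ
open import Data.Product.Base using (Σ-syntax; ∃-syntax; _×_; _,_; proj₁; proj₂)
open import Data.Sum.Base using (_⊎_; inj₁; inj₂)
open import Level using (_⊔_) renaming (suc to lsuc)
open import Relation.Binary.Core using (Rel)
open import Relation.Binary.Structures using (IsStrictPartialOrder)
open import Relation.Nullary using (¬_; yes; no; contradiction)

record OrderedField c ℓ₁ ℓ₂ : Set (lsuc (c ⊔ ℓ₁ ⊔ ℓ₂)) where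
  infix 4 _<_
  field
    heytingField : HeytingField c ℓ₁ ℓ₂

  open HeytingField heytingField public

  field
    _<_                  : Rel Carrier ℓ₂
    isStrictPartialOrder : IsStrictPartialOrder _≈_ _<_
    <⇒#                  : ∀ {x y} → x < y → x # y
    #⇒<⊎>                : ∀ {x y} → x # y → x < y ⊎ y < x
    +-monoˡ-<            : ∀ {x y} z → x < y → x + z < y + z
    *-pos                : ∀ {x y} → 0# < x → 0# < y → 0# < x * y

  fromℕ : ℕ → Carrier
  fromℕ zero    = 0#
  fromℕ (suc n) = 1# + fromℕ n

  -- Both orders of m and n are covered, so this says |sₘ - sₙ| < ε.
  Cauchy : (ℕ → Carrier) → Set (c ⊔ ℓ₂)
  Cauchy s = ∀ ε → 0# < ε →
    ∃[ N ] ∀ m n → N ℕ.≤ m → N ℕ.≤ n → s m < s n + ε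

  ConvergesTo : (ℕ → Carrier) → Carrier → Set (c ⊔ ℓ₂)
  ConvergesTo s l = ∀ ε → 0# < ε →
    ∃[ N ] ∀ n → N ℕ.≤ n → s n < l + ε × l < s n + ε

-- The real numbers, given axiomatically as a Cauchy-complete Archimedean
-- ordered field.  Classically this determines ℝ up to isomorphism; no
-- decidability of the order is assumed, so that constructive Cauchy or
-- Dedekind reals are covered as well.
record CompleteOrderedField c ℓ₁ ℓ₂ : Set (lsuc (c ⊔ ℓ₁ ⊔ ℓ₂)) where
  field
    orderedField : OrderedField c ℓ₁ ℓ₂

  open OrderedField orderedField public

  field
    archimedean : ∀ x → ∃[ n ] x < fromℕ n
    complete    : ∀ s → Cauchy s → ∃[ l ] ConvergesTo s l

module OrderedFieldProperties {c ℓ₁ ℓ₂} (F : OrderedField c ℓ₁ ℓ₂) where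

  open OrderedField F
  open IsStrictPartialOrder isStrictPartialOrder public
    using () renaming (irrefl to <-irrefl; trans to <-trans; <-respˡ-≈ to <-respˡ; <-respʳ-≈ to <-respʳ)

  realRing : CommutativeRing c ℓ₁
  realRing = record { isCommutativeRing = isCommutativeRing }

  open CommutativeRing realRing public using (ring; commutativeSemiring)
  open import Algebra.Properties.Ring ring using (-1*x≈-x; -‿distribˡ-*; -‿involutive; -0#≈0#)
  open import Algebra.Apartness.Properties.HeytingCommutativeRing
    (HeytingField.heytingCommutativeRing heytingField) using (1#0; x-0≈x; invertibleʳ⇒#)
  open import Algebra.Solver.Ring.NaturalCoefficients.Default commutativeSemiring
  open import Relation.Binary.Reasoning.Setoid setoid

  private variable
    x y z : Carrier

  <-cotrans : x < y → ∀ z → x < z ⊎ z < y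
  <-cotrans x<y z with #-cotrans (<⇒# x<y) z
  ... | inj₁ x#z with #⇒<⊎> x#z
  ...   | inj₁ x<z = inj₁ x<z
  ...   | inj₂ z<x = inj₂ (<-trans z<x x<y)
  <-cotrans x<y z | inj₂ z#y with #⇒<⊎> z#y
  ...   | inj₁ z<y = inj₂ z<y
  ...   | inj₂ y<z = inj₁ (<-trans x<y y<z)

  x<0⇒0<-x : x < 0# → 0# < - x
  x<0⇒0<-x {x} p = <-respˡ (-‿inverseʳ x) (<-respʳ (+-identityˡ (- x)) (+-monoˡ-< (- x) p))

  x<y⇒0<y-x : x < y → 0# < y - x
  x<y⇒0<y-x {x} p = <-respˡ (-‿inverseʳ x) (+-monoˡ-< (- x) p)

  -x*-x≈x*x : ∀ x → - x * - x ≈ x * x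
  -x*-x≈x*x x = begin
    - x * - x                  ≈⟨ *-cong (-1*x≈-x x) (-1*x≈-x x) ⟨
    (- 1# * x) * (- 1# * x)    ≈⟨ solve 2 (λ e a → (e :* a) :* (e :* a) := (e :* e) :* (a :* a)) refl (- 1#) x ⟩
    (- 1# * - 1#) * (x * x)    ≈⟨ *-congʳ (trans (-1*x≈-x (- 1#)) (-‿involutive 1#)) ⟩
    1# * (x * x)               ≈⟨ *-identityˡ (x * x) ⟩
    x * x                      ∎

  #0⇒0<x*x : x # 0# → 0# < x * x
  #0⇒0<x*x {x} x#0 with #⇒<⊎> x#0
  ... | inj₁ x<0 = <-respʳ (-x*-x≈x*x x) (*-pos (x<0⇒0<-x x<0) (x<0⇒0<-x x<0))
  ... | inj₂ 0<x = *-pos 0<x 0<x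

  0<1 : 0# < 1#
  0<1 = <-respʳ (*-identityˡ 1#) (#0⇒0<x*x 1#0)

  inverse : x # 0# → ∃[ y ] x * y ≈ 1#
  inverse {x} x#0 = let y , _ , p = #⇒invertible x#0 in
    y , trans (*-congʳ (sym (x-0≈x x))) p

  inverse⇒# : x * y ≈ 1# → x # 0#
  inverse⇒# {x} {y} p = invertibleʳ⇒# (y , trans (*-congʳ (x-0≈x x)) p)

  *-#0ˡ : x * y # 0# → x # 0#
  *-#0ˡ {x} {y} p with inverse p
  ... | z , q = inverse⇒# (trans (sym (*-assoc x y z)) q)

  +-pos : 0# < x → 0# < y → 0# < x + y
  +-pos {x} {y} p q = <-trans q (<-respˡ (+-identityˡ y) (+-monoˡ-< y p))

  *-cancel-pos : 0# < x * y → 0# < y → 0# < x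
  *-cancel-pos {x} {y} p q with #⇒<⊎> (*-#0ˡ (#-sym (<⇒# p)))
  ... | inj₂ 0<x = 0<x
  ... | inj₁ x<0 = contradiction
    (<-respʳ (trans (+-congˡ (sym (-‿distribˡ-* x y))) (-‿inverseʳ (x * y)))
             (+-pos p (*-pos (x<0⇒0<-x x<0) q)))
    (<-irrefl refl)

  x*x≮0 : ¬ (x * x < 0#)
  x*x≮0 {x} p = <-irrefl refl (<-trans p (#0⇒0<x*x (*-#0ˡ (<⇒# p))))

  +-cancelˡ : x + y < x → y < 0#
  +-cancelˡ {x} {y} p = <-respˡ lem (<-respʳ (-‿inverseʳ x) (+-monoˡ-< (- x) p))
    where
    lem : x + y + - x ≈ y
    lem = begin
      x + y + - x     ≈⟨ solve 3 (λ a b d → a :+ b :+ d := b :+ (a :+ d)) refl x y (- x) ⟩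
      y + (x + - x)   ≈⟨ +-congˡ (-‿inverseʳ x) ⟩
      y + 0#          ≈⟨ +-identityʳ y ⟩
      y               ∎

  +-≮0 : ¬ (x < 0#) → ¬ (y < 0#) → ¬ (x + y < 0#)
  +-≮0 {x} {y} p q r with <-cotrans r x
  ... | inj₁ s = q (+-cancelˡ s)
  ... | inj₂ s = p s

  +-pos-≮0 : 0# < x → ¬ (y < 0#) → 0# < x + y
  +-pos-≮0 {x} {y} p q with <-cotrans p (x + y)
  ... | inj₁ s = s
  ... | inj₂ s = contradiction (+-cancelˡ s) q

  *-<1 : ¬ (x < 0#) → x < 1# → y < 1# → x * y < 1#
  *-<1 {x} {y} x≮0 x<1 y<1 with <-cotrans x<1 (x * y)
  ... | inj₂ s = s
  ... | inj₁ s = contradiction x<0 x≮0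
    where
    1-y>0 : 0# < 1# - y
    1-y>0 = x<y⇒0<y-x y<1
    eq : x * y - x ≈ - x * (1# - y)
    eq = sym (begin
      - x * (1# - y)                    ≈⟨ *-cong (-1*x≈-x x) (+-congˡ (-1*x≈-x y)) ⟨
      (- 1# * x) * (1# + - 1# * y)      ≈⟨ solve 3 (λ e a b → (e :* a) :* (con 1 :+ e :* b)
                                             := (e :* e) :* (a :* b) :+ e :* a) refl (- 1#) x y ⟩
      (- 1# * - 1#) * (x * y) + - 1# * x
        ≈⟨ +-cong (*-congʳ (trans (-1*x≈-x (- 1#)) (-‿involutive 1#))) (-1*x≈-x x) ⟩
      1# * (x * y) + - x                ≈⟨ +-congʳ (*-identityˡ (x * y)) ⟩
      x * y - x                         ∎)
    -x>0 : 0# < - x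
    -x>0 = *-cancel-pos (<-respʳ eq (x<y⇒0<y-x s)) 1-y>0
    x<0 : x < 0#
    x<0 = <-respˡ (+-identityˡ x) (<-respʳ (-‿inverseˡ x) (+-monoˡ-< x -x>0))

  x*x<1⇒x<1 : x * x < 1# → 0# < 1# - x
  x*x<1⇒x<1 {x} p = go (#⇒<⊎> (*-#0ˡ (#-sym (<⇒# prod))))
    where
    eq : 1# - x * x ≈ (1# - x) * (1# + x)
    eq = sym (begin
      (1# - x) * (1# + x)             ≈⟨ *-congʳ (+-congˡ (-1*x≈-x x)) ⟨
      (1# + - 1# * x) * (1# + x)      ≈⟨ solve 2 (λ e a → (con 1 :+ e :* a) :* (con 1 :+ a)
                                           := con 1 :+ e :* (a :* a) :+ (con 1 :+ e) :* a) refl (- 1#) x ⟩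
      1# + - 1# * (x * x) + (1# + - 1#) * x
                                      ≈⟨ +-cong (+-congˡ (-1*x≈-x (x * x))) (trans (*-congʳ (-‿inverseʳ 1#)) (zeroˡ x)) ⟩
      1# - x * x + 0#                 ≈⟨ +-identityʳ _ ⟩
      1# - x * x                      ∎)
    prod : 0# < (1# - x) * (1# + x)
    prod = <-respʳ eq (x<y⇒0<y-x p)
    sum : (1# - x) + (1# + x) ≈ 1# + 1#
    sum = begin
      (1# - x) + (1# + x)     ≈⟨ solve 3 (λ o m a → (o :+ m) :+ (o :+ a) := (o :+ o) :+ (m :+ a)) refl 1# (- x) x ⟩
      (1# + 1#) + (- x + x)   ≈⟨ +-congˡ (-‿inverseˡ x) ⟩
      (1# + 1#) + 0#          ≈⟨ +-identityʳ _ ⟩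
      1# + 1#                 ∎
    go : 1# - x < 0# ⊎ 0# < 1# - x → 0# < 1# - x
    go (inj₂ q) = q
    go (inj₁ q) with <-cotrans (<-respʳ (sym sum) (+-pos 0<1 0<1)) (1# - x)
    ... | inj₁ r = r
    ... | inj₂ r = *-cancel-pos prod 0<1+x
      where
      0<1+x : 0# < 1# + x
      0<1+x = <-respʳ lem (<-respˡ (-‿inverseʳ (1# - x)) (+-monoˡ-< (- (1# - x)) r))
        where
        lem : (1# - x) + (1# + x) + - (1# - x) ≈ 1# + x
        lem = begin
          (1# - x) + (1# + x) + - (1# - x)
            ≈⟨ solve 3 (λ a b d → a :+ b :+ d := b :+ (a :+ d)) refl (1# - x) (1# + x) (- (1# - x)) ⟩
          (1# + x) + ((1# - x) + - (1# - x))   ≈⟨ +-congˡ (-‿inverseʳ (1# - x)) ⟩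
          (1# + x) + 0#                        ≈⟨ +-identityʳ _ ⟩
          1# + x                               ∎

module Complex {c ℓ₁ ℓ₂} (ℝ : CompleteOrderedField c ℓ₁ ℓ₂) where

  private module R = CompleteOrderedField ℝ
  private module P = OrderedFieldProperties (CompleteOrderedField.orderedField ℝ)
  open R using () renaming (Carrier to |ℝ|)

  infix 7 _+i_
  record ℂ : Set c where
    constructor _+i_
    field
      re im : |ℝ|

  private
    _≈ᶜ_ : Rel ℂ ℓ₁
    (a +i b) ≈ᶜ (a′ +i b′) = (a R.≈ a′) × (b R.≈ b′)

    _+ᶜ_ _*ᶜ_ : ℂ → ℂ → ℂ
    (a +i b) +ᶜ (a′ +i b′) = (a R.+ a′) +i (b R.+ b′)
    (a +i b) *ᶜ (a′ +i b′) = (a R.* a′ R.- b R.* b′) +i (a R.* b′ R.+ b R.* a′)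

    -ᶜ_ : ℂ → ℂ
    -ᶜ (a +i b) = (R.- a) +i (R.- b)

  ∣_∣² : ℂ → |ℝ|
  ∣ a +i b ∣² = a R.* a R.+ b R.* b

  private
    module Laws where
      open R
      open P using (commutativeSemiring)
      open import Algebra.Properties.Ring P.ring using (-1*x≈-x; -‿involutive; -0#≈0#)
      open import Algebra.Solver.Ring.NaturalCoefficients.Default commutativeSemiring
      open import Relation.Binary.Reasoning.Setoid setoid

      e : Carrier
      e = - 1#

      -- ring laws are verified for R[X]/(X² - e), which needs no cancellation
      toE : ∀ x y → x - y ≈ x + e * y
      toE x y = +-congˡ (sym (-1*x≈-x y))

      mul-cong : ∀ {x y u v} → x ≈ᶜ y → u ≈ᶜ v → (x *ᶜ u) ≈ᶜ (y *ᶜ v)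
      mul-cong (p , q) (r , s) =
        +-cong (*-cong p r) (-‿cong (*-cong q s)) , +-cong (*-cong p s) (*-cong q r)

      mul-assoc : ∀ x y z → ((x *ᶜ y) *ᶜ z) ≈ᶜ (x *ᶜ (y *ᶜ z))
      mul-assoc (a +i b) (a′ +i b′) (a″ +i b″) =
        (begin
          (a * a′ - b * b′) * a″ - (a * b′ + b * a′) * b″
            ≈⟨ toE _ _ ⟩
          (a * a′ - b * b′) * a″ + e * ((a * b′ + b * a′) * b″)
            ≈⟨ +-congʳ (*-congʳ (toE _ _)) ⟩
          (a * a′ + e * (b * b′)) * a″ + e * ((a * b′ + b * a′) * b″)
            ≈⟨ solve 7 (λ e a b c d f g →
                 (a :* c :+ e :* (b :* d)) :* f :+ e :* ((a :* d :+ b :* c) :* g)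
                 := a :* (c :* f :+ e :* (d :* g)) :+ e :* (b :* (c :* g :+ d :* f)))
                 refl e a b a′ b′ a″ b″ ⟩
          a * (a′ * a″ + e * (b′ * b″)) + e * (b * (a′ * b″ + b′ * a″))
            ≈⟨ +-congʳ (*-congˡ (toE _ _)) ⟨
          a * (a′ * a″ - b′ * b″) + e * (b * (a′ * b″ + b′ * a″))
            ≈⟨ toE _ _ ⟨
          a * (a′ * a″ - b′ * b″) - b * (a′ * b″ + b′ * a″) ∎)
        ,
        (begin
          (a * a′ - b * b′) * b″ + (a * b′ + b * a′) * a″
            ≈⟨ +-congʳ (*-congʳ (toE _ _)) ⟩
          (a * a′ + e * (b * b′)) * b″ + (a * b′ + b * a′) * a″
            ≈⟨ solve 7 (λ e a b c d f g →
                 (a :* c :+ e :* (b :* d)) :* g :+ (a :* d :+ b :* c) :* f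
                 := a :* (c :* g :+ d :* f) :+ b :* (c :* f :+ e :* (d :* g)))
                 refl e a b a′ b′ a″ b″ ⟩
          a * (a′ * b″ + b′ * a″) + b * (a′ * a″ + e * (b′ * b″))
            ≈⟨ +-congˡ (*-congˡ (toE _ _)) ⟨
          a * (a′ * b″ + b′ * a″) + b * (a′ * a″ - b′ * b″) ∎)

      mul-comm : ∀ x y → (x *ᶜ y) ≈ᶜ (y *ᶜ x)
      mul-comm (a +i b) (a′ +i b′) =
        +-cong (*-comm a a′) (-‿cong (*-comm b b′)) ,
        trans (+-comm _ _) (+-cong (*-comm b a′) (*-comm a b′))

      mul-identityˡ : ∀ x → ((1# +i 0#) *ᶜ x) ≈ᶜ x
      mul-identityˡ (a +i b) =
        trans (+-cong (*-identityˡ a) (trans (-‿cong (zeroˡ b)) -0#≈0#)) (+-identityʳ a) ,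
        trans (+-cong (*-identityˡ b) (zeroˡ a)) (+-identityʳ b)

      mul-distribˡ : ∀ x y z → (x *ᶜ (y +ᶜ z)) ≈ᶜ ((x *ᶜ y) +ᶜ (x *ᶜ z))
      mul-distribˡ (a +i b) (a′ +i b′) (a″ +i b″) =
        (begin
          a * (a′ + a″) - b * (b′ + b″)
            ≈⟨ toE _ _ ⟩
          a * (a′ + a″) + e * (b * (b′ + b″))
            ≈⟨ solve 7 (λ e a b c d f g →
                 a :* (c :+ f) :+ e :* (b :* (d :+ g))
                 := (a :* c :+ e :* (b :* d)) :+ (a :* f :+ e :* (b :* g)))
                 refl e a b a′ b′ a″ b″ ⟩
          (a * a′ + e * (b * b′)) + (a * a″ + e * (b * b″))
            ≈⟨ +-cong (toE _ _) (toE _ _) ⟨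
          (a * a′ - b * b′) + (a * a″ - b * b″) ∎)
        ,
        solve 6 (λ a b c d f g →
          a :* (d :+ g) :+ b :* (c :+ f) := (a :* d :+ b :* c) :+ (a :* g :+ b :* f))
          refl a b a′ b′ a″ b″

      mul-distribʳ : ∀ x y z → ((y +ᶜ z) *ᶜ x) ≈ᶜ ((y *ᶜ x) +ᶜ (z *ᶜ x))
      mul-distribʳ x y z with mul-comm (y +ᶜ z) x | mul-distribˡ x y z | mul-comm x y | mul-comm x z
      ... | p , p′ | q , q′ | r , r′ | s , s′ =
        trans p (trans q (+-cong r s)) , trans p′ (trans q′ (+-cong r′ s′))

      mul-identityʳ : ∀ x → (x *ᶜ (1# +i 0#)) ≈ᶜ x
      mul-identityʳ x with mul-comm x (1# +i 0#) | mul-identityˡ x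
      ... | p , p′ | q , q′ = trans p q , trans p′ q′

      ∣*∣² : ∀ x y → ∣ x *ᶜ y ∣² ≈ ∣ x ∣² * ∣ y ∣²
      ∣*∣² (a +i b) (a′ +i b′) = begin
        (a * a′ - b * b′) * (a * a′ - b * b′) + (a * b′ + b * a′) * (a * b′ + b * a′)
          ≈⟨ +-congʳ (*-cong (toE _ _) (toE _ _)) ⟩
        (a * a′ + e * (b * b′)) * (a * a′ + e * (b * b′)) + (a * b′ + b * a′) * (a * b′ + b * a′)
          ≈⟨ solve 5 (λ e a b c d →
               (a :* c :+ e :* (b :* d)) :* (a :* c :+ e :* (b :* d)) :+ (a :* d :+ b :* c) :* (a :* d :+ b :* c)
               := (a :* a :* (c :* c) :+ a :* a :* (d :* d) :+ b :* b :* (c :* c) :+ (e :* e) :* (b :* b :* (d :* d)))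
                  :+ (con 1 :+ e) :* (a :* b :* c :* d :+ a :* b :* c :* d))
               refl e a b a′ b′ ⟩
        (a * a * (a′ * a′) + a * a * (b′ * b′) + b * b * (a′ * a′) + (e * e) * (b * b * (b′ * b′)))
          + (1# + e) * (a * b * a′ * b′ + a * b * a′ * b′)
          ≈⟨ +-cong (+-congˡ (*-congʳ (trans (-1*x≈-x e) (-‿involutive 1#))))
                    (trans (*-congʳ (-‿inverseʳ 1#)) (zeroˡ _)) ⟩
        (a * a * (a′ * a′) + a * a * (b′ * b′) + b * b * (a′ * a′) + 1# * (b * b * (b′ * b′))) + 0#
          ≈⟨ solve 4 (λ a b c d →
               (a :* a :* (c :* c) :+ a :* a :* (d :* d) :+ b :* b :* (c :* c) :+ con 1 :* (b :* b :* (d :* d))) :+ con 0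
               := (a :* a :+ b :* b) :* (c :* c :+ d :* d))
               refl a b a′ b′ ⟩
        (a * a + b * b) * (a′ * a′ + b′ * b′) ∎

      ∣1-∣² : ∀ w → ∣ w ∣² < 1# → 0# < ∣ (1# +i 0#) +ᶜ (-ᶜ w) ∣²
      ∣1-∣² (a +i b) p = P.+-pos-≮0 (*-pos 0<1-a 0<1-a) P.x*x≮0
        where
        a*a<1 : a * a < 1#
        a*a<1 with P.<-cotrans p (a * a)
        ... | inj₁ s = contradiction (P.+-cancelˡ s) P.x*x≮0
        ... | inj₂ s = s
        0<1-a = P.x*x<1⇒x<1 a*a<1

      mul-inverse : ∀ z (y : Carrier) → ∣ z ∣² * y ≈ 1# →
        (z *ᶜ ((ℂ.re z * y) +i (- (ℂ.im z) * y))) ≈ᶜ (1# +i 0#)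
      mul-inverse (a +i b) y p =
        (begin
          a * (a * y) - b * (- b * y)
            ≈⟨ trans (toE _ _) (+-congˡ (*-congˡ (*-congˡ (*-congʳ (sym (-1*x≈-x b)))))) ⟩
          a * (a * y) + e * (b * (e * b * y))
            ≈⟨ solve 4 (λ e a b y → a :* (a :* y) :+ e :* (b :* (e :* b :* y))
                 := a :* a :* y :+ (e :* e) :* (b :* b :* y)) refl e a b y ⟩
          a * a * y + (e * e) * (b * b * y)
            ≈⟨ +-congˡ (trans (*-congʳ (trans (-1*x≈-x e) (-‿involutive 1#))) (*-identityˡ _)) ⟩
          a * a * y + b * b * y   ≈⟨ distribʳ y (a * a) (b * b) ⟨
          (a * a + b * b) * y     ≈⟨ p ⟩
          1# ∎)
        ,
        (begin
          a * (- b * y) + b * (a * y)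
            ≈⟨ +-congʳ (*-congˡ (*-congʳ (-1*x≈-x b))) ⟨
          a * (e * b * y) + b * (a * y)
            ≈⟨ solve 4 (λ e a b y → a :* (e :* b :* y) :+ b :* (a :* y)
                 := (con 1 :+ e) :* (a :* b :* y)) refl e a b y ⟩
          (1# + e) * (a * b * y)  ≈⟨ trans (*-congʳ (-‿inverseʳ 1#)) (zeroˡ _) ⟩
          0# ∎)

  complexRing : CommutativeRing c ℓ₁
  complexRing = record
    { Carrier = ℂ
    ; _≈_ = _≈ᶜ_
    ; _+_ = _+ᶜ_
    ; _*_ = _*ᶜ_
    ; -_  = -ᶜ_
    ; 0#  = R.0# +i R.0#
    ; 1#  = R.1# +i R.0#
    ; isCommutativeRing = record
      { isRing = record
        { +-isAbelianGroup = record
          { isGroup = record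
            { isMonoid = record
              { isSemigroup = record
                { isMagma = record
                  { isEquivalence = record
                    { refl  = R.refl , R.refl
                    ; sym   = λ (p , q) → R.sym p , R.sym q
                    ; trans = λ (p , q) (r , s) → R.trans p r , R.trans q s
                    }
                  ; ∙-cong = λ (p , q) (r , s) → R.+-cong p r , R.+-cong q s
                  }
                ; assoc = λ x y z → R.+-assoc _ _ _ , R.+-assoc _ _ _
                }
              ; identity = (λ x → R.+-identityˡ _ , R.+-identityˡ _)
                         , (λ x → R.+-identityʳ _ , R.+-identityʳ _)
              }
            ; inverse = (λ x → R.-‿inverseˡ _ , R.-‿inverseˡ _)
                      , (λ x → R.-‿inverseʳ _ , R.-‿inverseʳ _)
            ; ⁻¹-cong = λ (p , q) → R.-‿cong p , R.-‿cong q
            }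
          ; comm = λ x y → R.+-comm _ _ , R.+-comm _ _
          }
        ; *-cong = Laws.mul-cong
        ; *-assoc = Laws.mul-assoc
        ; *-identity = Laws.mul-identityˡ , Laws.mul-identityʳ
        ; distrib = Laws.mul-distribˡ , Laws.mul-distribʳ
        }
      ; *-comm = Laws.mul-comm
      }
    }

  open CommutativeRing complexRing public hiding (Carrier)
  open import Algebra.Properties.Semiring.Exp (CommutativeRing.semiring complexRing) public
    using (_^_)

  infix 4 ∣_∣<_

  -- |z| < r, in the squared form |z|² < r² (only used for r > 0).
  ∣_∣<_ : ℂ → |ℝ| → Set ℓ₂
  ∣ z ∣< r = ∣ z ∣² R.< r R.* r

  -- z is apart from 0 (classically, z ≠ 0).
  _#0 : ℂ → Set ℓ₂
  z #0 = R.0# R.< ∣ z ∣²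

  *-∣∣² : ∀ z w → ∣ z * w ∣² R.≈ ∣ z ∣² R.* ∣ w ∣²
  *-∣∣² = Laws.∣*∣²

  *-#0 : ∀ {z w} → z #0 → w #0 → (z * w) #0
  *-#0 {z} {w} p q = P.<-respʳ (R.sym (*-∣∣² z w)) (R.*-pos p q)

  1#0 : 1# #0
  1#0 = P.<-respʳ (R.sym (R.trans (R.+-cong (R.*-identityˡ _) (R.zeroˡ _)) (R.+-identityʳ _))) P.0<1

  -- 1/z = z̄ / |z|²
  recip : ∀ z → z #0 → ℂ
  recip (a +i b) p = (a R.* r) +i (R.- b R.* r)
    where r = P.inverse (R.#-sym (R.<⇒# p)) .proj₁

  *-recip : ∀ z (p : z #0) → z * recip z p ≈ 1#
  *-recip z p = Laws.mul-inverse z (inv .proj₁) (inv .proj₂)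
    where inv = P.inverse (R.#-sym (R.<⇒# p))

  infix 4 _⟶_

  _⟶_ : (ℕ → ℂ) → ℂ → Set (c ⊔ ℓ₂)
  s ⟶ l = ∀ ε → R.0# R.< ε → ∃[ N ] ∀ n → N ℕ.≤ n → ∣ s n - l ∣< ε

  ∑[_] : ∀ {a} {I : Set a} → List I → (I → ℂ) → ℂ
  ∑[ [] ]     f = 0#
  ∑[ i ∷ is ] f = f i + ∑[ is ] f

  -- Unconditional convergence: the finite partial sums converge along the
  -- directed set of finite subsets of I (duplicate-free lists).
  HasSum : ∀ {a} {I : Set a} → (I → ℂ) → ℂ → Set (a ⊔ c ⊔ ℓ₂)
  HasSum {I = I} f s = ∀ ε → R.0# R.< ε →
    Σ[ S ∈ List I ] ∀ T → Unique T → S ⊆ T → ∣ ∑[ T ] f - s ∣< ε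

  -- (a;q)ₘ
  poch : ℂ → ℂ → ℕ → ℂ
  poch a q zero    = 1#
  poch a q (suc m) = poch a q m * (1# - a * q ^ m)

  -- P is the value of the infinite product (a;q)_∞.
  IsPoch∞ : ℂ → ℂ → ℂ → Set (c ⊔ ℓ₂)
  IsPoch∞ a q P = poch a q ⟶ P

  module UnitDisc (q : ℂ) (∣q∣<1 : ∣ q ∣< R.1#) where

    private
      ∣q∣²<1 : ∣ q ∣² R.< R.1#
      ∣q∣²<1 = P.<-respʳ (R.*-identityˡ _) ∣q∣<1

      ∣q^∣²<1 : ∀ j → ∣ q ^ suc j ∣² R.< R.1#
      ∣q^∣²<1 zero    = P.<-respˡ
        (R.sym (R.+-cong (R.*-cong (eq .proj₁) (eq .proj₁)) (R.*-cong (eq .proj₂) (eq .proj₂)))) ∣q∣²<1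
        where eq = *-identityʳ q
      ∣q^∣²<1 (suc j) = P.<-respˡ (R.sym (*-∣∣² q (q ^ suc j)))
        (P.*-<1 (P.+-≮0 P.x*x≮0 P.x*x≮0) ∣q∣²<1 (∣q^∣²<1 j))

    qfac : ℕ → ℂ
    qfac = poch q q

    qfac#0 : ∀ m → qfac m #0
    qfac#0 zero    = 1#0
    qfac#0 (suc m) = *-#0 (qfac#0 m) (Laws.∣1-∣² (q ^ suc m) (∣q^∣²<1 m))

    1/qfac : ℕ → ℂ
    1/qfac m = recip (qfac m) (qfac#0 m)

    qbinom : ℕ → ℕ → ℂ
    qbinom A B with B ℕ.≤? A
    ... | yes _ = qfac A * (1/qfac B * 1/qfac (A ℕ.∸ B))
    ... | no  _ = 0#

T : ℕ → ℕ
T j = (j ℕ.* (j ℕ.+ 1)) ℕ./ 2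

{-# OPTIONS --safe #-}
-- Let A_M be the sum of the terms with 2m + k ≤ 2M, and write 1/(q)_r = 0 for
-- r < 0.  Bressoud's identity
--   Σ_n q^(n²) [⌊k/2⌋, n] = Σ_j (-1)^j q^(j(5j+1)/2) [k, ⌊k/2⌋ - 2j]
-- turns the terms with 2m + k fixed into q-Chu–Vandermonde sums over m.  After
-- these are evaluated, the contributions of 2m + k = 2L - 1 and 2m + k = 2L
-- combine to
--   A_M = Σ_j (-1)^j q^((13j²+5j)/2) Σ_{L≤M} q^(L²) / ((q)_{L-2j} (q)_{L+2j}).
-- For M → ∞ the inner sum tends to q^(4j²)/(q)_∞, again by q-Chu–Vandermonde, and
-- Jacobi's triple product Σ_j (-1)^j q^((21j²+5j)/2) = (q²¹,q⁸,q¹³;q²¹)_∞ remains.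
-- Both limits are taken in finite identities, with errors O(ρ^M) for a real
-- ρ < 1 with |q| ≤ ρ²; the spare factor ρ pays for the sums over j and for the
-- unconditional convergence.

module Submission where

open import Defs
open import Data.Nat.Base as ℕ using (ℕ; zero; suc; z≤n; s≤s; _∸_; ⌊_/2⌋)
open import Data.Product.Base using (Σ-syntax; ∃-syntax; _×_; _,_; proj₁; proj₂)
open import Algebra.Bundles using (CommutativeRing; RawRing)
import Algebra.Properties.Semiring.Exp as Exp
open import Data.Integer.Base as ℤ using (ℤ; +_; -[1+_])
import Data.Integer.Properties as ℤ
open import Data.List.Base using (List; []; _∷_; map; _++_; downFrom)
open import Data.List.Membership.Propositional using (_∈_; _∉_)
open import Data.List.Membership.Propositional.Properties
  using (∈-map⁺; ∈-map⁻; ∈-++⁺ˡ; ∈-++⁺ʳ; ∈-++⁻; ∈-downFrom⁺)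
open import Data.List.Relation.Binary.Subset.Propositional using (_⊆_)
open import Data.List.Relation.Unary.All as All using (All)
open import Data.List.Relation.Unary.AllPairs using ([]; _∷_)
open import Data.List.Relation.Unary.Any using (here; there)
open import Data.List.Relation.Unary.Unique.Propositional using (Unique)
import Data.List.Relation.Unary.Unique.Propositional.Properties as Unique
open import Data.Maybe.Base using (Maybe)
import Data.Maybe.Base as Maybe
import Data.Nat.DivMod as ℕ
import Data.Nat.Properties as ℕ
open import Data.Nat.Tactic.RingSolver using () renaming (solve to ℕ-solve)
open import Data.Sum.Base using (_⊎_; inj₁; inj₂; map₂)
open import Level using (_⊔_) renaming (suc to lsuc)
open import Relation.Binary.Consequences using (dec⇒weaklyDec)
open import Relation.Binary.PropositionalEquality as ≡ using (_≡_; module ≡-Reasoning)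
open import Relation.Nullary using (¬_; contradiction; yes; no)

-- Ring solver with integer coefficients; finite sums

-- The square (2j)² enters twice: the sum over m at odd 2m + k contributes (2j)² + 2j, and j(5j+1)/2
-- + (2j)² + 2j = (13j²+5j)/2; the limit of the inner sum then contributes (2j)² again. Bressoud's
-- identity does not close under induction by itself. It is proved together with its companion, Σ_n
-- q^(n²+n) [L, n], and the two recurrences lead from one to the other. Sums over j ∈ ℤ are folded
-- into pairs of terms with natural exponents, and the triple product is stated for a pair with x y
-- = q instead of z and q/z. The only units are the (q)_n, so identities are proved by recurrences
-- from which factors 1 - q^n are cancelled. In the limit the obstacle is uniformity in j: with d =
-- 2|j| the inner sum is known up to ρ^(M-d), which says nothing once d is close to M. The power of
-- q in front of it has to restore ρ^M and still leave a summable factor. The order of the reals is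
-- not decidable, so non-strict inequalities are negations, and every error estimate is an explicit
-- bound rather than a statement about a maximum or a case distinction.

module IntegerSolver {c ℓ} (K : CommutativeRing c ℓ) where
  open CommutativeRing K
  open import Algebra.Solver.Ring.AlmostCommutativeRing
  open import Algebra.Properties.Ring ring using (-0#≈0#; -‿involutive; -‿+-comm; -‿distribˡ-*; -‿distribʳ-*)
  open import Algebra.Properties.Semiring.Mult.TCOptimised semiring
    using (1+×; ×-homo-+; ×1-homo-*) renaming (_×_ to _⋆_)
  open import Relation.Binary.Reasoning.Setoid setoid
  open import Algebra.Properties.CommutativeSemigroup +-commutativeSemigroup using (interchange)

  private
    ℤ-ring : RawRing _ _
    ℤ-ring = record
      { Carrier = ℤ ; _≈_ = _≡_ ; _+_ = ℤ._+_ ; _*_ = ℤ._*_ ; -_ = ℤ.-_ ; 0# = + 0 ; 1# = + 1 }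

    ⟦_⟧ : ℤ → Carrier
    ⟦ + n ⟧      = n ⋆ 1#
    ⟦ -[1+ n ] ⟧ = - (suc n ⋆ 1#)

    -homo : ∀ i → ⟦ ℤ.- i ⟧ ≈ - ⟦ i ⟧
    -homo (+ zero)  = sym -0#≈0#
    -homo (+ suc n) = refl
    -homo -[1+ n ]  = sym (-‿involutive _)

    ⊖-homo : ∀ m n → ⟦ m ℤ.⊖ n ⟧ ≈ m ⋆ 1# - n ⋆ 1#
    ⊖-homo m zero = sym (trans (+-congˡ -0#≈0#) (+-identityʳ _))
    ⊖-homo zero (suc n) = sym (+-identityˡ _)
    ⊖-homo (suc m) (suc n) = begin
      ⟦ suc m ℤ.⊖ suc n ⟧               ≡⟨ ≡.cong ⟦_⟧ (ℤ.[1+m]⊖[1+n]≡m⊖n m n) ⟩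
      ⟦ m ℤ.⊖ n ⟧                       ≈⟨ ⊖-homo m n ⟩
      m ⋆ 1# - n ⋆ 1#                   ≈⟨ +-identityˡ _ ⟨
      0# + (m ⋆ 1# - n ⋆ 1#)            ≈⟨ +-congʳ (-‿inverseʳ 1#) ⟨
      (1# - 1#) + (m ⋆ 1# - n ⋆ 1#)     ≈⟨ interchange _ _ _ _ ⟩
      (1# + m ⋆ 1#) + (- 1# - n ⋆ 1#)   ≈⟨ +-cong (sym (1+× m 1#)) (trans (-‿+-comm _ _) (-‿cong (sym (1+× n 1#)))) ⟩
      suc m ⋆ 1# - suc n ⋆ 1#           ∎

    +-homo : ∀ i j → ⟦ i ℤ.+ j ⟧ ≈ ⟦ i ⟧ + ⟦ j ⟧
    +-homo (+ m) (+ n)         = ×-homo-+ 1# m n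
    +-homo (+ m) -[1+ n ]      = ⊖-homo m (suc n)
    +-homo -[1+ m ] (+ n)      = trans (⊖-homo n (suc m)) (+-comm _ _)
    +-homo -[1+ m ] -[1+ n ]   = begin
      - (suc (suc (m ℕ.+ n)) ⋆ 1#)        ≡⟨ ≡.cong (λ k → - (suc k ⋆ 1#)) (ℕ.+-suc m n) ⟨
      - ((suc m ℕ.+ suc n) ⋆ 1#)          ≈⟨ -‿cong (×-homo-+ 1# (suc m) (suc n)) ⟩
      - (suc m ⋆ 1# + suc n ⋆ 1#)         ≈⟨ -‿+-comm _ _ ⟨
      - (suc m ⋆ 1#) - (suc n ⋆ 1#)       ∎

    *-homo : ∀ i j → ⟦ i ℤ.* j ⟧ ≈ ⟦ i ⟧ * ⟦ j ⟧
    *-homo (+ m) (+ n) = trans (reflexive (≡.cong ⟦_⟧ (≡.sym (ℤ.pos-* m n)))) (×1-homo-* m n)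
    *-homo (+ m) -[1+ n ] = begin
      ⟦ + m ℤ.* -[1+ n ] ⟧          ≡⟨ ≡.cong ⟦_⟧ (ℤ.neg-distribʳ-* (+ m) (+ suc n)) ⟨
      ⟦ ℤ.- (+ m ℤ.* + suc n) ⟧     ≈⟨ -homo (+ m ℤ.* + suc n) ⟩
      - ⟦ + m ℤ.* + suc n ⟧         ≈⟨ -‿cong (*-homo (+ m) (+ suc n)) ⟩
      - (⟦ + m ⟧ * ⟦ + suc n ⟧)     ≈⟨ -‿distribʳ-* _ _ ⟩
      ⟦ + m ⟧ * ⟦ -[1+ n ] ⟧        ∎
    *-homo -[1+ m ] (+ n) = begin
      ⟦ -[1+ m ] ℤ.* + n ⟧          ≡⟨ ≡.cong ⟦_⟧ (ℤ.neg-distribˡ-* (+ suc m) (+ n)) ⟨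
      ⟦ ℤ.- (+ suc m ℤ.* + n) ⟧     ≈⟨ -homo (+ suc m ℤ.* + n) ⟩
      - ⟦ + suc m ℤ.* + n ⟧         ≈⟨ -‿cong (*-homo (+ suc m) (+ n)) ⟩
      - (⟦ + suc m ⟧ * ⟦ + n ⟧)     ≈⟨ -‿distribˡ-* _ _ ⟩
      ⟦ -[1+ m ] ⟧ * ⟦ + n ⟧        ∎
    *-homo -[1+ m ] -[1+ n ] = begin
      ⟦ + suc m ℤ.* + suc n ⟧             ≈⟨ *-homo (+ suc m) (+ suc n) ⟩
      suc m ⋆ 1# * (suc n ⋆ 1#)           ≈⟨ -‿involutive _ ⟨
      - - (suc m ⋆ 1# * (suc n ⋆ 1#))     ≈⟨ -‿cong (-‿distribˡ-* _ _) ⟩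
      - (- (suc m ⋆ 1#) * (suc n ⋆ 1#))   ≈⟨ -‿distribʳ-* _ _ ⟩
      - (suc m ⋆ 1#) * - (suc n ⋆ 1#)     ∎

    homomorphism : ℤ-ring -Raw-AlmostCommutative⟶ fromCommutativeRing K
    homomorphism = record
      { ⟦_⟧ = ⟦_⟧ ; +-homo = +-homo ; *-homo = *-homo ; -‿homo = -homo
      ; 0-homo = refl ; 1-homo = refl }

    dec : ∀ i j → Maybe (⟦ i ⟧ ≈ ⟦ j ⟧)
    dec i j = Maybe.map (λ i≡j → reflexive (≡.cong ⟦_⟧ i≡j)) (dec⇒weaklyDec ℤ._≟_ i j)

  open import Algebra.Solver.Ring ℤ-ring (fromCommutativeRing K) homomorphism dec public
    using (Polynomial; con; _:+_; _:*_; _:-_; :-_; _:=_; solve)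

  :0 :1 : ∀ {n} → Polynomial n
  :0 = con (+ 0)
  :1 = con (+ 1)

module FiniteSums {c ℓ} (K : CommutativeRing c ℓ) where
  open CommutativeRing K
  open IntegerSolver K
  open import Relation.Binary.Reasoning.Setoid setoid
  open import Algebra.Properties.Ring ring using (-0#≈0#)

  ∑< : ℕ → (ℕ → Carrier) → Carrier
  ∑< zero    f = 0#
  ∑< (suc n) f = f n + ∑< n f

  ∑-cong< : ∀ n {f g} → (∀ i → i ℕ.< n → f i ≈ g i) → ∑< n f ≈ ∑< n g
  ∑-cong< zero    f≈g = refl
  ∑-cong< (suc n) f≈g = +-cong (f≈g n ℕ.≤-refl) (∑-cong< n (λ i i<n → f≈g i (ℕ.m≤n⇒m≤1+n i<n)))

  ∑-cong : ∀ n {f g} → (∀ i → f i ≈ g i) → ∑< n f ≈ ∑< n g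
  ∑-cong n f≈g = ∑-cong< n (λ i _ → f≈g i)

  ∑-zero : ∀ n {f} → (∀ i → i ℕ.< n → f i ≈ 0#) → ∑< n f ≈ 0#
  ∑-zero zero    f≈0 = refl
  ∑-zero (suc n) f≈0 = trans (+-cong (f≈0 n ℕ.≤-refl) (∑-zero n (λ i i<n → f≈0 i (ℕ.m≤n⇒m≤1+n i<n)))) (+-identityˡ 0#)

  ∑-+ : ∀ n f g → ∑< n (λ i → f i + g i) ≈ ∑< n f + ∑< n g
  ∑-+ zero    f g = sym (+-identityˡ 0#)
  ∑-+ (suc n) f g = trans (+-congˡ (∑-+ n f g))
    (solve 4 (λ a b c d → (a :+ b) :+ (c :+ d) := (a :+ c) :+ (b :+ d)) refl (f n) (g n) (∑< n f) (∑< n g))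

  ∑-neg : ∀ n f → ∑< n (λ i → - f i) ≈ - ∑< n f
  ∑-neg zero    f = sym -0#≈0#
  ∑-neg (suc n) f = trans (+-congˡ (∑-neg n f))
    (solve 2 (λ a b → :- a :+ :- b := :- (a :+ b)) refl (f n) (∑< n f))

  ∑-minus : ∀ n f g → ∑< n (λ i → f i - g i) ≈ ∑< n f - ∑< n g
  ∑-minus n f g = trans (∑-+ n f (λ i → - g i)) (+-congˡ (∑-neg n g))

  ∑-*ˡ : ∀ n x f → ∑< n (λ i → x * f i) ≈ x * ∑< n f
  ∑-*ˡ zero    x f = sym (zeroʳ x)
  ∑-*ˡ (suc n) x f = trans (+-congˡ (∑-*ˡ n x f)) (sym (distribˡ x _ _))

  ∑-*ʳ : ∀ n x f → ∑< n (λ i → f i * x) ≈ ∑< n f * x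
  ∑-*ʳ n x f = trans (∑-cong n (λ i → *-comm (f i) x)) (trans (∑-*ˡ n x f) (*-comm x _))

  ∑-swap : ∀ m n (f : ℕ → ℕ → Carrier) → ∑< m (λ i → ∑< n (f i)) ≈ ∑< n (λ j → ∑< m (λ i → f i j))
  ∑-swap zero    n f = sym (∑-zero n (λ _ _ → refl))
  ∑-swap (suc m) n f = trans (+-congˡ (∑-swap m n f)) (sym (∑-+ n (f m) _))

  ∑-head : ∀ n f → ∑< (suc n) f ≈ f 0 + ∑< n (λ i → f (suc i))
  ∑-head zero    f = refl
  ∑-head (suc n) f = trans (+-congˡ (∑-head n f))
    (solve 3 (λ a b c → a :+ (b :+ c) := b :+ (a :+ c)) refl (f (suc n)) (f 0) (∑< n (λ i → f (suc i))))

  ∑-only-head : ∀ n f → (∀ i → f (suc i) ≈ 0#) → ∑< (suc n) f ≈ f 0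
  ∑-only-head n f f≈0 = trans (∑-head n f) (trans (+-congˡ (∑-zero n (λ i _ → f≈0 i))) (+-identityʳ _))

  ∑-drop-last : ∀ n f → f n ≈ 0# → ∑< (suc n) f ≈ ∑< n f
  ∑-drop-last n f f≈0 = trans (+-congʳ f≈0) (+-identityˡ _)

-- Reciprocal q-factorials

tri : ℕ → ℕ
tri zero    = 0
tri (suc n) = tri n ℕ.+ suc n

tri+tri : ∀ n → tri n ℕ.+ tri n ≡ n ℕ.* n ℕ.+ n
tri+tri zero    = ≡.refl
tri+tri (suc n) = begin
  tri n ℕ.+ suc n ℕ.+ (tri n ℕ.+ suc n)       ≡⟨ regroup (tri n) n ⟩
  (tri n ℕ.+ tri n) ℕ.+ (suc n ℕ.+ suc n)     ≡⟨ ≡.cong (ℕ._+ (suc n ℕ.+ suc n)) (tri+tri n) ⟩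
  n ℕ.* n ℕ.+ n ℕ.+ (suc n ℕ.+ suc n)         ≡⟨ ℕ-solve (n ∷ []) ⟩
  suc n ℕ.* suc n ℕ.+ suc n                   ∎
  where
  open ≡-Reasoning
  regroup : ∀ t n → t ℕ.+ suc n ℕ.+ (t ℕ.+ suc n) ≡ (t ℕ.+ t) ℕ.+ (suc n ℕ.+ suc n)
  regroup t n = ℕ-solve (t ∷ n ∷ [])

-- The exponents involve `tri n`, which a polynomial identity can only treat as a free variable t,
-- and they agree only modulo 2t = n² + n. Adding n² + n on one side and 2t on the other leaves a
-- polynomial identity in n and t.
mod-tri : ∀ n {a b} → a ℕ.+ (n ℕ.* n ℕ.+ n) ≡ b ℕ.+ (tri n ℕ.+ tri n) → a ≡ b
mod-tri n {a} {b} eq = ℕ.+-cancelʳ-≡ (n ℕ.* n ℕ.+ n) a b (≡.trans eq (≡.cong (b ℕ.+_) (tri+tri n)))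

record QFactorial {c ℓ} (K : CommutativeRing c ℓ) : Set (c ⊔ ℓ) where
  open CommutativeRing K
  open Exp semiring using (_^_)
  field
    q       : Carrier
    qf u    : ℕ → Carrier
    qf-zero : qf 0 ≈ 1#
    qf-suc  : ∀ n → qf (suc n) ≈ qf n * (1# - q ^ suc n)
    qf*u    : ∀ n → qf n * u n ≈ 1#

module QSeries {c ℓ} (K : CommutativeRing c ℓ) (Q : QFactorial K) where
  open CommutativeRing K
  open QFactorial Q
  open IntegerSolver K
  open FiniteSums K
  open Exp semiring using (_^_; ^-homo-*)
  open import Relation.Binary.Reasoning.Setoid setoid

  ^-cong-≡ : ∀ {a b} → a ≡ b → q ^ a ≈ q ^ b
  ^-cong-≡ eq = reflexive (≡.cong (q ^_) eq)

  ^-split : ∀ {e} a b → e ≡ a ℕ.+ b → q ^ e ≈ q ^ a * q ^ b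
  ^-split a b eq = trans (^-cong-≡ eq) (^-homo-* q a b)

  u-zero : u 0 ≈ 1#
  u-zero = trans (sym (*-identityˡ (u 0))) (trans (*-congʳ (sym qf-zero)) (qf*u 0))

  u-suc : ∀ n → u n ≈ (1# - q ^ suc n) * u (suc n)
  u-suc n = begin
    u n                                                   ≈⟨ *-identityʳ _ ⟨
    u n * 1#                                              ≈⟨ *-congˡ (qf*u (suc n)) ⟨
    u n * (qf (suc n) * u (suc n))                        ≈⟨ *-congˡ (*-congʳ (qf-suc n)) ⟩
    u n * (qf n * (1# - q ^ suc n) * u (suc n))
      ≈⟨ solve 4 (λ a b c d → a :* (b :* c :* d) := (b :* a) :* (c :* d)) refl (u n) (qf n) (1# - q ^ suc n) (u (suc n)) ⟩
    (qf n * u n) * ((1# - q ^ suc n) * u (suc n))         ≈⟨ *-congʳ (qf*u n) ⟩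
    1# * ((1# - q ^ suc n) * u (suc n))                   ≈⟨ *-identityˡ _ ⟩
    (1# - q ^ suc n) * u (suc n)                          ∎

  -- The inverse of 1 - q^(n+1) is `qf n * u (suc n)`. Recurrences for sums divided by (q)_n carry
  -- such factors, and they are removed here.
  cancel : ∀ n {x y} → (1# - q ^ suc n) * x ≈ (1# - q ^ suc n) * y → x ≈ y
  cancel n {x} {y} eq = begin
    x                                              ≈⟨ lem x ⟩
    (qf n * u (suc n)) * ((1# - q ^ suc n) * x)    ≈⟨ *-congˡ eq ⟩
    (qf n * u (suc n)) * ((1# - q ^ suc n) * y)    ≈⟨ lem y ⟨
    y                                              ∎
    where
    lem : ∀ x → x ≈ (qf n * u (suc n)) * ((1# - q ^ suc n) * x)
    lem x = begin
      x                                            ≈⟨ *-identityˡ x ⟨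
      1# * x                                       ≈⟨ *-congʳ (qf*u (suc n)) ⟨
      qf (suc n) * u (suc n) * x                   ≈⟨ *-congʳ (*-congʳ (qf-suc n)) ⟩
      qf n * (1# - q ^ suc n) * u (suc n) * x
        ≈⟨ solve 4 (λ a b c d → a :* b :* c :* d := (a :* c) :* (b :* d)) refl (qf n) (1# - q ^ suc n) (u (suc n)) x ⟩
      (qf n * u (suc n)) * ((1# - q ^ suc n) * x)  ∎

  -- um n i is 1/(q)ₙ₋ᵢ, which is 0 for n < i.
  um : ℕ → ℕ → Carrier
  um n       zero    = u n
  um zero    (suc i) = 0#
  um (suc n) (suc i) = um n i

  um-+ : ∀ i n → um (i ℕ.+ n) i ≡ u n
  um-+ zero    n = ≡.refl
  um-+ (suc i) n = um-+ i n

  um-≤ : ∀ {n i} → i ℕ.≤ n → um n i ≡ u (n ∸ i)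
  um-≤ z≤n       = ≡.refl
  um-≤ (s≤s i≤n) = um-≤ i≤n

  um-< : ∀ {n i} → n ℕ.< i → um n i ≡ 0#
  um-< {zero}  {suc i} _         = ≡.refl
  um-< {suc n} {suc i} (s≤s n<i) = um-< n<i

  -- For n = i the factor is 1 - q^0 = 0, in accordance with 1/(q)_r = 0 at r = -1. The recurrence
  -- therefore crosses the edge of the support, and sums over j need no boundary cases.
  um-suc : ∀ n i → um n (suc i) ≈ (1# - q ^ (n ∸ i)) * um n i
  um-suc zero    zero    = sym (trans (*-congʳ (-‿inverseʳ 1#)) (zeroˡ _))
  um-suc zero    (suc i) = sym (zeroʳ _)
  um-suc (suc n) zero    = u-suc n
  um-suc (suc n) (suc i) = um-suc n i

  -- Next to um n i, a truncated difference n ∸ i in an exponent may be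
  -- treated as a true one.
  um-^-cong : ∀ n i e e′ → (∀ d → n ≡ i ℕ.+ d → e ≡ e′) → um n i * q ^ e ≈ um n i * q ^ e′
  um-^-cong n i e e′ e≡e′ with ℕ.≤-<-connex i n
  ... | inj₁ i≤n = *-congˡ (^-cong-≡ {e} {e′} (e≡e′ (n ∸ i) (≡.sym (ℕ.m+[n∸m]≡n i≤n))))
  ... | inj₂ n<i rewrite um-< n<i = trans (zeroˡ _) (sym (zeroˡ _))

  um-^ : ∀ n i (f : ℕ → ℕ) e → (∀ d → n ≡ i ℕ.+ d → f d ≡ e) → um n i * q ^ f (n ∸ i) ≈ um n i * q ^ e
  um-^ n i f e f≡e = um-^-cong n i (f (n ∸ i)) e (λ { d ≡.refl → ≡.trans (≡.cong f (ℕ.m+n∸m≡n i d)) (f≡e d ≡.refl) })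

  -- Up to a factor (q)₂ₙ or (q)₂ₙ₊₁, the q-binomials [2n, n-i] and [2n+1, n-i].
  D O : ℕ → ℕ → Carrier
  D n i = u (n ℕ.+ i) * um n i
  O n i = u (suc n ℕ.+ i) * um n i

  D-^ : ∀ n i (f : ℕ → ℕ) e → (∀ d → n ≡ i ℕ.+ d → f d ≡ e) → D n i * q ^ f (n ∸ i) ≈ D n i * q ^ e
  D-^ n i f e f≡e = trans (*-assoc _ _ _) (trans (*-congˡ (um-^ n i f e f≡e)) (sym (*-assoc _ _ _)))

  O-^ : ∀ n i (f : ℕ → ℕ) e → (∀ d → n ≡ i ℕ.+ d → f d ≡ e) → O n i * q ^ f (n ∸ i) ≈ O n i * q ^ e
  O-^ n i f e f≡e = trans (*-assoc _ _ _) (trans (*-congˡ (um-^ n i f e f≡e)) (sym (*-assoc _ _ _)))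

  D-< : ∀ {n i} → n ℕ.< i → D n i ≈ 0#
  D-< n<i rewrite um-< n<i = zeroʳ _

  O-< : ∀ {n i} → n ℕ.< i → O n i ≈ 0#
  O-< n<i rewrite um-< n<i = zeroʳ _

  O≈D↑ : ∀ n i → O n i ≈ (1# - q ^ (suc n ∸ i)) * D (suc n) i
  O≈D↑ n i = trans (*-congˡ (um-suc (suc n) i))
    (solve 3 (λ a b c → a :* (b :* c) := b :* (a :* c)) refl _ _ _)

  D≈O : ∀ n i → D n i ≈ (1# - q ^ suc (n ℕ.+ i)) * O n i
  D≈O n i = trans (*-congʳ (u-suc (n ℕ.+ i))) (*-assoc _ _ _)

  D-suc≈O : ∀ n i → D n (suc i) ≈ (1# - q ^ (n ∸ i)) * O n i
  D-suc≈O n i = trans (*-cong (reflexive (≡.cong u (ℕ.+-suc n i))) (um-suc n i))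
    (solve 3 (λ a b c → a :* (b :* c) := b :* (a :* c)) refl _ _ _)

  O≈D↑-suc : ∀ n i → O n i ≈ (1# - q ^ suc (suc (n ℕ.+ i))) * D (suc n) (suc i)
  O≈D↑-suc n i = trans (*-congʳ (trans (u-suc (suc n ℕ.+ i)) (*-congˡ (reflexive (≡.cong (λ k → u (suc k)) (≡.sym (ℕ.+-suc n i)))))))
    (*-assoc _ _ _)

  private
    -- 1 - ab = (1 - a) + a(1 - b). The product a b has to equal the intended power only next to d,
    -- because one of the exponents is a truncated difference. Applied to the neighbours of `D` and
    -- `O` this yields the q-Pascal rules below.
    split-lem : ∀ {d o₁ o₂ a b ab} → o₁ ≈ (1# - a) * d → o₂ ≈ (1# - b) * d → d * (a * b) ≈ d * ab →
                (1# - ab) * d ≈ o₁ + a * o₂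
    split-lem {d} {o₁} {o₂} {a} {b} {ab} p₁ p₂ eq = begin
      (1# - ab) * d                          ≈⟨ solve 2 (λ d x → (:1 :- x) :* d := d :- d :* x) refl d ab ⟩
      d - d * ab                             ≈⟨ +-congˡ (-‿cong eq) ⟨
      d - d * (a * b)
        ≈⟨ solve 3 (λ d a b → d :- d :* (a :* b) := (:1 :- a) :* d :+ a :* ((:1 :- b) :* d)) refl d a b ⟩
      (1# - a) * d + a * ((1# - b) * d)      ≈⟨ +-cong p₁ (*-congˡ p₂) ⟨
      o₁ + a * o₂                            ∎

  D↑-split : ∀ n i → (1# - q ^ (suc n ℕ.+ suc n)) * D (suc n) (suc i) ≈ O n (suc i) + q ^ (n ∸ i) * O n i
  D↑-split n i = split-lem (O≈D↑ n (suc i)) (O≈D↑-suc n i)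
    (trans (*-congˡ (sym (^-homo-* q (n ∸ i) (suc (suc (n ℕ.+ i))))))
           (D-^ (suc n) (suc i) (λ x → x ℕ.+ suc (suc (n ℕ.+ i))) (suc n ℕ.+ suc n)
             λ { d ≡.refl → ℕ-solve (i ∷ d ∷ []) }))

  D↑-split′ : ∀ n i → (1# - q ^ (suc n ℕ.+ suc n)) * D (suc n) (suc i) ≈ O n i + q ^ suc (suc (n ℕ.+ i)) * O n (suc i)
  D↑-split′ n i = split-lem (O≈D↑-suc n i) (O≈D↑ n (suc i))
    (trans (*-congˡ (sym (^-homo-* q (suc (suc (n ℕ.+ i))) (n ∸ i))))
           (D-^ (suc n) (suc i) (λ x → suc (suc (n ℕ.+ i)) ℕ.+ x) (suc n ℕ.+ suc n)
             λ { d ≡.refl → ℕ-solve (i ∷ d ∷ []) }))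

  D↑-split₀ : ∀ n → (1# - q ^ (suc n ℕ.+ suc n)) * D (suc n) 0 ≈ O n 0 + q ^ suc n * O n 0
  D↑-split₀ n = split-lem (O≈D↑ n 0) (O≈D↑ n 0) (*-congˡ (sym (^-homo-* q (suc n) (suc n))))

  O-split : ∀ n i → (1# - q ^ suc (n ℕ.+ n)) * O n i ≈ D n (suc i) + q ^ (n ∸ i) * D n i
  O-split n i = split-lem (D-suc≈O n i) (D≈O n i)
    (trans (*-congˡ (sym (^-homo-* q (n ∸ i) (suc (n ℕ.+ i)))))
           (O-^ n i (λ x → x ℕ.+ suc (n ℕ.+ i)) (suc (n ℕ.+ n)) λ { d ≡.refl → ℕ-solve (i ∷ d ∷ []) }))

  O-split′ : ∀ n i → (1# - q ^ suc (n ℕ.+ n)) * O n i ≈ D n i + q ^ suc (n ℕ.+ i) * D n (suc i)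
  O-split′ n i = split-lem (D≈O n i) (D-suc≈O n i)
    (trans (*-congˡ (sym (^-homo-* q (suc (n ℕ.+ i)) (n ∸ i))))
           (O-^ n i (λ x → suc (n ℕ.+ i) ℕ.+ x) (suc (n ℕ.+ n)) λ { d ≡.refl → ℕ-solve (i ∷ d ∷ []) }))

  -- The q-Chu-Vandermonde sum Σ_i q^((r-i)(s-i)) [r, i] / (q)_{s-i} = 1/(q)_s, made symmetric by
  -- division by (q)_r. The induction is on s for all r at once: after multiplication by 1 - q^(s+1)
  -- one part is the sum for (r-1, s), the other is q^r times the sum for (r, s).
  vandermonde : ∀ s r B → s ℕ.< B →
    ∑< B (λ i → q ^ ((r ∸ i) ℕ.* (s ∸ i)) * (u i * (um r i * um s i))) ≈ u r * u s
  vandermonde zero r (suc B) _ = begin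
    ∑< (suc B) f                              ≈⟨ ∑-only-head B f (λ i → solve 3 (λ a b c → a :* (b :* (c :* :0)) := :0) refl _ _ _) ⟩
    q ^ (r ℕ.* 0) * (u 0 * (u r * u 0))       ≈⟨ *-cong (^-cong-≡ (ℕ.*-zeroʳ r)) (*-congʳ u-zero) ⟩
    1# * (1# * (u r * u 0))                   ≈⟨ solve 1 (λ a → :1 :* (:1 :* a) := a) refl _ ⟩
    u r * u 0                                 ∎
    where f = λ i → q ^ ((r ∸ i) ℕ.* (0 ∸ i)) * (u i * (um r i * um 0 i))
  vandermonde (suc s) r (suc B) (s≤s s<B) = cancel s (begin
    (1# - q ^ suc s) * ∑< (suc B) f             ≈⟨ ∑-*ˡ (suc B) _ f ⟨
    ∑< (suc B) (λ i → (1# - q ^ suc s) * f i)   ≈⟨ ∑-cong (suc B) split ⟩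
    ∑< (suc B) (λ i → g i + q ^ r * h i)        ≈⟨ ∑-+ (suc B) g _ ⟩
    ∑< (suc B) g + ∑< (suc B) (λ i → q ^ r * h i)   ≈⟨ +-cong (trans (∑-head B g) (+-identityˡ _)) (∑-*ˡ (suc B) _ h) ⟩
    ∑< B (λ i → g (suc i)) + q ^ r * ∑< (suc B) h   ≈⟨ +-cong (shifted r) (*-congˡ (vandermonde s r (suc B) (ℕ.m≤n⇒m≤1+n s<B))) ⟩
    (1# - q ^ r) * u r * u s + q ^ r * (u r * u s)
      ≈⟨ solve 3 (λ a b c → (:1 :- a) :* b :* c :+ a :* (b :* c) := b :* c) refl (q ^ r) (u r) (u s) ⟩
    u r * u s                                   ≈⟨ *-congˡ (u-suc s) ⟩
    u r * ((1# - q ^ suc s) * u (suc s))        ≈⟨ solve 3 (λ a b c → a :* (b :* c) := b :* (a :* c)) refl (u r) _ (u (suc s)) ⟩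
    (1# - q ^ suc s) * (u r * u (suc s))        ∎)
    where
    f g h : ℕ → Carrier
    f i = q ^ ((r ∸ i) ℕ.* (suc s ∸ i)) * (u i * (um r i * um (suc s) i))
    g zero = 0#
    g (suc i) = q ^ ((r ∸ suc i) ℕ.* (s ∸ i)) * (u i * (um r (suc i) * um s i))
    h i = q ^ ((r ∸ i) ℕ.* (s ∸ i)) * (u i * (um r i * um s i))

    shifted : ∀ r → ∑< B (λ i → q ^ ((r ∸ suc i) ℕ.* (s ∸ i)) * (u i * (um r (suc i) * um s i)))
                    ≈ (1# - q ^ r) * u r * u s
    shifted zero = trans (∑-zero B (λ i _ → solve 3 (λ a b c → a :* (b :* (:0 :* c)) := :0) refl _ _ _))
      (solve 2 (λ a b → :0 := (:1 :- :1) :* a :* b) refl _ _)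
    shifted (suc r) = trans (vandermonde s r B s<B) (*-congʳ (u-suc r))

    -- 1 - q^(s+1) = (1 - q^i) + q^i (1 - q^(s+1-i))
    split : ∀ i → (1# - q ^ suc s) * f i ≈ g i + q ^ r * h i
    split zero = begin
      (1# - q ^ suc s) * (q ^ (r ℕ.* suc s) * (u 0 * (u r * u (suc s))))
        ≈⟨ *-congˡ (*-congʳ (^-split r (r ℕ.* s) (ℕ.*-suc r s))) ⟩
      (1# - q ^ suc s) * (q ^ r * q ^ (r ℕ.* s) * (u 0 * (u r * u (suc s))))
        ≈⟨ solve 6 (λ a b c d e f → a :* (b :* c :* (d :* (e :* f))) := :0 :+ b :* (c :* (d :* (e :* (a :* f))))) refl _ _ _ _ _ _ ⟩
      0# + q ^ r * (q ^ (r ℕ.* s) * (u 0 * (u r * ((1# - q ^ suc s) * u (suc s)))))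
        ≈⟨ +-congˡ (*-congˡ (*-congˡ (*-congˡ (*-congˡ (u-suc s))))) ⟨
      g 0 + q ^ r * h 0 ∎
    split (suc j) = begin
      (1# - q ^ suc s) * (E * (u (suc j) * (Ur * Us)))
        ≈⟨ solve 5 (λ a b c d e → (:1 :- a) :* (b :* (c :* (d :* e))) := b :* (c :* (d :* (e :- e :* a)))) refl _ _ _ _ _ ⟩
      E * (u (suc j) * (Ur * (Us - Us * q ^ suc s)))
        ≈⟨ *-congˡ (*-congˡ (*-congˡ (+-congˡ (-‿cong lem₁)))) ⟨
      E * (u (suc j) * (Ur * (Us - Us * (q ^ suc j * q ^ (s ∸ j)))))
        ≈⟨ solve 6 (λ a b c d x y → a :* (b :* (c :* (d :- d :* (x :* y)))) :=
             a :* ((:1 :- x) :* b :* (c :* d)) :+ (b :* (c :* (((:1 :- y) :* d) :* (a :* x))))) refl E (u (suc j)) Ur Us (q ^ suc j) (q ^ (s ∸ j)) ⟩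
      E * ((1# - q ^ suc j) * u (suc j) * (Ur * Us))
        + (u (suc j) * (Ur * ((1# - q ^ (s ∸ j)) * Us * (E * q ^ suc j))))
        ≈⟨ +-cong (*-congˡ (*-congʳ (sym (u-suc j)))) (*-congˡ lem₂) ⟩
      g (suc j) + u (suc j) * (Ur * (um s (suc j) * (q ^ r * q ^ ((r ∸ suc j) ℕ.* (s ∸ suc j)))))
        ≈⟨ +-congˡ (solve 5 (λ a b c d e → a :* (b :* (c :* (d :* e))) := d :* (e :* (a :* (b :* c)))) refl _ _ _ _ _) ⟩
      g (suc j) + q ^ r * h (suc j) ∎
      where
      E = q ^ ((r ∸ suc j) ℕ.* (s ∸ j))
      Ur = um r (suc j)
      Us = um s j
      lem₁ : Us * (q ^ suc j * q ^ (s ∸ j)) ≈ Us * q ^ suc s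
      lem₁ = trans (*-congˡ (sym (^-homo-* q (suc j) (s ∸ j))))
        (um-^ s j (suc j ℕ.+_) (suc s) (λ { d ≡.refl → ≡.refl }))
      lem₂ : Ur * ((1# - q ^ (s ∸ j)) * Us * (E * q ^ suc j)) ≈ Ur * (um s (suc j) * (q ^ r * q ^ ((r ∸ suc j) ℕ.* (s ∸ suc j))))
      lem₂ = begin
        Ur * ((1# - q ^ (s ∸ j)) * Us * (E * q ^ suc j))
          ≈⟨ *-congˡ (*-cong (um-suc s j) (^-homo-* q ((r ∸ suc j) ℕ.* (s ∸ j)) (suc j))) ⟨
        Ur * (um s (suc j) * q ^ ((r ∸ suc j) ℕ.* (s ∸ j) ℕ.+ suc j))
          ≈⟨ *-congˡ (um-^-cong s (suc j) ((r ∸ suc j) ℕ.* (s ∸ j) ℕ.+ suc j) ((r ∸ suc j) ℕ.* suc (s ∸ suc j) ℕ.+ suc j) (λ d s≡ → ≡.cong (λ k → (r ∸ suc j) ℕ.* k ℕ.+ suc j) (lem₃ d s≡))) ⟩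
        Ur * (um s (suc j) * q ^ ((r ∸ suc j) ℕ.* suc (s ∸ suc j) ℕ.+ suc j))
          ≈⟨ solve 3 (λ a b c → a :* (b :* c) := b :* (a :* c)) refl _ _ _ ⟩
        um s (suc j) * (Ur * q ^ ((r ∸ suc j) ℕ.* suc (s ∸ suc j) ℕ.+ suc j))
          ≈⟨ *-congˡ (um-^-cong r (suc j) ((r ∸ suc j) ℕ.* suc (s ∸ suc j) ℕ.+ suc j) (r ℕ.+ (r ∸ suc j) ℕ.* (s ∸ suc j)) (λ { d ≡.refl → lem₄ d })) ⟩
        um s (suc j) * (Ur * q ^ (r ℕ.+ (r ∸ suc j) ℕ.* (s ∸ suc j)))
          ≈⟨ solve 3 (λ a b c → b :* (a :* c) := a :* (b :* c)) refl _ _ _ ⟩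
        Ur * (um s (suc j) * q ^ (r ℕ.+ (r ∸ suc j) ℕ.* (s ∸ suc j)))
          ≈⟨ *-congˡ (*-congˡ (^-homo-* q r ((r ∸ suc j) ℕ.* (s ∸ suc j)))) ⟩
        Ur * (um s (suc j) * (q ^ r * q ^ ((r ∸ suc j) ℕ.* (s ∸ suc j)))) ∎
        where
        lem₃ : ∀ d → s ≡ suc j ℕ.+ d → s ∸ j ≡ suc (s ∸ suc j)
        lem₃ d ≡.refl = ≡.trans (≡.cong (_∸ j) (≡.sym (ℕ.+-suc j d))) (≡.trans (ℕ.m+n∸m≡n j (suc d)) (≡.cong suc (≡.sym (ℕ.m+n∸m≡n j d))))
        lem₄ : ∀ d → (suc j ℕ.+ d ∸ suc j) ℕ.* suc (s ∸ suc j) ℕ.+ suc j ≡ suc j ℕ.+ d ℕ.+ (suc j ℕ.+ d ∸ suc j) ℕ.* (s ∸ suc j)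
        lem₄ d rewrite ℕ.m+n∸m≡n j d = expand d (s ∸ suc j)
          where
          expand : ∀ d e → d ℕ.* suc e ℕ.+ suc j ≡ suc j ℕ.+ d ℕ.+ d ℕ.* e
          expand d e = ℕ-solve (d ∷ e ∷ j ∷ [])

-- Bressoud's identity

-- Doubling by recursion makes `dbl (suc i)` unfold to two successors, so the rules for `D` and `O`,
-- which move the second argument by one, apply directly to 2i, 2i + 1 and 2i + 2.
dbl : ℕ → ℕ
dbl zero    = zero
dbl (suc i) = suc (suc (dbl i))

dbl≡+ : ∀ i → dbl i ≡ i ℕ.+ i
dbl≡+ zero    = ≡.refl
dbl≡+ (suc i) = ≡.cong suc (≡.trans (≡.cong suc (dbl≡+ i)) (≡.sym (ℕ.+-suc i i)))

n≤dbl : ∀ n → n ℕ.≤ dbl n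
n≤dbl zero    = z≤n
n≤dbl (suc n) = s≤s (ℕ.m≤n⇒m≤1+n (n≤dbl n))

n≤n² : ∀ n → n ℕ.≤ n ℕ.* n
n≤n² zero    = z≤n
n≤n² (suc n) = ℕ.m≤m*n (suc n) (suc n)

module Bressoud {c ℓ} (K : CommutativeRing c ℓ) (Q : QFactorial K) where
  open CommutativeRing K
  open QFactorial Q
  open QSeries K Q
  open IntegerSolver K
  open FiniteSums K
  open Exp semiring using (_^_; ^-homo-*)
  open import Relation.Binary.Reasoning.Setoid setoid

  bin : ℕ → ℕ → Carrier
  bin L n = qf L * (u n * um L n)

  bin-zero : ∀ L → bin L 0 ≈ 1#
  bin-zero L = trans (*-congˡ (trans (*-congʳ u-zero) (*-identityˡ _))) (qf*u L)

  bin-< : ∀ {L n} → L ℕ.< n → bin L n ≈ 0#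
  bin-< L<n rewrite um-< L<n = trans (*-congˡ (zeroʳ _)) (zeroʳ _)

  private
    bin-suc : ∀ L n → let x = q ^ (L ∸ n) ; y = q ^ suc n in
      bin (suc L) (suc n) ≈ qf L * (u (suc n) * (um L n - um L n * (x * y)))
    bin-suc L n = begin
      qf (suc L) * (u (suc n) * U)
        ≈⟨ *-congʳ (qf-suc L) ⟩
      qf L * (1# - q ^ suc L) * (u (suc n) * U)
        ≈⟨ solve 4 (λ a x b c → a :* (:1 :- x) :* (b :* c) := a :* (b :* (c :- c :* x))) refl (qf L) (q ^ suc L) (u (suc n)) U ⟩
      qf L * (u (suc n) * (U - U * q ^ suc L))
        ≈⟨ *-congˡ (*-congˡ (+-congˡ (-‿cong (um-^ L n (ℕ._+ suc n) (suc L) (λ { d ≡.refl → ℕ-solve (n ∷ d ∷ []) })))))  ⟨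
      qf L * (u (suc n) * (U - U * q ^ (L ∸ n ℕ.+ suc n)))
        ≈⟨ *-congˡ (*-congˡ (+-congˡ (-‿cong (*-congˡ (^-homo-* q (L ∸ n) (suc n)))))) ⟩
      qf L * (u (suc n) * (U - U * (q ^ (L ∸ n) * q ^ suc n))) ∎
      where U = um L n

  pascal₁ : ∀ L n → bin (suc L) (suc n) ≈ bin L (suc n) + q ^ (L ∸ n) * bin L n
  pascal₁ L n = begin
    bin (suc L) (suc n)
      ≈⟨ bin-suc L n ⟩
    qf L * (u (suc n) * (U - U * (q ^ (L ∸ n) * q ^ suc n)))
      ≈⟨ solve 5 (λ a b c x y → a :* (b :* (c :- c :* (x :* y))) := a :* (b :* ((:1 :- x) :* c)) :+ x :* (a :* ((:1 :- y) :* b :* c)))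
           refl (qf L) (u (suc n)) U (q ^ (L ∸ n)) (q ^ suc n) ⟩
    qf L * (u (suc n) * ((1# - q ^ (L ∸ n)) * U)) + q ^ (L ∸ n) * (qf L * ((1# - q ^ suc n) * u (suc n) * U))
      ≈⟨ +-cong (*-congˡ (*-congˡ (um-suc L n))) (*-congˡ (*-congˡ (*-congʳ (u-suc n)))) ⟨
    bin L (suc n) + q ^ (L ∸ n) * bin L n ∎
    where U = um L n

  pascal₂ : ∀ L n → bin (suc L) (suc n) ≈ q ^ suc n * bin L (suc n) + bin L n
  pascal₂ L n = begin
    bin (suc L) (suc n)
      ≈⟨ bin-suc L n ⟩
    qf L * (u (suc n) * (U - U * (q ^ (L ∸ n) * q ^ suc n)))
      ≈⟨ solve 5 (λ a b c x y → a :* (b :* (c :- c :* (x :* y))) := y :* (a :* (b :* ((:1 :- x) :* c))) :+ a :* ((:1 :- y) :* b :* c))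
           refl (qf L) (u (suc n)) U (q ^ (L ∸ n)) (q ^ suc n) ⟩
    q ^ suc n * (qf L * (u (suc n) * ((1# - q ^ (L ∸ n)) * U))) + qf L * ((1# - q ^ suc n) * u (suc n) * U)
      ≈⟨ +-cong (*-congˡ (*-congˡ (*-congˡ (um-suc L n)))) (*-congˡ (*-congʳ (u-suc n))) ⟨
    q ^ suc n * bin L (suc n) + bin L n ∎
    where U = um L n

  -- The parameter a is present because both recurrences raise it. Between them F 2 can be
  -- eliminated, which leaves a closed system for a = 0 and a = 1.
  F : ℕ → ℕ → Carrier
  F a L = ∑< (suc L) (λ n → q ^ (n ℕ.* n ℕ.+ a ℕ.* n) * bin L n)

  private
    F-term : ℕ → ℕ → ℕ → Carrier
    F-term a L n = q ^ (n ℕ.* n ℕ.+ a ℕ.* n) * bin L n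

    F-extend : ∀ a L → F a L ≈ ∑< (suc (suc L)) (F-term a L)
    F-extend a L = sym (∑-drop-last (suc L) (F-term a L) (trans (*-congˡ (bin-< ℕ.≤-refl)) (zeroʳ _)))

    F-head : ∀ a b L → F-term a (suc L) 0 ≈ F-term b L 0
    F-head a b L = *-cong (^-cong-≡ {a ℕ.* 0} {b ℕ.* 0} (≡.trans (ℕ.*-zeroʳ a) (≡.sym (ℕ.*-zeroʳ b))))
                          (trans (bin-zero (suc L)) (sym (bin-zero L)))

  F-rec₁ : ∀ a L → F a (suc L) ≈ F a L + q ^ (suc L ℕ.+ a) * F (suc a) L
  F-rec₁ a L = begin
    F a (suc L)                                                   ≈⟨ ∑-head (suc L) (F-term a (suc L)) ⟩
    F-term a (suc L) 0 + ∑< (suc L) (λ n → F-term a (suc L) (suc n))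
      ≈⟨ +-cong (F-head a a L) (trans (∑-cong (suc L) term) (∑-+ (suc L) _ _)) ⟩
    F-term a L 0 + (∑< (suc L) (λ n → F-term a L (suc n)) + ∑< (suc L) (λ n → q ^ (suc L ℕ.+ a) * F-term (suc a) L n))
      ≈⟨ +-assoc _ _ _ ⟨
    F-term a L 0 + ∑< (suc L) (λ n → F-term a L (suc n)) + ∑< (suc L) (λ n → q ^ (suc L ℕ.+ a) * F-term (suc a) L n)
      ≈⟨ +-cong (sym (trans (F-extend a L) (∑-head (suc L) (F-term a L)))) (∑-*ˡ (suc L) _ (F-term (suc a) L)) ⟩
    F a L + q ^ (suc L ℕ.+ a) * F (suc a) L                       ∎
    where
    expo : ∀ n d → suc n ℕ.* suc n ℕ.+ a ℕ.* suc n ℕ.+ d ≡ suc (n ℕ.+ d) ℕ.+ a ℕ.+ (n ℕ.* n ℕ.+ suc a ℕ.* n)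
    expo n d = ℕ-solve (n ∷ d ∷ a ∷ [])
    term : ∀ n → F-term a (suc L) (suc n) ≈ F-term a L (suc n) + q ^ (suc L ℕ.+ a) * F-term (suc a) L n
    term n = begin
      E * bin (suc L) (suc n)                                  ≈⟨ *-congˡ (pascal₁ L n) ⟩
      E * (bin L (suc n) + q ^ (L ∸ n) * bin L n)
        ≈⟨ solve 6 (λ e b x y z w → e :* (b :+ x :* (y :* (z :* w))) := e :* b :+ y :* (z :* (w :* (e :* x)))) refl
             E (bin L (suc n)) (q ^ (L ∸ n)) (qf L) (u n) (um L n) ⟩
      E * bin L (suc n) + qf L * (u n * (um L n * (E * q ^ (L ∸ n))))
        ≈⟨ +-congˡ (*-congˡ (*-congˡ (trans (*-congˡ (sym (^-homo-* q e (L ∸ n))))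
             (trans (um-^ L n (e ℕ.+_) (suc L ℕ.+ a ℕ.+ (n ℕ.* n ℕ.+ suc a ℕ.* n)) (λ { d ≡.refl → expo n d }))
               (*-congˡ (^-homo-* q (suc L ℕ.+ a) (n ℕ.* n ℕ.+ suc a ℕ.* n))))))) ⟩
      E * bin L (suc n) + qf L * (u n * (um L n * (q ^ (suc L ℕ.+ a) * q ^ (n ℕ.* n ℕ.+ suc a ℕ.* n))))
        ≈⟨ +-congˡ (solve 5 (λ a b c d e → a :* (b :* (c :* (d :* e))) := d :* (e :* (a :* (b :* c)))) refl _ _ _ _ _) ⟩
      E * bin L (suc n) + q ^ (suc L ℕ.+ a) * F-term (suc a) L n ∎
      where
      e = suc n ℕ.* suc n ℕ.+ a ℕ.* suc n
      E = q ^ e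

  F-rec₂ : ∀ a L → F a (suc L) ≈ F (suc a) L + q ^ suc a * F (suc (suc a)) L
  F-rec₂ a L = begin
    F a (suc L)                                                   ≈⟨ ∑-head (suc L) (F-term a (suc L)) ⟩
    F-term a (suc L) 0 + ∑< (suc L) (λ n → F-term a (suc L) (suc n))
      ≈⟨ +-cong (F-head a (suc a) L) (trans (∑-cong (suc L) term) (∑-+ (suc L) _ _)) ⟩
    F-term (suc a) L 0 + (∑< (suc L) (λ n → F-term (suc a) L (suc n)) + ∑< (suc L) (λ n → q ^ suc a * F-term (suc (suc a)) L n))
      ≈⟨ +-assoc _ _ _ ⟨
    F-term (suc a) L 0 + ∑< (suc L) (λ n → F-term (suc a) L (suc n)) + ∑< (suc L) (λ n → q ^ suc a * F-term (suc (suc a)) L n)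
      ≈⟨ +-cong (sym (trans (F-extend (suc a) L) (∑-head (suc L) (F-term (suc a) L)))) (∑-*ˡ (suc L) _ (F-term (suc (suc a)) L)) ⟩
    F (suc a) L + q ^ suc a * F (suc (suc a)) L                       ∎
    where
    term : ∀ n → F-term a (suc L) (suc n) ≈ F-term (suc a) L (suc n) + q ^ suc a * F-term (suc (suc a)) L n
    term n = begin
      E * bin (suc L) (suc n)                                  ≈⟨ *-congˡ (pascal₂ L n) ⟩
      E * (q ^ suc n * bin L (suc n) + bin L n)
        ≈⟨ solve 4 (λ e x b c → e :* (x :* b :+ c) := (e :* x) :* b :+ e :* c) refl E (q ^ suc n) (bin L (suc n)) (bin L n) ⟩
      (E * q ^ suc n) * bin L (suc n) + E * bin L n
        ≈⟨ +-cong
             (*-congʳ (sym (^-split e (suc n) (expo₁ n))))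
             (trans (*-congʳ (^-split (suc a) (n ℕ.* n ℕ.+ suc (suc a) ℕ.* n) (expo₂ n))) (*-assoc _ _ _)) ⟩
      F-term (suc a) L (suc n) + q ^ suc a * F-term (suc (suc a)) L n ∎
      where
      e = suc n ℕ.* suc n ℕ.+ a ℕ.* suc n
      E = q ^ e
      expo₁ : ∀ n → suc n ℕ.* suc n ℕ.+ suc a ℕ.* suc n ≡ suc n ℕ.* suc n ℕ.+ a ℕ.* suc n ℕ.+ suc n
      expo₁ n = ℕ-solve (n ∷ a ∷ [])
      expo₂ : ∀ n → suc n ℕ.* suc n ℕ.+ a ℕ.* suc n ≡ suc a ℕ.+ (n ℕ.* n ℕ.+ suc (suc a) ℕ.* n)
      expo₂ n = ℕ-solve (n ∷ a ∷ [])

  F₀-suc : ∀ L → F 0 (suc L) ≈ F 0 L + q ^ suc L * F 1 L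
  F₀-suc L = trans (F-rec₁ 0 L) (+-congˡ (*-congʳ (^-cong-≡ {suc L ℕ.+ 0} {suc L} (ℕ.+-identityʳ _))))

  F₁-suc : ∀ L → F 1 (suc L) ≈ q ^ suc L * F 0 (suc L) + (1# - q ^ suc L) * F 1 L
  F₁-suc L = begin
    F 1 (suc L)                                        ≈⟨ F-rec₁ 1 L ⟩
    F 1 L + q ^ (suc L ℕ.+ 1) * F 2 L                  ≈⟨ +-congˡ (*-congʳ (^-homo-* q (suc L) 1)) ⟩
    F 1 L + q ^ suc L * q ^ 1 * F 2 L
      ≈⟨ solve 4 (λ a x y b → a :+ x :* y :* b := x :* (a :+ y :* b) :+ (:1 :- x) :* a) refl (F 1 L) (q ^ suc L) (q ^ 1) (F 2 L) ⟩
    q ^ suc L * (F 1 L + q ^ 1 * F 2 L) + (1# - q ^ suc L) * F 1 L   ≈⟨ +-congʳ (*-congˡ (F-rec₂ 0 L)) ⟨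
    q ^ suc L * F 0 (suc L) + (1# - q ^ suc L) * F 1 L ∎

  sgn : ℕ → Carrier
  sgn zero    = 1#
  sgn (suc i) = - sgn i

  -- The bilateral sums over j ∈ ℤ are written with j = i and j = -1 - i
  -- paired, i ∈ ℕ.
  e₁ e₂ e₃ e₄ : ℕ → ℕ
  e₁ i = i ℕ.* i ℕ.+ i ℕ.* i ℕ.+ tri i
  e₂ i = suc i ℕ.* suc i ℕ.+ suc i ℕ.* suc i ℕ.+ tri i
  e₃ i = i ℕ.* i ℕ.+ (tri i ℕ.+ tri i ℕ.+ tri i)
  e₄ i = suc i ℕ.* suc i ℕ.+ (tri i ℕ.+ tri i ℕ.+ tri i)

  private
    -- The second part of each recurrence belongs to -j: in the paired indexing `a (suc i)` leads to
    -- `b′ i` and `b i` to `a′ (suc i)`, while j = 0 stays in place. The minus signs are those of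
    -- the pairing. The last two hypotheses say that whatever is pushed over the cut-off is zero.
    fold-sum : ∀ n {c s} {a z b w a′ b′ : ℕ → Carrier} →
      c * a 0 ≈ z 0 + s * a′ 0 →
      (∀ i → c * a (suc i) ≈ z (suc i) - s * b′ i) →
      (∀ i → c * b i ≈ w i - s * a′ (suc i)) →
      a′ (suc n) ≈ 0# → b′ n ≈ 0# →
      c * ∑< (suc n) (λ i → a i - b i) ≈ ∑< (suc n) (λ i → z i - w i) + s * ∑< (suc n) (λ i → a′ i - b′ i)
    fold-sum n {c} {s} {a} {z} {b} {w} {a′} {b′} a₀ a₊ b≈ a′-last b′-last = begin
      c * ∑< N (λ i → a i - b i)                                    ≈⟨ *-congˡ (∑-minus N a b) ⟩
      c * (∑< N a - ∑< N b)                                         ≈⟨ solve 3 (λ c a b → c :* (a :- b) := c :* a :- c :* b) refl _ _ _ ⟩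
      c * ∑< N a - c * ∑< N b                                       ≈⟨ +-cong ∑a (-‿cong ∑b) ⟩
      ∑< N z + s * (a′ 0 - ∑< n b′) - (∑< N w - s * ∑< N (λ i → a′ (suc i)))
        ≈⟨ solve 6 (λ z s a b w r → z :+ s :* (a :- b) :- (w :- s :* r) := z :- w :+ s :* (a :+ r :- b)) refl
             (∑< N z) s (a′ 0) (∑< n b′) (∑< N w) (∑< N (λ i → a′ (suc i))) ⟩
      ∑< N z - ∑< N w + s * (a′ 0 + ∑< N (λ i → a′ (suc i)) - ∑< n b′)
        ≈⟨ +-cong (sym (∑-minus N z w)) (*-congˡ (+-cong
             (trans (sym (∑-head N a′)) (∑-drop-last N a′ a′-last))
             (-‿cong (sym (∑-drop-last n b′ b′-last))))) ⟩
      ∑< N (λ i → z i - w i) + s * (∑< N a′ - ∑< N b′)              ≈⟨ +-congˡ (*-congˡ (∑-minus N a′ b′)) ⟨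
      ∑< N (λ i → z i - w i) + s * ∑< N (λ i → a′ i - b′ i)         ∎
      where
      N = suc n
      ∑a : c * ∑< N a ≈ ∑< N z + s * (a′ 0 - ∑< n b′)
      ∑a = begin
        c * ∑< N a                                        ≈⟨ ∑-*ˡ N c a ⟨
        ∑< N (λ i → c * a i)                              ≈⟨ ∑-head n _ ⟩
        c * a 0 + ∑< n (λ i → c * a (suc i))              ≈⟨ +-cong a₀ (trans (∑-cong n a₊) (∑-minus n _ _)) ⟩
        z 0 + s * a′ 0 + (∑< n (λ i → z (suc i)) - ∑< n (λ i → s * b′ i))
          ≈⟨ +-congˡ (+-congˡ (-‿cong (∑-*ˡ n s b′))) ⟩
        z 0 + s * a′ 0 + (∑< n (λ i → z (suc i)) - s * ∑< n b′)
          ≈⟨ solve 5 (λ z s a r b → z :+ s :* a :+ (r :- s :* b) := z :+ r :+ s :* (a :- b)) refl _ _ _ _ _ ⟩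
        z 0 + ∑< n (λ i → z (suc i)) + s * (a′ 0 - ∑< n b′)   ≈⟨ +-congʳ (∑-head n z) ⟨
        ∑< N z + s * (a′ 0 - ∑< n b′) ∎
      ∑b : c * ∑< N b ≈ ∑< N w - s * ∑< N (λ i → a′ (suc i))
      ∑b = begin
        c * ∑< N b                             ≈⟨ ∑-*ˡ N c b ⟨
        ∑< N (λ i → c * b i)                   ≈⟨ trans (∑-cong N b≈) (∑-minus N _ _) ⟩
        ∑< N w - ∑< N (λ i → s * a′ (suc i))   ≈⟨ +-congˡ (-‿cong (∑-*ˡ N s _)) ⟩
        ∑< N w - s * ∑< N (λ i → a′ (suc i))   ∎

    expand : ∀ {c s σ P P′ w d o₁ o₂} → c * d ≈ o₁ + w * o₂ → o₂ * (P * w) ≈ o₂ * (P′ * s) →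
             c * (σ * (P * d)) ≈ σ * (P * o₁) + s * (σ * (P′ * o₂))
    expand {c} {s} {σ} {P} {P′} {w} {d} {o₁} {o₂} p r = begin
      c * (σ * (P * d))                       ≈⟨ solve 4 (λ c σ p d → c :* (σ :* (p :* d)) := σ :* (p :* (c :* d))) refl _ _ _ _ ⟩
      σ * (P * (c * d))                       ≈⟨ *-congˡ (*-congˡ p) ⟩
      σ * (P * (o₁ + w * o₂))                 ≈⟨ solve 5 (λ σ p o w r → σ :* (p :* (o :+ w :* r)) := σ :* (p :* o) :+ σ :* (r :* (p :* w))) refl _ _ _ _ _ ⟩
      σ * (P * o₁) + σ * (o₂ * (P * w))       ≈⟨ +-congˡ (*-congˡ r) ⟩
      σ * (P * o₁) + σ * (o₂ * (P′ * s))      ≈⟨ +-congˡ (solve 4 (λ σ o p s → σ :* (o :* (p :* s)) := s :* (σ :* (p :* o))) refl _ _ _ _) ⟩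
      σ * (P * o₁) + s * (σ * (P′ * o₂))      ∎

    expand⁺ : ∀ {c s σ P P′ w d o₁ o₂} → c * d ≈ o₁ + w * o₂ → o₂ * (P * w) ≈ o₂ * (P′ * s) →
             c * (- σ * (P * d)) ≈ - σ * (P * o₁) - s * (σ * (P′ * o₂))
    expand⁺ p r = trans (expand p r) (+-congˡ (solve 3 (λ s σ x → s :* (:- σ :* x) := :- (s :* (σ :* x))) refl _ _ _))

    expand⁻ : ∀ {c s σ P P′ w d o₁ o₂} → c * d ≈ o₁ + w * o₂ → o₂ * (P * w) ≈ o₂ * (P′ * s) →
             c * (σ * (P * d)) ≈ σ * (P * o₁) - s * (- σ * (P′ * o₂))
    expand⁻ p r = trans (expand p r) (+-congˡ (solve 3 (λ s σ x → s :* (σ :* x) := :- (s :* (:- σ :* x))) refl _ _ _))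

  ^-shift : ∀ e a e′ s → e ℕ.+ a ≡ e′ ℕ.+ s → q ^ e * q ^ a ≈ q ^ e′ * q ^ s
  ^-shift e a e′ s eq = trans (sym (^-homo-* q e a)) (^-split e′ s eq)

  O-shift : ∀ n i e e′ s → (∀ d → n ≡ i ℕ.+ d → e ℕ.+ d ≡ e′ ℕ.+ s) →
            O n i * (q ^ e * q ^ (n ∸ i)) ≈ O n i * (q ^ e′ * q ^ s)
  O-shift n i e e′ s eq = trans (*-congˡ (sym (^-homo-* q e (n ∸ i))))
    (trans (O-^ n i (e ℕ.+_) (e′ ℕ.+ s) eq) (*-congˡ (^-homo-* q e′ s)))

  D-shift : ∀ n i e e′ s → (∀ d → n ≡ i ℕ.+ d → e ℕ.+ d ≡ e′ ℕ.+ s) →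
            D n i * (q ^ e * q ^ (n ∸ i)) ≈ D n i * (q ^ e′ * q ^ s)
  D-shift n i e e′ s eq = trans (*-congˡ (sym (^-homo-* q e (n ∸ i))))
    (trans (D-^ n i (e ℕ.+_) (e′ ℕ.+ s) eq) (*-congˡ (^-homo-* q e′ s)))

  xa xb za zb ya yb ta tb : ℕ → ℕ → Carrier
  xa L i = sgn i * (q ^ e₁ i * D L (dbl i))
  xb L i = sgn i * (q ^ e₂ i * D L (dbl (suc i)))
  za L i = sgn i * (q ^ e₁ i * O L (dbl i))
  zb L i = sgn i * (q ^ e₂ i * O L (suc (dbl i)))
  ya L i = sgn i * (q ^ e₃ i * O L (dbl i))
  yb L i = sgn i * (q ^ e₄ i * O L (suc (dbl i)))
  ta L i = sgn i * (q ^ e₃ i * D L (suc (dbl i)))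
  tb L i = sgn i * (q ^ e₄ i * D L (suc (dbl i)))

  -- The cut-off B is irrelevant for B > L.  The sums over j ∈ ℤ are those of
  --   X:  (-1)^j q^(j(5j+1)/2) / ((q)_{L-2j} (q)_{L+2j})
  --   Z:  (-1)^j q^(j(5j+1)/2) / ((q)_{L-2j} (q)_{L+1+2j})
  --   Y:  (-1)^j q^(j(5j+3)/2) / ((q)_{L-2j} (q)_{L+1+2j})
  --   V:  (-1)^j q^(j(5j+3)/2) / ((q)_{L-1-2j} (q)_{L+1+2j})
  X Y Z V : ℕ → ℕ → Carrier
  X B L = ∑< B (λ i → xa L i - xb L i)
  Z B L = ∑< B (λ i → za L i - zb L i)
  Y B L = ∑< B (λ i → ya L i - yb L i)
  V B L = ∑< B (λ i → ta L i - tb L i)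

  private
    term-zero : ∀ {σ P x} → x ≈ 0# → σ * (P * x) ≈ 0#
    term-zero x≈0 = trans (*-congˡ (trans (*-congˡ x≈0) (zeroʳ _))) (zeroʳ _)

  -- For j > 0 and for j < 0 different q-Pascal rules are taken, each time the one whose first part
  -- keeps Bressoud's exponent and so gives a term of `Z`. The second part is then q^(L+1) times the
  -- term of `Y` at -j. This mirrors `F₀-suc`.
  X-step : ∀ n L → L ℕ.≤ n → (1# - q ^ (suc L ℕ.+ suc L)) * X (suc n) (suc L) ≈ Z (suc n) L + q ^ suc L * Y (suc n) L
  X-step n L L≤n = fold-sum n
    (expand {w = q ^ suc L} (D↑-split₀ L) refl)
    (λ i → expand⁺ (D↑-split L (suc (dbl i))) (O-shift L (suc (dbl i)) (e₁ (suc i)) (e₄ i) (suc L)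
       (λ { d ≡.refl → ≡.sym (mod-tri i (≡.subst (λ k → e₄ i ℕ.+ suc (suc (k ℕ.+ d)) ℕ.+ (i ℕ.* i ℕ.+ i) ≡ e₁ (suc i) ℕ.+ d ℕ.+ (tri i ℕ.+ tri i))
          (≡.sym (dbl≡+ i)) (eq₁ i (tri i) d))) })))
    (λ i → expand⁻ (D↑-split′ L (suc (dbl i))) (*-congˡ (^-shift (e₂ i) (suc (suc (L ℕ.+ suc (dbl i)))) (e₃ (suc i)) (suc L)
       (≡.subst (λ k → e₂ i ℕ.+ suc (suc (L ℕ.+ suc k)) ≡ e₃ (suc i) ℕ.+ suc L) (≡.sym (dbl≡+ i)) (≡.sym (mod-tri i (eq₂ i (tri i))))))))
    (term-zero (O-< (ℕ.m≤n⇒m≤1+n (s≤s (ℕ.≤-trans L≤n (n≤dbl n))))))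
    (term-zero (O-< (s≤s (ℕ.≤-trans L≤n (n≤dbl n)))))
    where
    eq₁ : ∀ i t d → suc i ℕ.* suc i ℕ.+ (t ℕ.+ t ℕ.+ t) ℕ.+ suc (suc (i ℕ.+ i ℕ.+ d)) ℕ.+ (i ℕ.* i ℕ.+ i)
      ≡ suc i ℕ.* suc i ℕ.+ suc i ℕ.* suc i ℕ.+ (t ℕ.+ suc i) ℕ.+ d ℕ.+ (t ℕ.+ t)
    eq₁ i t d = ℕ-solve (i ∷ t ∷ d ∷ [])
    eq₂ : ∀ i t → suc i ℕ.* suc i ℕ.+ (t ℕ.+ suc i ℕ.+ (t ℕ.+ suc i) ℕ.+ (t ℕ.+ suc i)) ℕ.+ suc L ℕ.+ (i ℕ.* i ℕ.+ i)
      ≡ suc i ℕ.* suc i ℕ.+ suc i ℕ.* suc i ℕ.+ t ℕ.+ suc (suc (L ℕ.+ suc (i ℕ.+ i))) ℕ.+ (t ℕ.+ t)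
    eq₂ i t = ℕ-solve (i ∷ t ∷ L ∷ [])

  Y-split : ∀ n L → L ℕ.≤ n → (1# - q ^ suc (L ℕ.+ L)) * Y (suc n) L ≈ V (suc n) L + q ^ L * X (suc n) L
  Y-split n L L≤n = fold-sum n
    (expand {w = q ^ L} (O-split L 0) refl)
    (λ i → expand⁺ (O-split L (dbl (suc i))) (D-shift L (dbl (suc i)) (e₃ (suc i)) (e₂ i) L
       (λ { d ≡.refl → ≡.subst (λ k → e₃ (suc i) ℕ.+ d ≡ e₂ i ℕ.+ suc (suc (k ℕ.+ d))) (≡.sym (dbl≡+ i)) (mod-tri i (eq₁ i (tri i) d)) })))
    (λ i → expand⁻ (O-split′ L (suc (dbl i))) (*-congˡ (^-shift (e₄ i) (suc (L ℕ.+ suc (dbl i))) (e₁ (suc i)) L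
       (≡.subst (λ k → e₄ i ℕ.+ suc (L ℕ.+ suc k) ≡ e₁ (suc i) ℕ.+ L) (≡.sym (dbl≡+ i)) (mod-tri i (eq₂ i (tri i)))))))
    (term-zero (D-< (ℕ.m≤n⇒m≤1+n (s≤s (ℕ.≤-trans L≤n (n≤dbl n))))))
    (term-zero (D-< (ℕ.m≤n⇒m≤1+n (s≤s (ℕ.≤-trans L≤n (n≤dbl n))))))
    where
    eq₁ : ∀ i t d → suc i ℕ.* suc i ℕ.+ (t ℕ.+ suc i ℕ.+ (t ℕ.+ suc i) ℕ.+ (t ℕ.+ suc i)) ℕ.+ d ℕ.+ (i ℕ.* i ℕ.+ i)
      ≡ suc i ℕ.* suc i ℕ.+ suc i ℕ.* suc i ℕ.+ t ℕ.+ suc (suc (i ℕ.+ i ℕ.+ d)) ℕ.+ (t ℕ.+ t)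
    eq₁ i t d = ℕ-solve (i ∷ t ∷ d ∷ [])
    eq₂ : ∀ i t → suc i ℕ.* suc i ℕ.+ (t ℕ.+ t ℕ.+ t) ℕ.+ suc (L ℕ.+ suc (i ℕ.+ i)) ℕ.+ (i ℕ.* i ℕ.+ i)
      ≡ suc i ℕ.* suc i ℕ.+ suc i ℕ.* suc i ℕ.+ (t ℕ.+ suc i) ℕ.+ L ℕ.+ (t ℕ.+ t)
    eq₂ i t = ℕ-solve (i ∷ t ∷ L ∷ [])

  -- The terms at j = i and j = -1 - i contain the same factor `D (suc L) (suc (dbl i))`, so the
  -- identity holds pair by pair. With l = q^(L+1) and r = q^(2i+1) it is 1 - l² = (1 - l)(1 + l)
  -- followed by (1 + l)(1 - r) = (1 - l r) - r(1 - v), where r v = l holds next to that factor.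
  V-step : ∀ B L → (1# - q ^ (suc L ℕ.+ suc L)) * V B (suc L) ≈ (1# - q ^ suc L) * Y B L
  V-step B L = begin
    (1# - q ^ (suc L ℕ.+ suc L)) * V B (suc L)                            ≈⟨ ∑-*ˡ B _ _ ⟨
    ∑< B (λ i → (1# - q ^ (suc L ℕ.+ suc L)) * (ta (suc L) i - tb (suc L) i))   ≈⟨ ∑-cong B term ⟩
    ∑< B (λ i → (1# - q ^ suc L) * (ya L i - yb L i))                     ≈⟨ ∑-*ˡ B _ _ ⟩
    (1# - q ^ suc L) * Y B L                                              ∎
    where
    term : ∀ i → (1# - q ^ (suc L ℕ.+ suc L)) * (ta (suc L) i - tb (suc L) i) ≈ (1# - q ^ suc L) * (ya L i - yb L i)
    term i = begin
      (1# - q ^ (suc L ℕ.+ suc L)) * (σ * (P * Δ) - σ * (q ^ e₄ i * Δ))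
        ≈⟨ *-cong (+-congˡ (-‿cong (^-homo-* q (suc L) (suc L)))) (+-congˡ (-‿cong (*-congˡ (*-congʳ P′)))) ⟩
      (1# - l * l) * (σ * (P * Δ) - σ * (P * (q * m) * Δ))
        ≈⟨ solve 5 (λ l σ p d r → (:1 :- l :* l) :* (σ :* (p :* d) :- σ :* (p :* r :* d)) :=
             (:1 :- l) :* (σ :* (p :* (d :- d :* (r :+ r :* l) :+ d :* l)))) refl l σ P Δ (q * m) ⟩
      (1# - l) * (σ * (P * (Δ - Δ * (q * m + q * m * l) + Δ * l)))
        ≈⟨ *-congˡ (*-congˡ (*-congˡ (solve 4 (λ d r l x → d :- d :* (r :+ r :* l) :+ d :* l := d :- r :* d :- d :* (l :* r) :+ d :* l) refl Δ (q * m) l P))) ⟩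
      (1# - l) * (σ * (P * (Δ - q * m * Δ - Δ * (l * (q * m)) + Δ * l)))
        ≈⟨ *-congˡ (*-congˡ (*-congˡ (+-cong (+-congˡ (-‿cong (*-congˡ lm))) dl))) ⟩
      (1# - l) * (σ * (P * (Δ - q * m * Δ - Δ * w + Δ * (q * m * v))))
        ≈⟨ solve 7 (λ l σ p d r w v → (:1 :- l) :* (σ :* (p :* (d :- r :* d :- d :* w :+ d :* (r :* v))))
             := (:1 :- l) :* (σ :* (p :* ((:1 :- w) :* d)) :- σ :* (p :* r :* ((:1 :- v) :* d)))) refl l σ P Δ (q * m) w v ⟩
      (1# - l) * (σ * (P * ((1# - w) * Δ)) - σ * (P * (q * m) * ((1# - v) * Δ)))
        ≈⟨ *-congˡ (+-cong (*-congˡ (*-congˡ (O≈D↑-suc L (dbl i)))) (-‿cong (*-congˡ (*-cong P′ (O≈D↑ L (suc (dbl i))))))) ⟨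
      (1# - l) * (ya L i - yb L i) ∎
      where
      l = q ^ suc L
      m = q ^ dbl i
      σ = sgn i
      P = q ^ e₃ i
      Δ = D (suc L) (suc (dbl i))
      w = q ^ suc (suc (L ℕ.+ dbl i))
      v = q ^ (L ∸ dbl i)
      expo : ∀ i t → suc i ℕ.* suc i ℕ.+ t ≡ i ℕ.* i ℕ.+ t ℕ.+ suc (i ℕ.+ i)
      expo i t = ℕ-solve (i ∷ t ∷ [])
      P′ : q ^ e₄ i ≈ P * (q * m)
      P′ = ^-split (e₃ i) (suc (dbl i)) (≡.subst (λ k → e₄ i ≡ e₃ i ℕ.+ suc k) (≡.sym (dbl≡+ i)) (expo i (tri i ℕ.+ tri i ℕ.+ tri i)))
      lm : l * (q * m) ≈ w
      lm = sym (^-split (suc L) (suc (dbl i)) (≡.cong suc (≡.sym (ℕ.+-suc L (dbl i)))))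
      dl : Δ * l ≈ Δ * (q * m * v)
      dl = trans (sym (D-^ (suc L) (suc (dbl i)) (suc (dbl i) ℕ.+_) (suc L) (λ { d ≡.refl → ≡.refl })))
                 (*-congˡ (^-homo-* q (suc (dbl i)) (L ∸ dbl i)))

  -- k = 2L and k = 2L + 1 have the same ⌊k/2⌋, so their left-hand sides differ only in the factor
  -- 1/(q)_k. This relation lets the even identity imply the odd one.
  X≈Z : ∀ B L → X B L ≈ (1# - q ^ suc (L ℕ.+ L)) * Z B L
  X≈Z B L = begin
    ∑< B (λ i → xa L i - xb L i)                                       ≈⟨ ∑-cong B term ⟩
    ∑< B (λ i → (1# - q ^ suc (L ℕ.+ L)) * (za L i - zb L i))          ≈⟨ ∑-*ˡ B _ _ ⟩
    (1# - q ^ suc (L ℕ.+ L)) * Z B L                                   ∎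
    where
    -- Both (1 - q^(2L+1)) za - xa and (1 - q^(2L+1)) zb - xb are multiples
    -- of D L (2i+1), and they agree.
    term : ∀ i → xa L i - xb L i ≈ (1# - q ^ suc (L ℕ.+ L)) * (za L i - zb L i)
    term i = begin
      xa L i - xb L i
        ≈⟨ solve 3 (λ a b r → a :- b := (a :+ r) :- (b :+ r)) refl (xa L i) (xb L i) (s * (σ * (P * Δ))) ⟩
      (xa L i + s * (σ * (P * Δ))) - (xb L i + s * (σ * (P * Δ)))
        ≈⟨ +-cong (expand (O-split′ L (dbl i)) refl) (-‿cong (expand (O-split L (suc (dbl i))) shift)) ⟨
      κ * za L i - κ * zb L i  ≈⟨ solve 3 (λ c a b → c :* a :- c :* b := c :* (a :- b)) refl _ _ _ ⟩
      κ * (za L i - zb L i) ∎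
      where
      κ = 1# - q ^ suc (L ℕ.+ L)
      σ = sgn i
      P = q ^ e₁ i
      s = q ^ suc (L ℕ.+ dbl i)
      Δ = D L (suc (dbl i))
      eq : ∀ i t d → suc i ℕ.* suc i ℕ.+ suc i ℕ.* suc i ℕ.+ t ℕ.+ d ≡ i ℕ.* i ℕ.+ i ℕ.* i ℕ.+ t ℕ.+ suc (suc (i ℕ.+ i ℕ.+ d ℕ.+ (i ℕ.+ i)))
      eq i t d = ℕ-solve (i ∷ t ∷ d ∷ [])
      shift : Δ * (q ^ e₂ i * q ^ (L ∸ suc (dbl i))) ≈ Δ * (P * s)
      shift = D-shift L (suc (dbl i)) (e₂ i) (e₁ i) (suc (L ℕ.+ dbl i))
        (λ { d ≡.refl → ≡.subst (λ k → e₂ i ℕ.+ d ≡ e₁ i ℕ.+ suc (suc (k ℕ.+ d ℕ.+ k))) (≡.sym (dbl≡+ i)) (eq i (tri i) d) })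

  private
    -- Both sides obey the same coupled recurrences: `F₀-suc` corresponds to `X-step`, and `F₁-suc`
    -- to `Y-split` combined with `V-step`. The cut-off n stays fixed while L runs up to it, so all
    -- sums compared have the same length.
    bressoud : ∀ n L → L ℕ.≤ n →
      F 0 L * u (L ℕ.+ L) ≈ X (suc n) L × F 1 L * u (suc (L ℕ.+ L)) ≈ Y (suc n) L
    odd : ∀ n L → L ℕ.≤ n → F 0 L * u (suc (L ℕ.+ L)) ≈ Z (suc n) L
    odd n L L≤n = cancel (L ℕ.+ L) (begin
      (1# - q ^ suc (L ℕ.+ L)) * (F 0 L * u (suc (L ℕ.+ L)))   ≈⟨ solve 3 (λ a b c → a :* (b :* c) := b :* (a :* c)) refl _ _ _ ⟩
      F 0 L * ((1# - q ^ suc (L ℕ.+ L)) * u (suc (L ℕ.+ L)))   ≈⟨ *-congˡ (u-suc (L ℕ.+ L)) ⟨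
      F 0 L * u (L ℕ.+ L)                                      ≈⟨ proj₁ (bressoud n L L≤n) ⟩
      X (suc n) L                                              ≈⟨ X≈Z (suc n) L ⟩
      (1# - q ^ suc (L ℕ.+ L)) * Z (suc n) L                   ∎)

    bressoud n zero _ =
      (begin
        F 0 0 * u 0                    ≈⟨ *-congʳ (F-zero 0) ⟩
        1# * u 0                       ≈⟨ solve 1 (λ v → :1 :* v := :1 :* (:1 :* (v :* :1)) :- :0) refl (u 0) ⟩
        1# * (1# * (u 0 * 1#)) - 0#    ≈⟨ +-cong (*-congˡ (*-congˡ (*-congˡ (sym u-zero)))) (-‿cong (sym (term-zero (D-< {0} (s≤s z≤n))))) ⟩
        xa 0 0 - xb 0 0                ≈⟨ ∑-only-head n _ (λ i → vanish (term-zero (D-< {0} (s≤s z≤n))) (term-zero (D-< {0} (s≤s z≤n)))) ⟨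
        X (suc n) 0                    ∎) ,
      (begin
        F 1 0 * u 1                    ≈⟨ *-congʳ (F-zero 1) ⟩
        1# * u 1                       ≈⟨ solve 1 (λ v → :1 :* v := :1 :* (:1 :* (v :* :1)) :- :0) refl (u 1) ⟩
        1# * (1# * (u 1 * 1#)) - 0#    ≈⟨ +-cong (*-congˡ (*-congˡ (*-congˡ (sym u-zero)))) (-‿cong (sym (term-zero (O-< {0} (s≤s z≤n))))) ⟩
        ya 0 0 - yb 0 0                ≈⟨ ∑-only-head n _ (λ i → vanish (term-zero (O-< {0} (s≤s z≤n))) (term-zero (O-< {0} (s≤s z≤n)))) ⟨
        Y (suc n) 0                    ∎)
      where
      F-zero : ∀ a → F a 0 ≈ 1#
      F-zero a = trans (+-identityʳ _) (trans (*-cong (^-cong-≡ {a ℕ.* 0} {0} (ℕ.*-zeroʳ a)) (bin-zero 0)) (*-identityˡ 1#))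
      vanish : ∀ {x y} → x ≈ 0# → y ≈ 0# → x - y ≈ 0#
      vanish p r = trans (+-cong p (-‿cong r)) (-‿inverseʳ 0#)
    bressoud n (suc L) L<n = X≈ , cancel (suc L ℕ.+ suc L) (cancel (L ℕ.+ suc L) (begin
      c₂ * (c₃ * (f₁′ * u (suc (suc L ℕ.+ suc L))))
        ≈⟨ *-congˡ (trans (solve 3 (λ a b c → a :* (b :* c) := b :* (a :* c)) refl _ _ _) (*-congˡ (sym (u-suc (suc L ℕ.+ suc L))))) ⟩
      c₂ * (f₁′ * u (suc L ℕ.+ suc L))
        ≈⟨ trans (solve 3 (λ a b c → a :* (b :* c) := b :* (a :* c)) refl _ _ _) (*-congˡ u₂) ⟩
      f₁′ * u (suc (L ℕ.+ L))
        ≈⟨ *-congʳ (F₁-suc L) ⟩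
      (q ^ suc L * f₀′ + (1# - q ^ suc L) * f₁) * u (suc (L ℕ.+ L))
        ≈⟨ solve 4 (λ a f g v → (a :* f :+ (:1 :- a) :* g) :* v := a :* f :* v :+ (:1 :- a) :* (g :* v)) refl _ _ _ _ ⟩
      q ^ suc L * f₀′ * u (suc (L ℕ.+ L)) + (1# - q ^ suc L) * (f₁ * u (suc (L ℕ.+ L)))
        ≈⟨ +-cong (*-congˡ (sym u₂)) (*-congˡ (proj₂ IH)) ⟩
      q ^ suc L * f₀′ * (c₂ * u (suc L ℕ.+ suc L)) + (1# - q ^ suc L) * Y (suc n) L
        ≈⟨ +-cong (solve 4 (λ a b c d → a :* b :* (c :* d) := c :* (a :* (b :* d))) refl _ _ _ _) (sym (V-step (suc n) L)) ⟩
      c₂ * (q ^ suc L * (f₀′ * u (suc L ℕ.+ suc L))) + c₂ * V (suc n) (suc L)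
        ≈⟨ +-congʳ (*-congˡ (*-congˡ X≈)) ⟩
      c₂ * (q ^ suc L * X (suc n) (suc L)) + c₂ * V (suc n) (suc L)
        ≈⟨ solve 3 (λ c x v → c :* x :+ c :* v := c :* (v :+ x)) refl _ _ _ ⟩
      c₂ * (V (suc n) (suc L) + q ^ suc L * X (suc n) (suc L))
        ≈⟨ *-congˡ (Y-split n (suc L) L<n) ⟨
      c₂ * (c₃ * Y (suc n) (suc L)) ∎))
      where
      f₀′ = F 0 (suc L)
      f₁′ = F 1 (suc L)
      f₀ = F 0 L
      f₁ = F 1 L
      L≤n = ℕ.<⇒≤ L<n
      IH = bressoud n L L≤n
      c₂ = 1# - q ^ (suc L ℕ.+ suc L)
      c₃ = 1# - q ^ suc (suc L ℕ.+ suc L)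
      u₂ : c₂ * u (suc L ℕ.+ suc L) ≈ u (suc (L ℕ.+ L))
      u₂ = sym (trans (reflexive (≡.cong u (≡.sym (ℕ.+-suc L L)))) (u-suc (L ℕ.+ suc L)))
      X≈ : f₀′ * u (suc L ℕ.+ suc L) ≈ X (suc n) (suc L)
      X≈ = cancel (L ℕ.+ suc L) (begin
        c₂ * (f₀′ * u (suc L ℕ.+ suc L))
          ≈⟨ trans (solve 3 (λ a b c → a :* (b :* c) := b :* (a :* c)) refl _ _ _) (*-cong (F₀-suc L) u₂) ⟩
        (f₀ + q ^ suc L * f₁) * u (suc (L ℕ.+ L))
          ≈⟨ solve 4 (λ f a g v → (f :+ a :* g) :* v := f :* v :+ a :* (g :* v)) refl _ _ _ _ ⟩
        f₀ * u (suc (L ℕ.+ L)) + q ^ suc L * (f₁ * u (suc (L ℕ.+ L)))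
          ≈⟨ +-cong (odd n L L≤n) (*-congˡ (proj₂ IH)) ⟩
        Z (suc n) L + q ^ suc L * Y (suc n) L
          ≈⟨ X-step n L L≤n ⟨
        c₂ * X (suc n) (suc L) ∎)

  F*u-even : ∀ n L → L ℕ.≤ n → F 0 L * u (dbl L) ≈ X (suc n) L
  F*u-even n L L≤n rewrite dbl≡+ L = proj₁ (bressoud n L L≤n)

  F*u-odd : ∀ n L → L ℕ.≤ n → F 0 L * u (suc (dbl L)) ≈ Z (suc n) L
  F*u-odd n L L≤n rewrite dbl≡+ L = odd n L L≤n

-- Summation over m

double-injective : ∀ {m n} → m ℕ.+ m ≡ n ℕ.+ n → m ≡ n
double-injective {m} {n} eq = ℕ.*-cancelˡ-≡ m n 2 (≡.trans (two m) (≡.trans eq (≡.sym (two n))))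
  where
  two : ∀ m → 2 ℕ.* m ≡ m ℕ.+ m
  two m = ≡.cong (m ℕ.+_) (ℕ.+-identityʳ m)

tri+tri′ : ∀ m n {e} → (m ℕ.* m ℕ.+ m) ℕ.+ (n ℕ.* n ℕ.+ n) ≡ e ℕ.+ e → tri m ℕ.+ tri n ≡ e
tri+tri′ m n eq = double-injective (≡.trans (regroup (tri m) (tri n)) (≡.trans (≡.cong₂ ℕ._+_ (tri+tri m) (tri+tri n)) eq))
  where
  regroup : ∀ s t → s ℕ.+ t ℕ.+ (s ℕ.+ t) ≡ (s ℕ.+ s) ℕ.+ (t ℕ.+ t)
  regroup s t = ℕ-solve (s ∷ t ∷ [])

module Resummation {c ℓ} (K : CommutativeRing c ℓ) (Q : QFactorial K) where
  open CommutativeRing K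
  open QFactorial Q
  open QSeries K Q
  open Bressoud K Q
  open IntegerSolver K
  open FiniteSums K
  open Exp semiring using (_^_)
  open import Relation.Binary.Reasoning.Setoid setoid

  ∑-reverse : ∀ n f → ∑< (suc n) f ≈ ∑< (suc n) (λ i → f (n ∸ i))
  ∑-reverse zero    f = refl
  ∑-reverse (suc n) f = trans (+-congˡ (∑-reverse n f)) (sym (∑-head (suc n) (λ i → f (suc n ∸ i))))

  private
    ∸-+ : ∀ a m d → a ℕ.+ (m ℕ.+ d) ∸ m ≡ a ℕ.+ d
    ∸-+ a m d = ≡.trans (≡.cong (_∸ m) (lem a m d)) (ℕ.m+n∸m≡n m (a ℕ.+ d))
      where
      lem : ∀ a m d → a ℕ.+ (m ℕ.+ d) ≡ m ℕ.+ (a ℕ.+ d)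
      lem a m d = ℕ-solve (a ∷ m ∷ d ∷ [])

    ∸-< : ∀ a c m → c ℕ.< m → m ℕ.≤ a ℕ.+ c → a ℕ.+ c ∸ m ℕ.< a
    ∸-< a c m c<m m≤ = ℕ.+-cancelʳ-< m (a ℕ.+ c ∸ m) a
      (≡.subst (ℕ._< a ℕ.+ m) (≡.sym (ℕ.m∸n+n≡m m≤)) (ℕ.+-monoʳ-< a c<m))

    zero₃ : ∀ {x y z w} → w ≈ 0# → x * (y * (z * w)) ≈ 0#
    zero₃ w≈0 = trans (*-congˡ (trans (*-congˡ (trans (*-congˡ w≈0) (zeroʳ _))) (zeroʳ _))) (zeroʳ _)

  -- For e = 0 and e = 1, u (e + n + a) * um n a is D n a and O n a.
  layer : ∀ e L a E → (∀ d → L ≡ a ℕ.+ d →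
      (e ℕ.+ L ℕ.+ a) ℕ.* (e ℕ.+ L ℕ.+ a) ℕ.+ (e ℕ.+ L ℕ.+ a) ℕ.+ (d ℕ.* d ℕ.+ d) ≡ E ℕ.+ E) →
    ∑< (suc L) (λ m → q ^ (tri m ℕ.+ tri (m ℕ.+ (e ℕ.+ dbl (L ∸ m)))) * (u m * (u (e ℕ.+ (L ∸ m) ℕ.+ a) * um (L ∸ m) a)))
      ≈ q ^ E * (u (e ℕ.+ L ℕ.+ a) * um L a)
  layer e L a E hyp with ℕ.≤-<-connex a L
  ... | inj₂ L<a = trans
    (∑-zero (suc L) (λ m _ → zero₃ (reflexive (um-< (ℕ.≤-<-trans (ℕ.m∸n≤m L m) L<a)))))
    (sym (trans (*-congˡ (trans (*-congˡ (reflexive (um-< L<a))) (zeroʳ _))) (zeroʳ _)))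
  ... | inj₁ a≤L with L ∸ a | ≡.sym (ℕ.m+[n∸m]≡n a≤L)
  ...   | c | ≡.refl = begin
    ∑< (suc (a ℕ.+ c)) _                    ≈⟨ ∑-cong< (suc (a ℕ.+ c)) term ⟩
    ∑< (suc (a ℕ.+ c)) (λ m → q ^ E * (q ^ ((r ∸ m) ℕ.* (c ∸ m)) * (u m * (um r m * um c m))))
                                            ≈⟨ ∑-*ˡ (suc (a ℕ.+ c)) _ _ ⟩
    q ^ E * ∑< (suc (a ℕ.+ c)) (λ m → q ^ ((r ∸ m) ℕ.* (c ∸ m)) * (u m * (um r m * um c m)))
                                            ≈⟨ *-congˡ (vandermonde c r (suc (a ℕ.+ c)) (s≤s (ℕ.m≤n+m c a))) ⟩
    q ^ E * (u r * u c)                     ≈⟨ *-congˡ (*-congˡ (reflexive (um-+ a c))) ⟨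
    q ^ E * (u r * um (a ℕ.+ c) a)          ∎
    where
    r = e ℕ.+ (a ℕ.+ c) ℕ.+ a
    -- Here r + c = e + 2L, and T(m) + T(r+c-m) = T(r) + T(c) + (r-m)(c-m). The hypothesis on E says
    -- E = T(r) + T(c), so what still depends on m is the q-Chu-Vandermonde summand. For m > c both
    -- sides vanish.
    term : ∀ m → m ℕ.< suc (a ℕ.+ c) →
      q ^ (tri m ℕ.+ tri (m ℕ.+ (e ℕ.+ dbl (a ℕ.+ c ∸ m)))) * (u m * (u (e ℕ.+ (a ℕ.+ c ∸ m) ℕ.+ a) * um (a ℕ.+ c ∸ m) a))
        ≈ q ^ E * (q ^ ((r ∸ m) ℕ.* (c ∸ m)) * (u m * (um r m * um c m)))
    term m (s≤s m≤) with ℕ.≤-<-connex m c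
    ... | inj₂ c<m = trans (zero₃ (reflexive (um-< (∸-< a c m c<m m≤))))
      (sym (trans (*-congˡ (zero₃ (reflexive (um-< c<m)))) (zeroʳ _)))
    ... | inj₁ m≤c with c ∸ m | ≡.sym (ℕ.m+[n∸m]≡n m≤c)
    ...   | d | ≡.refl = begin
      q ^ (tri m ℕ.+ tri (m ℕ.+ (e ℕ.+ dbl (a ℕ.+ (m ℕ.+ d) ∸ m)))) * (u m * (u (e ℕ.+ (a ℕ.+ (m ℕ.+ d) ∸ m) ℕ.+ a) * um (a ℕ.+ (m ℕ.+ d) ∸ m) a))
        ≡⟨ ≡.cong (λ k → q ^ (tri m ℕ.+ tri (m ℕ.+ (e ℕ.+ dbl k))) * (u m * (u (e ℕ.+ k ℕ.+ a) * um k a))) (∸-+ a m d) ⟩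
      q ^ (tri m ℕ.+ tri (m ℕ.+ (e ℕ.+ dbl (a ℕ.+ d)))) * (u m * (u (e ℕ.+ (a ℕ.+ d) ℕ.+ a) * um (a ℕ.+ d) a))
        ≈⟨ *-cong (^-split E (r′ ℕ.* d) expo) (*-congˡ (*-congˡ (reflexive (um-+ a d)))) ⟩
      q ^ E * q ^ (r′ ℕ.* d) * (u m * (u r′ * u d))
        ≈⟨ *-assoc _ _ _ ⟩
      q ^ E * (q ^ (r′ ℕ.* d) * (u m * (u r′ * u d)))
        ≈⟨ *-congˡ (*-congˡ (*-congˡ (*-cong
             (reflexive (≡.trans (≡.sym (um-+ m r′)) (≡.cong (λ k → um k m) (≡.sym r≡))))
             (reflexive (≡.sym (um-+ m d)))))) ⟩
      q ^ E * (q ^ (r′ ℕ.* d) * (u m * (um (e ℕ.+ (a ℕ.+ (m ℕ.+ d)) ℕ.+ a) m * um (m ℕ.+ d) m)))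
        ≡⟨ ≡.cong (λ k → q ^ E * (q ^ (k ℕ.* d) * (u m * (um (e ℕ.+ (a ℕ.+ (m ℕ.+ d)) ℕ.+ a) m * um (m ℕ.+ d) m))))
             (≡.trans (≡.sym (ℕ.m+n∸m≡n m r′)) (≡.cong (_∸ m) (≡.sym r≡))) ⟩
      q ^ E * (q ^ ((e ℕ.+ (a ℕ.+ (m ℕ.+ d)) ℕ.+ a ∸ m) ℕ.* d) * (u m * (um (e ℕ.+ (a ℕ.+ (m ℕ.+ d)) ℕ.+ a) m * um (m ℕ.+ d) m))) ∎
      where
      r′ = e ℕ.+ (a ℕ.+ d) ℕ.+ a
      r≡ : e ℕ.+ (a ℕ.+ (m ℕ.+ d)) ℕ.+ a ≡ m ℕ.+ (e ℕ.+ (a ℕ.+ d) ℕ.+ a)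
      r≡ = ℕ-solve (e ∷ a ∷ m ∷ d ∷ [])
      y = m ℕ.+ (e ℕ.+ dbl (a ℕ.+ d))
      quad : ∀ k → k ≡ a ℕ.+ d ℕ.+ (a ℕ.+ d) →
        m ℕ.* m ℕ.+ m ℕ.+ ((m ℕ.+ (e ℕ.+ k)) ℕ.* (m ℕ.+ (e ℕ.+ k)) ℕ.+ (m ℕ.+ (e ℕ.+ k)))
        ≡ (e ℕ.+ (a ℕ.+ (m ℕ.+ d)) ℕ.+ a) ℕ.* (e ℕ.+ (a ℕ.+ (m ℕ.+ d)) ℕ.+ a) ℕ.+ (e ℕ.+ (a ℕ.+ (m ℕ.+ d)) ℕ.+ a) ℕ.+ ((m ℕ.+ d) ℕ.* (m ℕ.+ d) ℕ.+ (m ℕ.+ d))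
          ℕ.+ ((e ℕ.+ (a ℕ.+ d) ℕ.+ a) ℕ.* d ℕ.+ (e ℕ.+ (a ℕ.+ d) ℕ.+ a) ℕ.* d)
      quad k ≡.refl = ℕ-solve (e ∷ a ∷ m ∷ d ∷ [])
      expo : tri m ℕ.+ tri y ≡ E ℕ.+ r′ ℕ.* d
      expo = tri+tri′ m y (≡.trans (quad (dbl (a ℕ.+ d)) (dbl≡+ (a ℕ.+ d)))
        (≡.trans (≡.cong (ℕ._+ (r′ ℕ.* d ℕ.+ r′ ℕ.* d)) (hyp (m ℕ.+ d) ≡.refl)) (regroup E (r′ ℕ.* d))))
        where
        regroup : ∀ x z → x ℕ.+ x ℕ.+ (z ℕ.+ z) ≡ x ℕ.+ z ℕ.+ (x ℕ.+ z)
        regroup x z = ℕ-solve (x ∷ z ∷ [])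

  layer-D : ∀ L a → ∑< (suc L) (λ m → q ^ (tri m ℕ.+ tri (m ℕ.+ dbl (L ∸ m))) * (u m * D (L ∸ m) a))
                    ≈ q ^ (L ℕ.* L ℕ.+ L ℕ.+ a ℕ.* a) * D L a
  layer-D L a = layer 0 L a (L ℕ.* L ℕ.+ L ℕ.+ a ℕ.* a) (λ { d ≡.refl → ℕ-solve (a ∷ d ∷ []) })

  layer-O : ∀ L a → ∑< (suc L) (λ m → q ^ (tri m ℕ.+ tri (m ℕ.+ suc (dbl (L ∸ m)))) * (u m * O (L ∸ m) a))
                    ≈ q ^ (suc L ℕ.* suc L ℕ.+ (a ℕ.* a ℕ.+ a)) * O L a
  layer-O L a = layer 1 L a (suc L ℕ.* suc L ℕ.+ (a ℕ.* a ℕ.+ a)) (λ { d ≡.refl → ℕ-solve (a ∷ d ∷ []) })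

  h : ℕ → ℕ → Carrier
  h M d = ∑< (suc M) (λ L → q ^ (L ℕ.* L) * D L d)

  -- In reversed order, i = M - L, the identity (M-i)² = a² + (M+a-i)(M-a-i) makes this
  -- q-Chu-Vandermonde with r = M + a and s = M - a. It differs from `h` only by the weight
  -- 1/(q)_{M-L}, which tends to a constant.
  D-bailey : ∀ M a → ∑< (suc M) (λ L → q ^ (L ℕ.* L) * (u (M ∸ L) * D L a)) ≈ q ^ (a ℕ.* a) * D M a
  D-bailey M a with ℕ.≤-<-connex a M
  ... | inj₂ M<a = trans
    (∑-zero (suc M) (λ { L (s≤s L≤M) → zero₃ (reflexive (um-< (ℕ.≤-<-trans L≤M M<a))) }))
    (sym (trans (*-congˡ (D-< M<a)) (zeroʳ _)))
  ... | inj₁ a≤M with M ∸ a | ≡.sym (ℕ.m+[n∸m]≡n a≤M)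
  ...   | c | ≡.refl = begin
    ∑< (suc M) (λ L → q ^ (L ℕ.* L) * (u (M ∸ L) * D L a))                        ≈⟨ ∑-reverse M _ ⟩
    ∑< (suc M) (λ i → q ^ ((M ∸ i) ℕ.* (M ∸ i)) * (u (M ∸ (M ∸ i)) * D (M ∸ i) a))   ≈⟨ ∑-cong< (suc M) term ⟩
    ∑< (suc M) (λ i → q ^ (a ℕ.* a) * (q ^ ((r ∸ i) ℕ.* (c ∸ i)) * (u i * (um r i * um c i))))
                                            ≈⟨ ∑-*ˡ (suc M) _ _ ⟩
    q ^ (a ℕ.* a) * ∑< (suc M) (λ i → q ^ ((r ∸ i) ℕ.* (c ∸ i)) * (u i * (um r i * um c i)))
                                            ≈⟨ *-congˡ (vandermonde c r (suc M) (s≤s (ℕ.m≤n+m c a))) ⟩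
    q ^ (a ℕ.* a) * (u r * u c)             ≈⟨ *-congˡ (*-congˡ (reflexive (um-+ a c))) ⟨
    q ^ (a ℕ.* a) * D M a                   ∎
    where
    r = a ℕ.+ c ℕ.+ a
    term : ∀ i → i ℕ.< suc (a ℕ.+ c) →
      q ^ ((a ℕ.+ c ∸ i) ℕ.* (a ℕ.+ c ∸ i)) * (u (a ℕ.+ c ∸ (a ℕ.+ c ∸ i)) * D (a ℕ.+ c ∸ i) a)
        ≈ q ^ (a ℕ.* a) * (q ^ ((r ∸ i) ℕ.* (c ∸ i)) * (u i * (um r i * um c i)))
    term i (s≤s i≤) rewrite ℕ.m∸[m∸n]≡n i≤ with ℕ.≤-<-connex i c
    ... | inj₂ c<i = trans (zero₃ (reflexive (um-< (∸-< a c i c<i i≤))))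
      (sym (trans (*-congˡ (zero₃ (reflexive (um-< c<i)))) (zeroʳ _)))
    ... | inj₁ i≤c with c ∸ i | ≡.sym (ℕ.m+[n∸m]≡n i≤c)
    ...   | d | ≡.refl = begin
      q ^ ((a ℕ.+ (i ℕ.+ d) ∸ i) ℕ.* (a ℕ.+ (i ℕ.+ d) ∸ i)) * (u i * D (a ℕ.+ (i ℕ.+ d) ∸ i) a)
        ≡⟨ ≡.cong (λ k → q ^ (k ℕ.* k) * (u i * D k a)) (∸-+ a i d) ⟩
      q ^ ((a ℕ.+ d) ℕ.* (a ℕ.+ d)) * (u i * D (a ℕ.+ d) a)
        ≈⟨ *-cong (^-split (a ℕ.* a) (r′ ℕ.* d) square) (*-congˡ (*-congˡ (reflexive (um-+ a d)))) ⟩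
      q ^ (a ℕ.* a) * q ^ (r′ ℕ.* d) * (u i * (u r′ * u d))
        ≈⟨ *-assoc _ _ _ ⟩
      q ^ (a ℕ.* a) * (q ^ (r′ ℕ.* d) * (u i * (u r′ * u d)))
        ≈⟨ *-congˡ (*-congˡ (*-congˡ (*-cong
             (reflexive (≡.trans (≡.sym (um-+ i r′)) (≡.cong (λ k → um k i) (≡.sym r≡))))
             (reflexive (≡.sym (um-+ i d)))))) ⟩
      q ^ (a ℕ.* a) * (q ^ (r′ ℕ.* d) * (u i * (um R i * um (i ℕ.+ d) i)))
        ≡⟨ ≡.cong (λ k → q ^ (a ℕ.* a) * (q ^ (k ℕ.* d) * (u i * (um R i * um (i ℕ.+ d) i))))
             (≡.trans (≡.sym (ℕ.m+n∸m≡n i r′)) (≡.cong (_∸ i) (≡.sym r≡))) ⟩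
      q ^ (a ℕ.* a) * (q ^ ((R ∸ i) ℕ.* d) * (u i * (um R i * um (i ℕ.+ d) i))) ∎
      where
      R = a ℕ.+ (i ℕ.+ d) ℕ.+ a
      r′ = a ℕ.+ d ℕ.+ a
      square : (a ℕ.+ d) ℕ.* (a ℕ.+ d) ≡ a ℕ.* a ℕ.+ (a ℕ.+ d ℕ.+ a) ℕ.* d
      square = ℕ-solve (a ∷ d ∷ [])
      r≡ : a ℕ.+ (i ℕ.+ d) ℕ.+ a ≡ i ℕ.+ (a ℕ.+ d ℕ.+ a)
      r≡ = ℕ-solve (a ∷ i ∷ d ∷ [])

-- Assembling the layers of odd and even 2m + k

⌊dbl/2⌋ : ∀ i → ⌊ dbl i /2⌋ ≡ i
⌊dbl/2⌋ zero    = ≡.refl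
⌊dbl/2⌋ (suc i) = ≡.cong suc (⌊dbl/2⌋ i)

⌊suc-dbl/2⌋ : ∀ i → ⌊ suc (dbl i) /2⌋ ≡ i
⌊suc-dbl/2⌋ zero    = ≡.refl
⌊suc-dbl/2⌋ (suc i) = ≡.cong suc (⌊suc-dbl/2⌋ i)

module TripleSum {c ℓ} (K : CommutativeRing c ℓ) (Q : QFactorial K) where
  open CommutativeRing K
  open QFactorial Q
  open QSeries K Q
  open Bressoud K Q
  open Resummation K Q
  open IntegerSolver K
  open FiniteSums K
  open Exp semiring using (_^_; ^-homo-*)
  open import Relation.Binary.Reasoning.Setoid setoid

  -- The layers 2m + k = 2L and 2m + k = 2L + 1. On both of them ⌊k/2⌋ = L - m, so Bressoud's
  -- identity is applied at L - m and the sum over m is one of the sums evaluated by `layer`.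
  even odd : (ℕ → ℕ → Carrier) → ℕ → Carrier
  even g L = ∑< (suc L) (λ m → g m (dbl (L ∸ m)))
  odd  g L = ∑< (suc L) (λ m → g m (suc (dbl (L ∸ m))))

  triangle : (ℕ → ℕ → Carrier) → ℕ → Carrier
  triangle g M = ∑< (suc M) (λ m → ∑< (suc (dbl (M ∸ m))) (g m))

  triangle-suc : ∀ g M → triangle g (suc M) ≈ triangle g M + (odd g M + even g (suc M))
  triangle-suc g M = begin
    ∑< (suc (dbl (M ∸ M))) (g (suc M)) + ∑< (suc M) (λ m → ∑< (suc (dbl (suc M ∸ m))) (g m))
      ≈⟨ +-cong (reflexive (≡.cong (λ k → ∑< (suc (dbl k)) (g (suc M))) (ℕ.n∸n≡0 M))) (∑-cong< (suc M) (λ { m (s≤s m≤M) → row m m≤M })) ⟩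
    g (suc M) 0 + 0# + ∑< (suc M) (λ m → g m (dbl (suc M ∸ m)) + (g m (suc (dbl (M ∸ m))) + ∑< (suc (dbl (M ∸ m))) (g m)))
      ≈⟨ +-congˡ (trans (∑-+ (suc M) _ _) (+-congˡ (∑-+ (suc M) _ _))) ⟩
    g (suc M) 0 + 0# + (∑< (suc M) (λ m → g m (dbl (suc M ∸ m))) + (odd g M + triangle g M))
      ≈⟨ solve 4 (λ a b c d → a :+ :0 :+ (b :+ (c :+ d)) := d :+ (c :+ (a :+ b))) refl _ _ _ _ ⟩
    triangle g M + (odd g M + (g (suc M) 0 + ∑< (suc M) (λ m → g m (dbl (suc M ∸ m)))))
      ≡⟨ ≡.cong (λ k → triangle g M + (odd g M + (g (suc M) (dbl k) + ∑< (suc M) (λ m → g m (dbl (suc M ∸ m)))))) (≡.sym (ℕ.n∸n≡0 M)) ⟩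
    triangle g M + (odd g M + even g (suc M)) ∎
    where
    row : ∀ m → m ℕ.≤ M → ∑< (suc (dbl (suc M ∸ m))) (g m) ≈ g m (dbl (suc M ∸ m)) + (g m (suc (dbl (M ∸ m))) + ∑< (suc (dbl (M ∸ m))) (g m))
    row m m≤M rewrite ℕ.+-∸-assoc 1 m≤M = refl

  -- The sum over n is already carried out: it is the factor `F 0`.
  summand : ℕ → ℕ → Carrier
  summand m k = q ^ (tri m ℕ.+ tri (m ℕ.+ k)) * (u m * (F 0 ⌊ k /2⌋ * u k))

  private
    collect : ∀ n L {E : ℕ → Carrier} {G : ℕ → Carrier} {P P′ : ℕ → Carrier} {f f′ : ℕ → ℕ → Carrier} →
      (∀ m → m ℕ.< suc L → G m ≈ ∑< n (λ i → sgn i * (P i * f m i) - sgn i * (P′ i * f′ m i))) →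
      ∑< (suc L) (λ m → E m * (u m * G m)) ≈
      ∑< n (λ i → sgn i * (P i * ∑< (suc L) (λ m → E m * (u m * f m i)))
                - sgn i * (P′ i * ∑< (suc L) (λ m → E m * (u m * f′ m i))))
    collect n L {E} {G} {P} {P′} {f} {f′} G≈ = begin
      ∑< (suc L) (λ m → E m * (u m * G m))
        ≈⟨ ∑-cong< (suc L) (λ m m< → trans (*-congˡ (*-congˡ (G≈ m m<))) (trans (sym (*-assoc _ _ _)) (sym (∑-*ˡ n (E m * u m) _)))) ⟩
      ∑< (suc L) (λ m → ∑< n (λ i → E m * u m * (sgn i * (P i * f m i) - sgn i * (P′ i * f′ m i))))
        ≈⟨ ∑-swap (suc L) n _ ⟩
      ∑< n (λ i → ∑< (suc L) (λ m → E m * u m * (sgn i * (P i * f m i) - sgn i * (P′ i * f′ m i))))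
        ≈⟨ ∑-cong n (λ i → trans (∑-cong (suc L) (λ m →
             solve 7 (λ e v s p f p′ f′ → e :* v :* (s :* (p :* f) :- s :* (p′ :* f′)) := s :* (p :* (e :* (v :* f))) :- s :* (p′ :* (e :* (v :* f′))))
               refl (E m) (u m) (sgn i) (P i) (f m i) (P′ i) (f′ m i)))
             (trans (∑-minus (suc L) _ _) (+-cong (pull i) (-‿cong (pull i))))) ⟩
      ∑< n (λ i → sgn i * (P i * ∑< (suc L) (λ m → E m * (u m * f m i)))
                - sgn i * (P′ i * ∑< (suc L) (λ m → E m * (u m * f′ m i)))) ∎
      where
      pull : ∀ i {p} {f : ℕ → Carrier} → ∑< (suc L) (λ m → sgn i * (p * f m)) ≈ sgn i * (p * ∑< (suc L) f)
      pull i = trans (∑-*ˡ (suc L) _ _) (*-congˡ (∑-*ˡ (suc L) _ _))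

  even-summand : ∀ n L → L ℕ.≤ n → even summand L ≈ ∑< (suc n) (λ i →
      sgn i * (q ^ e₁ i * (q ^ (L ℕ.* L ℕ.+ L ℕ.+ dbl i ℕ.* dbl i) * D L (dbl i)))
    - sgn i * (q ^ e₂ i * (q ^ (L ℕ.* L ℕ.+ L ℕ.+ dbl (suc i) ℕ.* dbl (suc i)) * D L (dbl (suc i)))))
  even-summand n L L≤n = trans
    (collect (suc n) L (λ m _ → trans (*-congʳ (reflexive (≡.cong (F 0) (⌊dbl/2⌋ (L ∸ m))))) (F*u-even n (L ∸ m) (ℕ.≤-trans (ℕ.m∸n≤m L m) L≤n))))
    (∑-cong (suc n) (λ i → +-cong (*-congˡ (*-congˡ (layer-D L (dbl i)))) (-‿cong (*-congˡ (*-congˡ (layer-D L (dbl (suc i))))))))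

  odd-summand : ∀ n L → L ℕ.≤ n → odd summand L ≈ ∑< (suc n) (λ i →
      sgn i * (q ^ e₁ i * (q ^ (suc L ℕ.* suc L ℕ.+ (dbl i ℕ.* dbl i ℕ.+ dbl i)) * O L (dbl i)))
    - sgn i * (q ^ e₂ i * (q ^ (suc L ℕ.* suc L ℕ.+ (suc (dbl i) ℕ.* suc (dbl i) ℕ.+ suc (dbl i))) * O L (suc (dbl i)))))
  odd-summand n L L≤n = trans
    (collect (suc n) L (λ m _ → trans (*-congʳ (reflexive (≡.cong (F 0) (⌊suc-dbl/2⌋ (L ∸ m))))) (F*u-odd n (L ∸ m) (ℕ.≤-trans (ℕ.m∸n≤m L m) L≤n))))
    (∑-cong (suc n) (λ i → +-cong (*-congˡ (*-congˡ (layer-O L (dbl i)))) (-‿cong (*-congˡ (*-congˡ (layer-O L (suc (dbl i))))))))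

  -- The values of (13j²+5j)/2 at j = i and j = -1 - i, written as they arise: Bressoud's exponent
  -- plus the a² + a of `layer-O` with a = 2i and a = 2i + 1.
  α β : ℕ → ℕ
  α i = e₁ i ℕ.+ (dbl i ℕ.* dbl i ℕ.+ dbl i)
  β i = e₂ i ℕ.+ (suc (dbl i) ℕ.* suc (dbl i) ℕ.+ suc (dbl i))

  private
    -- O at M is (1 - q^(M+1-w)) times D at M + 1. Next to D, the subtracted power q^w q^(M+1-w)
    -- equals q^(M+1), and that is exactly what the even layer adds. `β-step` is the same
    -- cancellation for negative j.
    α-step : ∀ i M → let w = dbl i in
      q ^ e₁ i * (q ^ (suc M ℕ.* suc M ℕ.+ (w ℕ.* w ℕ.+ w)) * O M w)
        + q ^ e₁ i * (q ^ (suc M ℕ.* suc M ℕ.+ suc M ℕ.+ w ℕ.* w) * D (suc M) w)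
      ≈ q ^ α i * (q ^ (suc M ℕ.* suc M) * D (suc M) w)
    α-step i M = begin
      E * (q ^ (S ℕ.+ (w ℕ.* w ℕ.+ w)) * O M w) + E * (q ^ (S ℕ.+ suc M ℕ.+ w ℕ.* w) * Δ)
        ≈⟨ +-cong (*-congˡ (*-cong (trans (^-homo-* q S _) (*-congˡ (^-homo-* q (w ℕ.* w) w))) (O≈D↑ M w)))
                  (*-congˡ (*-congʳ (trans (^-homo-* q (S ℕ.+ suc M) (w ℕ.* w)) (*-congʳ (^-homo-* q S (suc M)))))) ⟩
      E * (q ^ S * (q ^ (w ℕ.* w) * q ^ w) * ((1# - q ^ (suc M ∸ w)) * Δ)) + E * (q ^ S * q ^ suc M * q ^ (w ℕ.* w) * Δ)
        ≈⟨ solve 7 (λ e s p r v m d → e :* (s :* (p :* r) :* ((:1 :- v) :* d)) :+ e :* (s :* m :* p :* d)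
             := e :* (s :* (p :* (r :* d :- d :* (r :* v) :+ d :* m)))) refl E (q ^ S) (q ^ (w ℕ.* w)) (q ^ w) (q ^ (suc M ∸ w)) (q ^ suc M) Δ ⟩
      E * (q ^ S * (q ^ (w ℕ.* w) * (q ^ w * Δ - Δ * (q ^ w * q ^ (suc M ∸ w)) + Δ * q ^ suc M)))
        ≈⟨ *-congˡ (*-congˡ (*-congˡ (+-congʳ (+-congˡ (-‿cong lem))))) ⟩
      E * (q ^ S * (q ^ (w ℕ.* w) * (q ^ w * Δ - Δ * q ^ suc M + Δ * q ^ suc M)))
        ≈⟨ solve 6 (λ e s p r m d → e :* (s :* (p :* (r :* d :- d :* m :+ d :* m))) := (e :* (p :* r)) :* (s :* d)) refl E (q ^ S) (q ^ (w ℕ.* w)) (q ^ w) (q ^ suc M) Δ ⟩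
      E * (q ^ (w ℕ.* w) * q ^ w) * (q ^ S * Δ)
        ≈⟨ *-congʳ (trans (^-homo-* q (e₁ i) (w ℕ.* w ℕ.+ w)) (*-congˡ (^-homo-* q (w ℕ.* w) w))) ⟨
      q ^ α i * (q ^ S * Δ) ∎
      where
      w = dbl i
      S = suc M ℕ.* suc M
      E = q ^ e₁ i
      Δ = D (suc M) w
      lem : Δ * (q ^ w * q ^ (suc M ∸ w)) ≈ Δ * q ^ suc M
      lem = trans (*-congˡ (sym (^-homo-* q w (suc M ∸ w)))) (D-^ (suc M) w (w ℕ.+_) (suc M) (λ d eq → ≡.sym eq))

    β-step : ∀ i M → let v = suc (dbl i); w = suc v in
      q ^ e₂ i * (q ^ (suc M ℕ.* suc M ℕ.+ (v ℕ.* v ℕ.+ v)) * O M v)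
        + q ^ e₂ i * (q ^ (suc M ℕ.* suc M ℕ.+ suc M ℕ.+ w ℕ.* w) * D (suc M) w)
      ≈ q ^ β i * (q ^ (suc M ℕ.* suc M) * D (suc M) w)
    β-step i M = begin
      E * (q ^ (S ℕ.+ W) * O M v) + E * (q ^ (S ℕ.+ suc M ℕ.+ w ℕ.* w) * Δ)
        ≈⟨ +-cong (*-congˡ (*-cong (^-homo-* q S W) (O≈D↑-suc M v)))
                  (*-congˡ (*-congʳ (trans (^-cong-≡ {S ℕ.+ suc M ℕ.+ w ℕ.* w} {S ℕ.+ (W ℕ.+ suc (suc (M ℕ.+ v)))} (expo M (dbl i)))
                                     (trans (^-homo-* q S _) (*-congˡ (^-homo-* q W (suc (suc (M ℕ.+ v))))))))) ⟩
      E * (q ^ S * q ^ W * ((1# - m) * Δ)) + E * (q ^ S * (q ^ W * m) * Δ)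
        ≈⟨ solve 5 (λ e s v m d → e :* (s :* v :* ((:1 :- m) :* d)) :+ e :* (s :* (v :* m) :* d) := e :* v :* (s :* d)) refl E (q ^ S) (q ^ W) m Δ ⟩
      E * q ^ W * (q ^ S * Δ)       ≈⟨ *-congʳ (^-homo-* q (e₂ i) W) ⟨
      q ^ β i * (q ^ S * Δ) ∎
      where
      v = suc (dbl i)
      w = suc v
      S = suc M ℕ.* suc M
      W = v ℕ.* v ℕ.+ v
      E = q ^ e₂ i
      Δ = D (suc M) w
      m = q ^ suc (suc (M ℕ.+ v))
      expo : ∀ M x → suc M ℕ.* suc M ℕ.+ suc M ℕ.+ suc (suc x) ℕ.* suc (suc x)
        ≡ suc M ℕ.* suc M ℕ.+ (suc x ℕ.* suc x ℕ.+ suc x ℕ.+ suc (suc (M ℕ.+ suc x)))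
      expo M x = ℕ-solve (M ∷ x ∷ [])

    D₀ : ∀ e e′ w → (w ≡ 0 → e ≡ e′) → q ^ e * D 0 w ≈ q ^ e′ * D 0 w
    D₀ e e′ zero    eq = *-congʳ (^-cong-≡ {e} {e′} (eq ≡.refl))
    D₀ e e′ (suc w) eq = trans (trans (*-congˡ (zeroʳ _)) (zeroʳ _)) (sym (trans (*-congˡ (zeroʳ _)) (zeroʳ _)))

    α-zero : ∀ i → q ^ e₁ i * (q ^ (0 ℕ.+ dbl i ℕ.* dbl i) * D 0 (dbl i)) ≈ q ^ α i * (q ^ 0 * D 0 (dbl i))
    α-zero i = trans (sym (*-assoc _ _ _)) (trans (*-congʳ (sym (^-homo-* q (e₁ i) (dbl i ℕ.* dbl i))))
      (trans (D₀ (e₁ i ℕ.+ dbl i ℕ.* dbl i) (α i) (dbl i) (λ eq → ≡.cong (e₁ i ℕ.+_) (≡.trans (≡.sym (ℕ.+-identityʳ _)) (≡.cong (dbl i ℕ.* dbl i ℕ.+_) (≡.sym eq)))))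
        (*-congˡ (sym (*-identityˡ _)))))

    β-zero : ∀ i → q ^ e₂ i * (q ^ (0 ℕ.+ dbl (suc i) ℕ.* dbl (suc i)) * D 0 (dbl (suc i))) ≈ q ^ β i * (q ^ 0 * D 0 (dbl (suc i)))
    β-zero i = solve 5 (λ a b c d e → a :* (b :* (c :* :0)) := d :* (e :* (c :* :0))) refl _ _ _ _ _

    regroup : ∀ {s a a′ b b′ x y} → a + a′ ≈ x → b + b′ ≈ y → (s * a - s * b) + (s * a′ - s * b′) ≈ s * x - s * y
    regroup {s} {a} {a′} {b} {b′} p r = trans
      (solve 5 (λ s a a′ b b′ → (s :* a :- s :* b) :+ (s :* a′ :- s :* b′) := s :* (a :+ a′) :- s :* (b :+ b′)) refl s a a′ b b′)
      (+-cong (*-congˡ p) (-‿cong (*-congˡ r)))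

  triangle-summand : ∀ n M → M ℕ.≤ n → triangle summand M ≈
    ∑< (suc n) (λ i → sgn i * (q ^ α i * h M (dbl i)) - sgn i * (q ^ β i * h M (dbl (suc i))))
  triangle-summand n zero _ = begin
    summand 0 0 + 0# + 0#          ≈⟨ +-identityʳ _ ⟩
    even summand 0                 ≈⟨ even-summand n 0 z≤n ⟩
    _                              ≈⟨ ∑-cong (suc n) (λ i → +-cong (*-congˡ (trans (α-zero i) (*-congˡ (sym (+-identityʳ _)))))
                                       (-‿cong (*-congˡ (trans (β-zero i) (*-congˡ (sym (+-identityʳ _))))))) ⟩
    ∑< (suc n) (λ i → sgn i * (q ^ α i * h 0 (dbl i)) - sgn i * (q ^ β i * h 0 (dbl (suc i)))) ∎
  triangle-summand n (suc M) M<n = begin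
    triangle summand (suc M)
      ≈⟨ triangle-suc summand M ⟩
    triangle summand M + (odd summand M + even summand (suc M))
      ≈⟨ +-cong (triangle-summand n M (ℕ.<⇒≤ M<n)) (+-cong (odd-summand n M (ℕ.<⇒≤ M<n)) (even-summand n (suc M) M<n)) ⟩
    _ ≈⟨ trans (∑-+ (suc n) _ _) (+-congˡ (∑-+ (suc n) _ _)) ⟨
    ∑< (suc n) _
      ≈⟨ ∑-cong (suc n) (λ i → trans (+-congˡ (regroup (α-step i M) (β-step i M)))
           (regroup (trans (sym (distribˡ _ _ _)) (*-congˡ (+-comm _ _))) (trans (sym (distribˡ _ _ _)) (*-congˡ (+-comm _ _))))) ⟩
    ∑< (suc n) (λ i → sgn i * (q ^ α i * h (suc M) (dbl i)) - sgn i * (q ^ β i * h (suc M) (dbl (suc i)))) ∎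

-- A finite form of Jacobi's triple product

module FiniteTripleProduct {c ℓ} (K : CommutativeRing c ℓ) (Q : QFactorial K) where
  open CommutativeRing K
  open QFactorial Q
  open QSeries K Q
  open IntegerSolver K
  open FiniteSums K
  open Exp semiring using (_^_; ^-homo-*)
  open import Relation.Binary.Reasoning.Setoid setoid

  -- theta x i is (-1)ⁱ qⁱ⁽ⁱ⁻¹⁾ᐟ² xⁱ.
  theta : Carrier → ℕ → Carrier
  theta x zero    = 1#
  theta x (suc i) = - (theta x i * (x * q ^ i))

  -- The relation x y = q replaces y = q/x: in the application x is q^13 to the base q^21, which
  -- need not be invertible. The terms of negative index are powers of y, so no inverse appears.
  module _ (x y : Carrier) (xy≈q : x * y ≈ q) (px py : ℕ → Carrier)
    (px-zero : px 0 ≈ 1#) (px-suc : ∀ n → px (suc n) ≈ px n * (1# - x * q ^ n))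
    (py-zero : py 0 ≈ 1#) (py-suc : ∀ n → py (suc n) ≈ py n * (1# - y * q ^ n))
    where

    private
      A B : ℕ → Carrier
      A = theta x
      B = theta y

      -- `S` is the bilateral sum belonging to (x)_M (y)_M / (q)_{2M}. `R` is the half-step
      -- (x)_{M+1} (y)_M / (q)_{2M+1}, so that each of `R-step` and `S-step` adds a single linear
      -- factor.
      S R : ℕ → ℕ → Carrier
      S N M = ∑< N (λ i → A i * D M i + B (suc i) * D M (suc i))
      R N M = ∑< N (λ i → A (suc i) * O M i + B i * O M i)

      D-pow : ∀ M i → q ^ (M ∸ i) * D M i * q ^ i ≈ q ^ M * D M i
      D-pow M i = begin
        q ^ (M ∸ i) * D M i * q ^ i     ≈⟨ solve 3 (λ a b c → a :* b :* c := b :* (c :* a)) refl _ _ _ ⟩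
        D M i * (q ^ i * q ^ (M ∸ i))   ≈⟨ *-congˡ (^-homo-* q i (M ∸ i)) ⟨
        D M i * q ^ (i ℕ.+ (M ∸ i))     ≈⟨ D-^ M i (i ℕ.+_) M (λ d eq → ≡.sym eq) ⟩
        D M i * q ^ M                   ≈⟨ *-comm _ _ ⟩
        q ^ M * D M i                   ∎

      O-pow : ∀ M i → q ^ (M ∸ i) * O M i * q ^ i ≈ q ^ M * O M i
      O-pow M i = begin
        q ^ (M ∸ i) * O M i * q ^ i     ≈⟨ solve 3 (λ a b c → a :* b :* c := b :* (c :* a)) refl _ _ _ ⟩
        O M i * (q ^ i * q ^ (M ∸ i))   ≈⟨ *-congˡ (^-homo-* q i (M ∸ i)) ⟨
        O M i * q ^ (i ℕ.+ (M ∸ i))     ≈⟨ O-^ M i (i ℕ.+_) M (λ d eq → ≡.sym eq) ⟩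
        O M i * q ^ M                   ≈⟨ *-comm _ _ ⟩
        q ^ M * O M i                   ∎

      pow : ∀ M i → q ^ suc (M ℕ.+ i) ≈ x * y * (q ^ M * q ^ i)
      pow M i = *-cong (sym xy≈q) (^-homo-* q M i)

      S-shift : ∀ n M → M ℕ.≤ n → S (suc n) M ≈ ∑< (suc n) (λ i → A (suc i) * D M (suc i) + B i * D M i)
      S-shift n M M≤n = begin
        S (suc n) M                               ≈⟨ ∑-+ (suc n) _ _ ⟩
        ∑< (suc n) a + ∑< (suc n) (λ i → b (suc i))   ≈⟨ +-cong (shift a (trans (*-congˡ (D-< (s≤s M≤n))) (zeroʳ _)))
                                                         (trans (solve 2 (λ s b → s := b :+ s :- b) refl _ (b 0)) (+-congʳ (sym (shift b (trans (*-congˡ (D-< (s≤s M≤n))) (zeroʳ _)))))) ⟩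
        (a 0 + ∑< (suc n) (λ i → a (suc i))) + (∑< (suc n) b - b 0)
                                                   ≈⟨ solve 4 (λ a s t b → (a :+ s) :+ (t :- b) := s :+ t :+ (a :- b)) refl _ _ _ _ ⟩
        -- The term of index 0 may be counted in either family, as both thetas start with 1.
        ∑< (suc n) (λ i → a (suc i)) + ∑< (suc n) b + (a 0 - b 0)   ≈⟨ trans (+-congˡ (-‿inverseʳ _)) (+-identityʳ _) ⟩
        ∑< (suc n) (λ i → a (suc i)) + ∑< (suc n) b   ≈⟨ ∑-+ (suc n) _ _ ⟨
        ∑< (suc n) (λ i → A (suc i) * D M (suc i) + B i * D M i) ∎
        where
        a b : ℕ → Carrier
        a i = A i * D M i
        b i = B i * D M i
        shift : ∀ f → f (suc n) ≈ 0# → ∑< (suc n) f ≈ f 0 + ∑< (suc n) (λ i → f (suc i))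
        shift f f≈0 = trans (sym (∑-drop-last (suc n) f f≈0)) (∑-head (suc n) f)

      R-step : ∀ n M → M ℕ.≤ n → (1# - q ^ suc (M ℕ.+ M)) * R (suc n) M ≈ (1# - x * q ^ M) * S (suc n) M
      R-step n M M≤n = begin
        (1# - q ^ suc (M ℕ.+ M)) * R (suc n) M         ≈⟨ ∑-*ˡ (suc n) _ _ ⟨
        ∑< (suc n) (λ i → (1# - q ^ suc (M ℕ.+ M)) * (A (suc i) * O M i + B i * O M i))   ≈⟨ ∑-cong (suc n) term ⟩
        ∑< (suc n) (λ i → (A (suc i) * D M (suc i) + B i * D M i) - x * q ^ M * (A i * D M i + B (suc i) * D M (suc i)))
          ≈⟨ trans (∑-minus (suc n) _ _) (+-cong (sym (S-shift n M M≤n)) (-‿cong (∑-*ˡ (suc n) _ _))) ⟩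
        S (suc n) M - x * q ^ M * S (suc n) M          ≈⟨ solve 2 (λ a s → s :- a :* s := (:1 :- a) :* s) refl _ _ ⟩
        (1# - x * q ^ M) * S (suc n) M                 ∎
        where
        term : ∀ i → (1# - q ^ suc (M ℕ.+ M)) * (A (suc i) * O M i + B i * O M i)
          ≈ (A (suc i) * D M (suc i) + B i * D M i) - x * q ^ M * (A i * D M i + B (suc i) * D M (suc i))
        term i = begin
          κ * (A (suc i) * O M i + B i * O M i)
            ≈⟨ solve 4 (λ k a b o → k :* (a :* o :+ b :* o) := a :* (k :* o) :+ b :* (k :* o)) refl κ (A (suc i)) (B i) (O M i) ⟩
          A (suc i) * (κ * O M i) + B i * (κ * O M i)
            ≈⟨ +-cong (*-congˡ (O-split M i)) (*-congˡ (trans (O-split′ M i) (+-congˡ (*-congʳ (pow M i))))) ⟩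
          A (suc i) * (D M (suc i) + q ^ (M ∸ i) * D M i) + B i * (D M i + x * y * (q ^ M * q ^ i) * D M (suc i))
            ≈⟨ solve 9 (λ a b x y qi qm v d d⁺ →
                 (:- (a :* (x :* qi))) :* (d⁺ :+ v :* d) :+ b :* (d :+ x :* y :* (qm :* qi) :* d⁺) :=
                 ((:- (a :* (x :* qi))) :* d⁺ :+ b :* d) :- (x :* (a :* (v :* d :* qi)) :+ x :* qm :* ((:- (b :* (y :* qi))) :* d⁺)))
                 refl (A i) (B i) x y (q ^ i) (q ^ M) (q ^ (M ∸ i)) (D M i) (D M (suc i)) ⟩
          (A (suc i) * D M (suc i) + B i * D M i) - (x * (A i * (q ^ (M ∸ i) * D M i * q ^ i)) + x * q ^ M * (B (suc i) * D M (suc i)))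
            ≈⟨ +-congˡ (-‿cong (+-congʳ (*-congˡ (*-congˡ (D-pow M i))))) ⟩
          (A (suc i) * D M (suc i) + B i * D M i) - (x * (A i * (q ^ M * D M i)) + x * q ^ M * (B (suc i) * D M (suc i)))
            ≈⟨ +-congˡ (-‿cong (solve 5 (λ x m a d b → x :* (a :* (m :* d)) :+ x :* m :* b := x :* m :* (a :* d :+ b)) refl x (q ^ M) (A i) (D M i) _)) ⟩
          (A (suc i) * D M (suc i) + B i * D M i) - x * q ^ M * (A i * D M i + B (suc i) * D M (suc i)) ∎
          where κ = 1# - q ^ suc (M ℕ.+ M)

      S-step : ∀ n M → M ℕ.< n → (1# - q ^ (suc M ℕ.+ suc M)) * S (suc n) (suc M) ≈ (1# - y * q ^ M) * R (suc n) M
      S-step n M M<n = begin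
        κ * S N (suc M)
          ≈⟨ *-congˡ S≈ ⟩
        κ * (D (suc M) 0 + ∑< N (λ i → A (suc i) * D (suc M) (suc i) + B (suc i) * D (suc M) (suc i)))
          ≈⟨ trans (distribˡ _ _ _) (+-congˡ (sym (∑-*ˡ N κ _))) ⟩
        κ * D (suc M) 0 + ∑< N (λ i → κ * (A (suc i) * D (suc M) (suc i) + B (suc i) * D (suc M) (suc i)))
          ≈⟨ +-cong head (trans (∑-cong N term) (trans (∑-minus N _ _) (+-cong (∑-+ N _ _) (-‿cong (trans (∑-*ˡ N _ _) (*-congˡ (∑-+ N _ _))))))) ⟩
        (b 0 - y * q ^ M * a 0) + (∑< N a + ∑< N (λ i → b (suc i)) - y * q ^ M * (∑< N (λ i → a (suc i)) + ∑< N b))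
          ≈⟨ solve 7 (λ b₀ z a₀ a b⁺ a⁺ b → (b₀ :- z :* a₀) :+ (a :+ b⁺ :- z :* (a⁺ :+ b)) := (a :+ (b₀ :+ b⁺)) :- z :* ((a₀ :+ a⁺) :+ b))
               refl (b 0) (y * q ^ M) (a 0) (∑< N a) (∑< N (λ i → b (suc i))) (∑< N (λ i → a (suc i))) (∑< N b) ⟩
        (∑< N a + (b 0 + ∑< N (λ i → b (suc i)))) - y * q ^ M * ((a 0 + ∑< N (λ i → a (suc i))) + ∑< N b)
          ≈⟨ +-cong (+-congˡ (extend b (trans (*-congˡ (O-< M<N)) (zeroʳ _)))) (-‿cong (*-congˡ (+-congʳ (extend a (trans (*-congˡ (O-< M<N)) (zeroʳ _)))))) ⟩
        (∑< N a + ∑< N b) - y * q ^ M * (∑< N a + ∑< N b)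
          ≈⟨ solve 2 (λ z s → s :- z :* s := (:1 :- z) :* s) refl _ _ ⟩
        (1# - y * q ^ M) * (∑< N a + ∑< N b)
          ≈⟨ *-congˡ (∑-+ N a b) ⟨
        (1# - y * q ^ M) * R N M ∎
        where
        N = suc n
        κ = 1# - q ^ (suc M ℕ.+ suc M)
        a b : ℕ → Carrier
        a i = A (suc i) * O M i
        b i = B i * O M i
        M<N : M ℕ.< N
        M<N = ℕ.m≤n⇒m≤1+n M<n
        extend : ∀ f → f N ≈ 0# → f 0 + ∑< N (λ i → f (suc i)) ≈ ∑< N f
        extend f f≈0 = trans (sym (∑-head N f)) (∑-drop-last N f f≈0)
        S≈ : S N (suc M) ≈ D (suc M) 0 + ∑< N (λ i → A (suc i) * D (suc M) (suc i) + B (suc i) * D (suc M) (suc i))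
        S≈ = begin
          S N (suc M)                        ≈⟨ ∑-+ N _ _ ⟩
          ∑< N f + ∑< N (λ i → B (suc i) * D (suc M) (suc i))
            ≈⟨ +-congʳ (extend f (trans (*-congˡ (D-< (s≤s M<n))) (zeroʳ _))) ⟨
          1# * D (suc M) 0 + ∑< N (λ i → f (suc i)) + ∑< N (λ i → B (suc i) * D (suc M) (suc i))
            ≈⟨ trans (+-assoc _ _ _) (+-cong (*-identityˡ _) (sym (∑-+ N _ _))) ⟩
          D (suc M) 0 + ∑< N (λ i → A (suc i) * D (suc M) (suc i) + B (suc i) * D (suc M) (suc i)) ∎
          where
          f : ℕ → Carrier
          f i = A i * D (suc M) i
        head : κ * D (suc M) 0 ≈ b 0 - y * q ^ M * a 0
        head = begin
          κ * D (suc M) 0                         ≈⟨ D↑-split₀ M ⟩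
          O M 0 + q * q ^ M * O M 0               ≈⟨ +-congˡ (*-congʳ (*-congʳ (sym xy≈q))) ⟩
          O M 0 + x * y * q ^ M * O M 0
            ≈⟨ solve 4 (λ x y m o → o :+ x :* y :* m :* o := :1 :* o :- y :* m :* ((:- (:1 :* (x :* :1))) :* o)) refl x y (q ^ M) (O M 0) ⟩
          b 0 - y * q ^ M * a 0 ∎
        term : ∀ i → κ * (A (suc i) * D (suc M) (suc i) + B (suc i) * D (suc M) (suc i))
          ≈ (a i + b (suc i)) - y * q ^ M * (a (suc i) + b i)
        term i = begin
          κ * (A (suc i) * Δ + B (suc i) * Δ)
            ≈⟨ solve 4 (λ k a b o → k :* (a :* o :+ b :* o) := a :* (k :* o) :+ b :* (k :* o)) refl κ (A (suc i)) (B (suc i)) Δ ⟩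
          A (suc i) * (κ * Δ) + B (suc i) * (κ * Δ)
            ≈⟨ +-cong (*-congˡ (trans (D↑-split′ M i) (+-congˡ (*-congʳ (trans (^-cong-≡ {suc (suc (M ℕ.+ i))} {suc (M ℕ.+ suc i)} (≡.cong suc (≡.sym (ℕ.+-suc M i)))) (pow M (suc i)))))))
                      (*-congˡ (D↑-split M i)) ⟩
          A (suc i) * (O M i + x * y * (q ^ M * q ^ suc i) * O M (suc i)) + B (suc i) * (O M (suc i) + q ^ (M ∸ i) * O M i)
            ≈⟨ solve 10 (λ a b x y qi qs qm v o o⁺ →
                 a :* (o :+ x :* y :* (qm :* qs) :* o⁺) :+ (:- (b :* (y :* qi))) :* (o⁺ :+ v :* o) :=
                 (a :* o :+ (:- (b :* (y :* qi))) :* o⁺) :- (y :* qm :* ((:- (a :* (x :* qs))) :* o⁺) :+ y :* (b :* (v :* o :* qi))))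
                 refl (A (suc i)) (B i) x y (q ^ i) (q ^ suc i) (q ^ M) (q ^ (M ∸ i)) (O M i) (O M (suc i)) ⟩
          (a i + b (suc i)) - (y * q ^ M * a (suc i) + y * (B i * (q ^ (M ∸ i) * O M i * q ^ i)))
            ≈⟨ +-congˡ (-‿cong (+-congˡ (*-congˡ (*-congˡ (O-pow M i))))) ⟩
          (a i + b (suc i)) - (y * q ^ M * a (suc i) + y * (B i * (q ^ M * O M i)))
            ≈⟨ +-congˡ (-‿cong (solve 5 (λ y m a b o → y :* m :* a :+ y :* (b :* (m :* o)) := y :* m :* (a :+ b :* o)) refl y (q ^ M) (a (suc i)) (B i) (O M i))) ⟩
          (a i + b (suc i)) - y * q ^ M * (a (suc i) + b i) ∎
          where Δ = D (suc M) (suc i)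

    triple-product : ∀ n M → M ℕ.≤ n → px M * py M * u (M ℕ.+ M) ≈
      ∑< (suc n) (λ i → theta x i * D M i + theta y (suc i) * D M (suc i))
    triple-product n zero _ = begin
      px 0 * py 0 * u 0               ≈⟨ *-cong (*-cong px-zero py-zero) u-zero ⟩
      1# * 1# * 1#                    ≈⟨ solve 1 (λ b → :1 :* :1 :* :1 := :1 :* (:1 :* :1) :+ b :* :0) refl (B 1) ⟩
      1# * (1# * 1#) + B 1 * 0#       ≈⟨ +-cong (*-congˡ (*-cong u-zero u-zero)) (*-congˡ (D-< {0} {1} (s≤s z≤n))) ⟨
      A 0 * D 0 0 + B 1 * D 0 1       ≈⟨ ∑-only-head n _ (λ i → trans (+-cong (*-congˡ (D-< {0} {suc i} (s≤s z≤n))) (*-congˡ (D-< {0} {suc (suc i)} (s≤s z≤n))))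
                                           (solve 2 (λ a b → a :* :0 :+ b :* :0 := :0) refl _ _)) ⟨
      S (suc n) 0                     ∎
    triple-product n (suc M) M<n = cancel (M ℕ.+ suc M) (cancel (M ℕ.+ M) (begin
      κ * (κ′ * (px (suc M) * py (suc M) * u (suc M ℕ.+ suc M)))
        ≈⟨ *-congˡ (*-congˡ (*-congʳ (*-cong (px-suc M) (py-suc M)))) ⟩
      κ * (κ′ * (px M * (1# - x * q ^ M) * (py M * (1# - y * q ^ M)) * u (suc M ℕ.+ suc M)))
        ≈⟨ solve 7 (λ k k′ p s r t v → k :* (k′ :* (p :* s :* (r :* t) :* v)) := t :* (s :* (p :* r :* (k :* (k′ :* v))))) refl κ κ′ _ _ _ _ _ ⟩
      (1# - y * q ^ M) * ((1# - x * q ^ M) * (px M * py M * (κ * (κ′ * u (suc M ℕ.+ suc M)))))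
        ≈⟨ *-congˡ (*-congˡ (*-congˡ u₂)) ⟨
      (1# - y * q ^ M) * ((1# - x * q ^ M) * (px M * py M * u (M ℕ.+ M)))
        ≈⟨ *-congˡ (*-congˡ (triple-product n M (ℕ.<⇒≤ M<n))) ⟩
      (1# - y * q ^ M) * ((1# - x * q ^ M) * S (suc n) M)
        ≈⟨ *-congˡ (R-step n M (ℕ.<⇒≤ M<n)) ⟨
      (1# - y * q ^ M) * (κ * R (suc n) M)
        ≈⟨ solve 3 (λ a b c → a :* (b :* c) := b :* (a :* c)) refl _ _ _ ⟩
      κ * ((1# - y * q ^ M) * R (suc n) M)
        ≈⟨ *-congˡ (S-step n M M<n) ⟨
      κ * (κ′ * S (suc n) (suc M)) ∎))
      where
      κ = 1# - q ^ suc (M ℕ.+ M)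
      κ′ = 1# - q ^ (suc M ℕ.+ suc M)
      u₂ : u (M ℕ.+ M) ≈ κ * (κ′ * u (suc M ℕ.+ suc M))
      u₂ = trans (u-suc (M ℕ.+ M)) (*-congˡ (trans (reflexive (≡.cong u (≡.sym (ℕ.+-suc M M)))) (u-suc (M ℕ.+ suc M))))

-- Ordered fields

module Order {c ℓ₁ ℓ₂} (F : OrderedField c ℓ₁ ℓ₂) where
  open OrderedField F
  open OrderedFieldProperties F
    using (realRing; <-irrefl; <-trans; <-respˡ; <-respʳ; <-cotrans; x<y⇒0<y-x; 0<1; inverse; *-cancel-pos; +-pos; *-#0ˡ)
  open CommutativeRing realRing using (semiring) public
  open IntegerSolver realRing
  open Exp semiring using (_^_; ^-homo-*)
  open import Relation.Binary.Reasoning.Setoid setoid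

  infix 4 _≤_
  -- The negated form needs no decision of the order: to prove it, a strict opposite inequality is
  -- assumed and refuted.
  _≤_ : Carrier → Carrier → Set ℓ₂
  x ≤ y = ¬ (y < x)

  ≤-reflexive : ∀ {x y} → x ≈ y → x ≤ y
  ≤-reflexive x≈y y<x = <-irrefl (sym x≈y) y<x

  ≤-refl : ∀ {x} → x ≤ x
  ≤-refl = ≤-reflexive refl

  <⇒≤ : ∀ {x y} → x < y → x ≤ y
  <⇒≤ x<y y<x = <-irrefl refl (<-trans x<y y<x)

  ≤-trans : ∀ {x y z} → x ≤ y → y ≤ z → x ≤ z
  ≤-trans {x} {y} x≤y y≤z z<x with <-cotrans z<x y
  ... | inj₁ z<y = y≤z z<y
  ... | inj₂ y<x = x≤y y<x

  <-≤-trans : ∀ {x y z} → x < y → y ≤ z → x < z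
  <-≤-trans {x} {y} {z} x<y y≤z with <-cotrans x<y z
  ... | inj₁ x<z = x<z
  ... | inj₂ z<y = contradiction z<y y≤z

  ≤-<-trans : ∀ {x y z} → x ≤ y → y < z → x < z
  ≤-<-trans {x} {y} {z} x≤y y<z with <-cotrans y<z x
  ... | inj₁ y<x = contradiction y<x x≤y
  ... | inj₂ x<z = x<z

  ≤-resp : ∀ {x x′ y y′} → x ≈ x′ → y ≈ y′ → x ≤ y → x′ ≤ y′
  ≤-resp p r x≤y y′<x′ = x≤y (<-respˡ (sym r) (<-respʳ (sym p) y′<x′))

  +-cancelʳ-< : ∀ {x y} z → x + z < y + z → x < y
  +-cancelʳ-< {x} {y} z lt = <-respˡ (lem x) (<-respʳ (lem y) (+-monoˡ-< (- z) lt))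
    where
    lem : ∀ x → x + z + - z ≈ x
    lem x = solve 2 (λ x z → x :+ z :- z := x) refl x z

  +-monoʳ-≤ : ∀ {x y} z → x ≤ y → x + z ≤ y + z
  +-monoʳ-≤ z x≤y lt = x≤y (+-cancelʳ-< z lt)

  +-mono-≤ : ∀ {x y u v} → x ≤ y → u ≤ v → x + u ≤ y + v
  +-mono-≤ {x} {y} {u} {v} p r = ≤-trans (+-monoʳ-≤ u p) (≤-resp (+-comm u y) (+-comm v y) (+-monoʳ-≤ y r))

  0≤y-x : ∀ {x y} → x ≤ y → 0# ≤ y - x
  0≤y-x {x} {y} x≤y = ≤-resp (-‿inverseʳ x) refl (+-monoʳ-≤ (- x) x≤y)

  0≤y-x⇒x≤y : ∀ {x y} → 0# ≤ y - x → x ≤ y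
  0≤y-x⇒x≤y {x} {y} p = ≤-resp (+-identityˡ x) (solve 2 (λ x y → y :- x :+ x := y) refl x y) (+-monoʳ-≤ x p)

  0<y-x⇒x<y : ∀ {x y} → 0# < y - x → x < y
  0<y-x⇒x<y {x} {y} p = <-respˡ (+-identityˡ x) (<-respʳ (solve 2 (λ x y → y :- x :+ x := y) refl x y) (+-monoˡ-< x p))

  0≤⇒#0⇒0< : ∀ {x} → 0# ≤ x → x # 0# → 0# < x
  0≤⇒#0⇒0< 0≤x x#0 with #⇒<⊎> x#0
  ... | inj₁ x<0 = contradiction x<0 0≤x
  ... | inj₂ 0<x = 0<x

  -- If x y were negative it would be apart from 0, hence so would x and y. Being nonnegative, both
  -- would be positive, and so would their product.
  *-nonneg : ∀ {x y} → 0# ≤ x → 0# ≤ y → 0# ≤ x * y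
  *-nonneg {x} {y} 0≤x 0≤y xy<0 = <-irrefl refl (<-trans xy<0
    (*-pos (0≤⇒#0⇒0< 0≤x (*-#0ˡ xy#0)) (0≤⇒#0⇒0< 0≤y (*-#0ˡ (<⇒# (<-respˡ (*-comm x y) xy<0))))))
    where xy#0 = <⇒# xy<0

  +-nonneg : ∀ {x y} → 0# ≤ x → 0# ≤ y → 0# ≤ x + y
  +-nonneg p r = ≤-resp (+-identityˡ 0#) refl (+-mono-≤ p r)

  *-monoʳ-≤ : ∀ {x y z} → 0# ≤ z → x ≤ y → x * z ≤ y * z
  *-monoʳ-≤ {x} {y} {z} 0≤z x≤y = 0≤y-x⇒x≤y (≤-resp refl
    (solve 3 (λ x y z → (y :- x) :* z := y :* z :- x :* z) refl x y z) (*-nonneg (0≤y-x x≤y) 0≤z))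

  *-monoˡ-≤ : ∀ {x y z} → 0# ≤ z → x ≤ y → z * x ≤ z * y
  *-monoˡ-≤ p r = ≤-resp (*-comm _ _) (*-comm _ _) (*-monoʳ-≤ p r)

  *-mono-≤ : ∀ {x y u v} → 0# ≤ u → 0# ≤ y → x ≤ y → u ≤ v → x * u ≤ y * v
  *-mono-≤ 0≤u 0≤y x≤y u≤v = ≤-trans (*-monoʳ-≤ 0≤u x≤y) (*-monoˡ-≤ 0≤y u≤v)

  *-cancel-≤ : ∀ {x y z} → 0# < z → x * z ≤ y * z → x ≤ y
  *-cancel-≤ {x} {y} {z} 0<z p y<x = p (0<y-x⇒x<y
    (<-respʳ (solve 3 (λ x y z → (x :- y) :* z := x :* z :- y :* z) refl x y z) (*-pos (x<y⇒0<y-x y<x) 0<z)))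

  square-mono-< : ∀ {x y} → 0# ≤ x → x < y → x * x < y * y
  square-mono-< {x} {y} 0≤x x<y = 0<y-x⇒x<y (<-respʳ
    (solve 2 (λ x y → (y :- x) :* (x :+ y) := y :* y :- x :* x) refl x y)
    (*-pos (x<y⇒0<y-x x<y) (<-≤-trans (≤-<-trans 0≤x x<y) (≤-resp (+-identityˡ y) refl (+-monoʳ-≤ y 0≤x)))))

  square-cancel-≤ : ∀ {x y} → 0# ≤ y → x * x ≤ y * y → x ≤ y
  square-cancel-≤ 0≤y p y<x = p (square-mono-< 0≤y y<x)

  0≤1 : 0# ≤ 1#
  0≤1 = <⇒≤ 0<1

  abstract
    inverse-pos : ∀ {x} → 0# < x → ∃[ y ] (0# < y × y * x ≈ 1#)
    inverse-pos {x} 0<x = let y , xy≈1 = inverse (#-sym (<⇒# 0<x)) ; yx≈1 = trans (*-comm y x) xy≈1 in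
      y , *-cancel-pos (<-respʳ (sym yx≈1) 0<1) 0<x , yx≈1

  module Powers (ρ : Carrier) (0<ρ : 0# < ρ) (ρ<1 : ρ < 1#) where

    ρ≤1 : ρ ≤ 1#
    ρ≤1 = <⇒≤ ρ<1

    0<ρ^ : ∀ n → 0# < ρ ^ n
    0<ρ^ zero    = 0<1
    0<ρ^ (suc n) = *-pos 0<ρ (0<ρ^ n)

    0≤ρ^ : ∀ n → 0# ≤ ρ ^ n
    0≤ρ^ n = <⇒≤ (0<ρ^ n)

    ρ^≤1 : ∀ n → ρ ^ n ≤ 1#
    ρ^≤1 zero    = ≤-refl
    ρ^≤1 (suc n) = ≤-resp refl (*-identityˡ 1#) (*-mono-≤ (0≤ρ^ n) 0≤1 ρ≤1 (ρ^≤1 n))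

    ρ^-anti : ∀ {m n} → m ℕ.≤ n → ρ ^ n ≤ ρ ^ m
    ρ^-anti {_} {n} z≤n = ρ^≤1 n
    ρ^-anti (s≤s m≤n)   = *-monoˡ-≤ (<⇒≤ 0<ρ) (ρ^-anti m≤n)

    κ : Carrier
    κ = proj₁ (inverse-pos (x<y⇒0<y-x ρ<1))

    0<κ : 0# < κ
    0<κ = proj₁ (proj₂ (inverse-pos (x<y⇒0<y-x ρ<1)))

    κ*[1-ρ] : κ * (1# - ρ) ≈ 1#
    κ*[1-ρ] = proj₂ (proj₂ (inverse-pos (x<y⇒0<y-x ρ<1)))

    -- 1 + ρ + ⋯ + ρⁿ⁻¹
    geom : ℕ → Carrier
    geom n = κ - κ * ρ ^ n

    geom-suc : ∀ n → ρ ^ n + geom n ≈ geom (suc n)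
    geom-suc n = begin
      ρ ^ n + geom n                       ≈⟨ +-congʳ (*-identityˡ _) ⟨
      1# * ρ ^ n + geom n                  ≈⟨ +-congʳ (*-congʳ κ*[1-ρ]) ⟨
      κ * (1# - ρ) * ρ ^ n + geom n        ≈⟨ solve 3 (λ k r p → k :* (:1 :- r) :* p :+ (k :- k :* p) := k :- k :* (r :* p)) refl κ ρ (ρ ^ n) ⟩
      geom (suc n)                         ∎

    geom-zero : geom 0 ≈ 0#
    geom-zero = solve 1 (λ k → k :- k :* :1 := :0) refl κ

    geom≤κ : ∀ n → geom n ≤ κ
    geom≤κ n = ≤-resp (+-comm _ _) (+-identityˡ κ) (+-monoʳ-≤ κ
      (≤-resp (solve 1 (λ x → :0 :- x := :- x) refl _) (-‿inverseʳ (κ * ρ ^ n)) (+-monoʳ-≤ (- (κ * ρ ^ n)) (*-nonneg (<⇒≤ 0<κ) (0≤ρ^ n)))))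

    -- Each of the n powers summed in `geom n` is at least ρ^n. As `geom n` stays below κ, this
    -- gives ρ^n = O(1/n), which is all that the Archimedean axiom requires.
    fromℕ-*ρ^ : ∀ n → fromℕ n * ρ ^ n ≤ geom n
    fromℕ-*ρ^ zero    = ≤-reflexive (trans (zeroˡ _) (sym geom-zero))
    fromℕ-*ρ^ (suc n) = ≤-trans (≤-reflexive (solve 3 (λ f r p → (:1 :+ f) :* (r :* p) := r :* (p :+ f :* p)) refl (fromℕ n) ρ (ρ ^ n)))
      (≤-trans (*-monoʳ-≤ (+-nonneg (0≤ρ^ n) (*-nonneg (0≤fromℕ n) (0≤ρ^ n))) ρ≤1)
      (≤-resp (sym (*-identityˡ _)) (trans (+-comm _ _) (geom-suc n)) (≤-resp (+-comm _ _) refl (+-monoʳ-≤ (ρ ^ n) (fromℕ-*ρ^ n)))))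
      where
      0≤fromℕ : ∀ n → 0# ≤ fromℕ n
      0≤fromℕ zero    = ≤-refl
      0≤fromℕ (suc n) = +-nonneg 0≤1 (0≤fromℕ n)

    ρ^-small : (∀ x → ∃[ n ] x < fromℕ n) → ∀ ε → 0# < ε → ∃[ N ] ρ ^ N < ε
    ρ^-small archimedean ε 0<ε = N , 0<y-x⇒x<y (*-cancel-pos
      (<-respʳ (solve 3 (λ e f p → f :* e :- f :* p := (e :- p) :* f) refl ε (fromℕ N) (ρ ^ N)) (x<y⇒0<y-x lt))
      0<N)
      where
      inv = inverse-pos 0<ε
      ε⁻¹ = proj₁ inv
      0<ε⁻¹ = proj₁ (proj₂ inv)
      -- N exceeds κ/ε, so N ρ^N ≤ κ < N ε, and the positive factor N is cancelled.
      N = proj₁ (archimedean (κ * ε⁻¹))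
      κε⁻¹<N : κ * ε⁻¹ < fromℕ N
      κε⁻¹<N = proj₂ (archimedean (κ * ε⁻¹))
      0<N : 0# < fromℕ N
      0<N = <-trans (*-pos 0<κ 0<ε⁻¹) κε⁻¹<N
      lt : fromℕ N * ρ ^ N < fromℕ N * ε
      lt = ≤-<-trans (≤-trans (fromℕ-*ρ^ N) (geom≤κ N)) (0<y-x⇒x<y (<-respʳ
        (begin
          (fromℕ N - κ * ε⁻¹) * ε          ≈⟨ solve 4 (λ n k i e → (n :- k :* i) :* e := n :* e :- k :* (i :* e)) refl (fromℕ N) κ ε⁻¹ ε ⟩
          fromℕ N * ε - κ * (ε⁻¹ * ε)      ≈⟨ +-congˡ (-‿cong (trans (*-congˡ (proj₂ (proj₂ inv))) (*-identityʳ κ))) ⟩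
          fromℕ N * ε - κ                  ∎)
        (*-pos (x<y⇒0<y-x κε⁻¹<N) 0<ε)))

    -- (ρ;ρ)_n and (-ρ;ρ)_n, the extreme values that |(q)_n| can take for |q| ≤ ρ. The first
    -- controls 1/(q)_n from above, the second controls (a;q)_n for |a| ≤ ρ.
    euler⁻ euler⁺ : ℕ → Carrier
    euler⁻ zero    = 1#
    euler⁻ (suc n) = euler⁻ n * (1# - ρ ^ suc n)
    euler⁺ zero    = 1#
    euler⁺ (suc n) = euler⁺ n * (1# + ρ ^ suc n)

    ρ^<1 : ∀ n → ρ ^ suc n < 1#
    ρ^<1 n = ≤-<-trans (≤-resp refl (*-identityʳ ρ) (*-monoˡ-≤ (<⇒≤ 0<ρ) (ρ^≤1 n))) ρ<1

    0<euler⁻ : ∀ n → 0# < euler⁻ n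
    0<euler⁻ zero    = 0<1
    0<euler⁻ (suc n) = *-pos (0<euler⁻ n) (x<y⇒0<y-x (ρ^<1 n))

    0<euler⁺ : ∀ n → 0# < euler⁺ n
    0<euler⁺ zero    = 0<1
    0<euler⁺ (suc n) = *-pos (0<euler⁺ n) (+-pos 0<1 (0<ρ^ (suc n)))

    euler⁻-anti : ∀ n d → euler⁻ (n ℕ.+ d) ≤ euler⁻ n
    euler⁻-anti n zero    rewrite ℕ.+-identityʳ n = ≤-refl
    euler⁻-anti n (suc d) rewrite ℕ.+-suc n d = ≤-trans
      (≤-resp refl (*-identityʳ _) (*-monoˡ-≤ (<⇒≤ (0<euler⁻ (n ℕ.+ d)))
        (0≤y-x⇒x≤y (≤-resp refl (solve 1 (λ x → x := :1 :- (:1 :- x)) refl _) (0≤ρ^ (suc (n ℕ.+ d)))))))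
      (euler⁻-anti n d)

    euler⁺*euler⁻≤1 : ∀ n → euler⁺ n * euler⁻ n ≤ 1#
    euler⁺*euler⁻≤1 zero    = ≤-reflexive (*-identityˡ 1#)
    euler⁺*euler⁻≤1 (suc n) = ≤-resp
      (solve 3 (λ a b x → a :* b :* ((:1 :+ x) :* (:1 :- x)) := a :* (:1 :+ x) :* (b :* (:1 :- x))) refl (euler⁺ n) (euler⁻ n) (ρ ^ suc n))
      (*-identityˡ 1#)
      (*-mono-≤ (*-nonneg (+-nonneg 0≤1 (0≤ρ^ (suc n))) (<⇒≤ (x<y⇒0<y-x (ρ^<1 n)))) 0≤1 (euler⁺*euler⁻≤1 n)
        (0≤y-x⇒x≤y (≤-resp refl (solve 1 (λ x → x :* x := :1 :- (:1 :+ x) :* (:1 :- x)) refl (ρ ^ suc n)) (*-nonneg (0≤ρ^ (suc n)) (0≤ρ^ (suc n))))))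

    -- From (1 - a)(1 - b) ≥ 1 - a - b: once ρ^(J+1) < 1 - ρ, the remaining
    -- factors of (ρ;ρ)_∞ have a product bounded below.
    euler⁻-lower : ∀ J d → euler⁻ J * (1# - ρ - ρ ^ suc J * (1# - ρ ^ d)) ≤ euler⁻ (J ℕ.+ d) * (1# - ρ)
    euler⁻-lower J zero rewrite ℕ.+-identityʳ J = ≤-reflexive (*-congˡ (solve 2 (λ r p → :1 :- r :- p :* (:1 :- :1) := :1 :- r) refl ρ (ρ ^ suc J)))
    euler⁻-lower J (suc d) rewrite ℕ.+-suc J d = ≤-trans
      (0≤y-x⇒x≤y (≤-resp refl eq (*-nonneg (*-nonneg (<⇒≤ (0<euler⁻ J)) (0≤ρ^ (suc J)))
        (*-nonneg (0≤y-x (ρ^≤1 d)) (0≤ρ^ (suc (J ℕ.+ d)))))))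
      (≤-resp refl (solve 3 (λ e r x → e :* (:1 :- r) :* (:1 :- x) := e :* (:1 :- x) :* (:1 :- r)) refl (euler⁻ (J ℕ.+ d)) ρ (ρ ^ suc (J ℕ.+ d)))
        (*-monoʳ-≤ (0≤y-x (ρ^≤1 (suc (J ℕ.+ d)))) (euler⁻-lower J d)))
      where
      eq : euler⁻ J * ρ ^ suc J * ((1# - ρ ^ d) * ρ ^ suc (J ℕ.+ d)) ≈
           euler⁻ J * (1# - ρ - ρ ^ suc J * (1# - ρ ^ d)) * (1# - ρ ^ suc (J ℕ.+ d)) - euler⁻ J * (1# - ρ - ρ ^ suc J * (1# - ρ ^ suc d))
      eq = begin
        euler⁻ J * ρ ^ suc J * ((1# - ρ ^ d) * ρ ^ suc (J ℕ.+ d))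
          ≈⟨ *-congˡ (*-congˡ (*-congˡ (^-homo-* ρ J d))) ⟩
        euler⁻ J * ρ ^ suc J * ((1# - ρ ^ d) * (ρ * (ρ ^ J * ρ ^ d)))
          ≈⟨ solve 4 (λ e r a b → e :* (r :* a) :* ((:1 :- b) :* (r :* (a :* b))) :=
               e :* (:1 :- r :- r :* a :* (:1 :- b)) :* (:1 :- r :* (a :* b)) :- e :* (:1 :- r :- r :* a :* (:1 :- r :* b))) refl (euler⁻ J) ρ (ρ ^ J) (ρ ^ d) ⟩
        _ ≈⟨ +-congʳ (*-congˡ (+-congˡ (-‿cong (*-congˡ (^-homo-* ρ J d))))) ⟨
        euler⁻ J * (1# - ρ - ρ ^ suc J * (1# - ρ ^ d)) * (1# - ρ ^ suc (J ℕ.+ d)) - euler⁻ J * (1# - ρ - ρ ^ suc J * (1# - ρ ^ suc d)) ∎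

    -- One constant serves both purposes: (1 + x)(1 - x) ≤ 1 gives `euler⁺ n * euler⁻ n ≤ 1`, so the
    -- reciprocal of a positive lower bound for `euler⁻` also bounds `euler⁺`.
    euler-bound : (∀ x → ∃[ n ] x < fromℕ n) → ∃[ b ] (0# < b × (∀ n → 1# ≤ b * euler⁻ n) × (∀ n → euler⁺ n ≤ b))
    euler-bound archimedean = b , 0<b , lower , upper
      where
      -- J is chosen with ρ^(J+1) < 1 - ρ, which makes c₀ positive. Indices up to J are covered as
      -- well, because `euler⁻` decreases and is compared at J + n.
      small = ρ^-small archimedean (1# - ρ) (x<y⇒0<y-x ρ<1)
      J = proj₁ small
      ρ^J< : ρ ^ suc J < 1# - ρ
      ρ^J< = ≤-<-trans (ρ^-anti (ℕ.n≤1+n J)) (proj₂ small)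
      c₀ = euler⁻ J * (1# - ρ - ρ ^ suc J)
      0<c₀ : 0# < c₀
      0<c₀ = *-pos (0<euler⁻ J) (x<y⇒0<y-x ρ^J<)
      c₀≤ : ∀ n → c₀ ≤ euler⁻ n
      c₀≤ n = ≤-trans (≤-trans
        (*-monoˡ-≤ (<⇒≤ (0<euler⁻ J)) (0≤y-x⇒x≤y (≤-resp refl
          (solve 3 (λ r a b → a :* b := :1 :- r :- a :* (:1 :- b) :- (:1 :- r :- a)) refl ρ (ρ ^ suc J) (ρ ^ n))
          (*-nonneg (0≤ρ^ (suc J)) (0≤ρ^ n)))))
        (euler⁻-lower J n))
        (≤-trans (≤-resp refl (*-identityʳ _) (*-monoˡ-≤ (<⇒≤ (0<euler⁻ (J ℕ.+ n)))
          (0≤y-x⇒x≤y (≤-resp refl (solve 1 (λ x → x := :1 :- (:1 :- x)) refl ρ) (<⇒≤ 0<ρ)))))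
          (≡.subst (λ k → euler⁻ k ≤ euler⁻ n) (ℕ.+-comm n J) (euler⁻-anti n J)))
      inv = inverse-pos 0<c₀
      b = proj₁ inv
      0<b = proj₁ (proj₂ inv)
      lower : ∀ n → 1# ≤ b * euler⁻ n
      lower n = ≤-resp (proj₂ (proj₂ inv)) refl (*-monoˡ-≤ (<⇒≤ 0<b) (c₀≤ n))
      upper : ∀ n → euler⁺ n ≤ b
      upper n = *-cancel-≤ 0<c₀ (≤-trans (*-monoˡ-≤ (<⇒≤ (0<euler⁺ n)) (c₀≤ n))
        (≤-trans (euler⁺*euler⁻≤1 n) (≤-reflexive (sym (proj₂ (proj₂ inv))))))

-- Estimates

-- Bd z r stands for |z| ≤ r.  The absolute value itself, a square root,
-- is not needed.
record NormedRing c ℓ r ℓ₁ ℓ₂ b : Set (lsuc (c ⊔ ℓ ⊔ r ⊔ ℓ₁ ⊔ ℓ₂ ⊔ b)) where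
  field
    ring  : CommutativeRing c ℓ
    scalars : OrderedField r ℓ₁ ℓ₂
  private
    module K = CommutativeRing ring
    module F = OrderedField scalars
  open Order scalars using (_≤_; semiring)
  open Exp semiring using () renaming (_^_ to _^ᶠ_)
  field
    archimedean : ∀ x → ∃[ n ] x F.< F.fromℕ n
    Bd        : K.Carrier → F.Carrier → Set b
    Bd-nonneg : ∀ {z r} → Bd z r → F.0# ≤ r
    Bd-resp   : ∀ {z w r} → z K.≈ w → Bd z r → Bd w r
    Bd-mono   : ∀ {z r s} → r ≤ s → Bd z r → Bd z s
    Bd-0      : Bd K.0# F.0#
    Bd-1      : Bd K.1# F.1#
    Bd-+      : ∀ {z w r s} → Bd z r → Bd w s → Bd (z K.+ w) (r F.+ s)
    Bd-*      : ∀ {z w r s} → Bd z r → Bd w s → Bd (z K.* w) (r F.* s)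
    Bd-neg    : ∀ {z r} → Bd z r → Bd (K.- z) r
    -- The lower bound |1 - z| ≥ 1 - s, put as a cancellation because only upper bounds can be
    -- expressed.
    Bd-cancel : ∀ {z w r s} → Bd z s → s F.< F.1# → F.0# ≤ r →
                Bd (w K.* (K.1# K.- z)) (r F.* (F.1# F.- s)) → Bd w r
    tight     : ∀ {ρ C z} → F.0# F.< ρ → ρ F.< F.1# → (∀ n → Bd z (C F.* ρ ^ᶠ n)) → z K.≈ K.0#
    -- Completeness for geometrically convergent sequences. The doubled constant leaves room for
    -- taking limits of real and imaginary parts separately, each with error C ρ^n.
    limit     : ∀ {ρ C} → F.0# F.< ρ → ρ F.< F.1# → (s : ℕ → K.Carrier) →
                (∀ n d → Bd (s (n ℕ.+ d) K.- s n) (C F.* ρ ^ᶠ n)) →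
                ∃[ l ] ∀ n → Bd (s n K.- l) ((C F.+ C) F.* ρ ^ᶠ n)

module Estimates {c ℓ r ℓ₁ ℓ₂ b} (N : NormedRing c ℓ r ℓ₁ ℓ₂ b)
  (ρ : OrderedField.Carrier (NormedRing.scalars N))
  (0<ρ : OrderedField._<_ (NormedRing.scalars N) (OrderedField.0# (NormedRing.scalars N)) ρ)
  (ρ<1 : OrderedField._<_ (NormedRing.scalars N) ρ (OrderedField.1# (NormedRing.scalars N)))
  where
  private
    module N = NormedRing N
    module F = OrderedField N.scalars
  open NormedRing N using (Bd; Bd-nonneg; Bd-resp; Bd-mono; Bd-0; Bd-1; Bd-+; Bd-*; Bd-neg; Bd-cancel; tight; limit; archimedean)
  open CommutativeRing N.ring
  open Order N.scalars using (_≤_; ≤-refl; ≤-trans; ≤-resp; ≤-reflexive; <⇒≤; *-nonneg; +-nonneg; *-monoˡ-≤; *-monoʳ-≤; +-mono-≤; +-monoʳ-≤; *-cancel-≤)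
  open Order.Powers N.scalars ρ 0<ρ ρ<1
  open OrderedFieldProperties N.scalars using (x<y⇒0<y-x)
  open IntegerSolver N.ring
  private module FS = IntegerSolver (OrderedFieldProperties.realRing N.scalars)
  open FiniteSums N.ring
  open Exp semiring using (_^_; ^-homo-*)
  open Exp (Order.semiring N.scalars) using () renaming (_^_ to _^ᶠ_; ^-homo-* to ^ᶠ-homo-*)
  open import Relation.Binary.Reasoning.Setoid setoid

  poch : Carrier → Carrier → ℕ → Carrier
  poch a q zero    = 1#
  poch a q (suc m) = poch a q m * (1# - a * q ^ m)

  ρ^-split : ∀ {e a b} → e ≡ a ℕ.+ b → ρ ^ᶠ e F.≈ ρ ^ᶠ a F.* ρ ^ᶠ b
  ρ^-split {e} {a} {b} eq = F.trans (F.reflexive (≡.cong (ρ ^ᶠ_) eq)) (^ᶠ-homo-* ρ a b)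

  Bd-≈ : ∀ {z r s} → r F.≈ s → Bd z r → Bd z s
  Bd-≈ r≈s = Bd-mono (≤-reflexive r≈s)

  Bd-minus : ∀ {z w r s} → Bd z r → Bd w s → Bd (z - w) (r F.+ s)
  Bd-minus p q = Bd-+ p (Bd-neg q)

  Bd-^ : ∀ {z r} → Bd z r → ∀ n → Bd (z ^ n) (r ^ᶠ n)
  Bd-^ p zero    = Bd-1
  Bd-^ p (suc n) = Bd-* p (Bd-^ p n)

  Bd-^-pos : ∀ {z r} → Bd z r → r ≤ F.1# → ∀ n → 0 ℕ.< n → Bd (z ^ n) r
  Bd-^-pos z≤r r≤1 (suc zero)    _ = Bd-≈ (F.*-identityʳ _) (Bd-* z≤r Bd-1)
  Bd-^-pos z≤r r≤1 (suc (suc n)) _ = Bd-≈ (F.*-identityʳ _) (Bd-* z≤r (Bd-mono r≤1 (Bd-^-pos z≤r r≤1 (suc n) (s≤s z≤n))))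

  Bd-∑ : ∀ n {f C} → F.0# ≤ C → (∀ i → i ℕ.< n → Bd (f i) (C F.* ρ ^ᶠ i)) → Bd (∑< n f) (C F.* κ)
  Bd-∑ n {f} {C} 0≤C f-bd = Bd-mono (*-monoˡ-≤ 0≤C (geom≤κ n)) (partial n f-bd)
    where
    partial : ∀ n → (∀ i → i ℕ.< n → Bd (f i) (C F.* ρ ^ᶠ i)) → Bd (∑< n f) (C F.* geom n)
    partial zero    _    = Bd-≈ (F.sym (F.trans (F.*-congˡ geom-zero) (F.zeroʳ C))) Bd-0
    partial (suc n) f-bd = Bd-≈ (F.trans (F.sym (F.distribˡ C _ _)) (F.*-congˡ (geom-suc n)))
      (Bd-+ (f-bd n ℕ.≤-refl) (partial n (λ i i<n → f-bd i (ℕ.m≤n⇒m≤1+n i<n))))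

  Bd-telescope : ∀ {C} (s : ℕ → Carrier) → F.0# ≤ C → (∀ n → Bd (s (suc n) - s n) (C F.* ρ ^ᶠ n)) →
                 ∀ n d → Bd (s (n ℕ.+ d) - s n) (C F.* κ F.* ρ ^ᶠ n)
  Bd-telescope {C} s 0≤C step n d = Bd-mono
    (*-monoʳ-≤ (0≤ρ^ n) (*-monoˡ-≤ 0≤C (geom≤κ d))) (partial d)
    where
    partial : ∀ d → Bd (s (n ℕ.+ d) - s n) (C F.* geom d F.* ρ ^ᶠ n)
    partial zero rewrite ℕ.+-identityʳ n = Bd-resp (sym (-‿inverseʳ (s n)))
      (Bd-≈ (F.sym (F.trans (F.*-congʳ (F.trans (F.*-congˡ geom-zero) (F.zeroʳ C))) (F.zeroˡ _))) Bd-0)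
    partial (suc d) rewrite ℕ.+-suc n d = Bd-resp
      (solve 3 (λ x y z → (x :- y) :+ (y :- z) := x :- z) refl (s (suc (n ℕ.+ d))) (s (n ℕ.+ d)) (s n))
      (Bd-≈ (F.trans (F.+-congʳ (F.*-congˡ (^ᶠ-homo-* ρ n d)))
        (F.trans (FS.solve 4 (λ c x y g → c FS.:* (x FS.:* y) FS.:+ c FS.:* g FS.:* x FS.:= c FS.:* (y FS.:+ g) FS.:* x) F.refl C (ρ ^ᶠ n) (ρ ^ᶠ d) (geom d))
          (F.*-congʳ (F.*-congˡ (geom-suc d)))))
        (Bd-+ (step (n ℕ.+ d)) (partial d)))

  B : F.Carrier
  B = proj₁ (euler-bound archimedean)

  0≤B : F.0# ≤ B
  0≤B = <⇒≤ (proj₁ (proj₂ (euler-bound archimedean)))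

  1≤B*euler⁻ : ∀ n → F.1# ≤ B F.* euler⁻ n
  1≤B*euler⁻ = proj₁ (proj₂ (proj₂ (euler-bound archimedean)))

  euler⁺≤B : ∀ n → euler⁺ n ≤ B
  euler⁺≤B = proj₂ (proj₂ (proj₂ (euler-bound archimedean)))

  poch-bound : ∀ {a q} → Bd a ρ → Bd q ρ → ∀ n → Bd (poch a q n) B
  poch-bound {a} {q} a≤ρ q≤ρ n = Bd-mono (euler⁺≤B n) (go n)
    where
    go : ∀ n → Bd (poch a q n) (euler⁺ n)
    go zero    = Bd-1
    go (suc n) = Bd-* (go n) (Bd-minus Bd-1 (Bd-* a≤ρ (Bd-^ q≤ρ n)))

  -- Convergence at rate ρ^n, with one constant that also bounds the sequence and its limit;
  -- products of limits need all three.
  record Tends (s : ℕ → Carrier) (l : Carrier) : Set (r ⊔ ℓ₂ ⊔ b) where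
    field
      C       : F.Carrier
      rate    : ∀ n → Bd (s n - l) (C F.* ρ ^ᶠ n)
      bound   : ∀ n → Bd (s n) C
      bound-l : Bd l C

  tends : ∀ {s C} → (∀ n → Bd (s n) C) → (∀ n → Bd (s (suc n) - s n) (C F.* ρ ^ᶠ n)) → ∃[ l ] Tends s l
  tends {s} {C} s≤C step = proj₁ lim , record
    { C = C₁ ; rate = λ n → Bd-mono (*-monoʳ-≤ (0≤ρ^ n) C₂≤C₁) (proj₂ lim n)
    ; bound = λ n → Bd-mono (≤-resp (F.+-identityʳ C) F.refl (+-mono-≤ ≤-refl 0≤C₂)) (s≤C n)
    ; bound-l = Bd-resp (solve 2 (λ x y → x :- (x :- y) := y) refl (s 0) (proj₁ lim)) (Bd-minus (s≤C 0) (Bd-≈ (F.*-identityʳ C₂) (proj₂ lim 0))) }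
    where
    0≤C = Bd-nonneg (s≤C 0)
    lim = limit 0<ρ ρ<1 s (Bd-telescope s 0≤C step)
    C₂ = C F.* κ F.+ C F.* κ
    0≤C₂ : F.0# ≤ C₂
    0≤C₂ = +-nonneg (*-nonneg 0≤C (<⇒≤ 0<κ)) (*-nonneg 0≤C (<⇒≤ 0<κ))
    C₁ = C F.+ C₂
    C₂≤C₁ : C₂ ≤ C₁
    C₂≤C₁ = ≤-resp (F.+-identityˡ C₂) F.refl (+-monoʳ-≤ C₂ 0≤C)

  tends-resp : ∀ {s t l} → (∀ n → s n ≈ t n) → Tends s l → Tends t l
  tends-resp s≈t s→ = record
    { C = C ; rate = λ n → Bd-resp (+-congʳ (s≈t n)) (rate n)
    ; bound = λ n → Bd-resp (s≈t n) (bound n) ; bound-l = bound-l }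
    where open Tends s→

  ρ^-suc≤ : ∀ {C} n → F.0# ≤ C → C F.* (ρ F.* ρ ^ᶠ n) ≤ C F.* ρ ^ᶠ n
  ρ^-suc≤ n 0≤C = *-monoˡ-≤ 0≤C (ρ^-anti (ℕ.n≤1+n n))

  poch-tends : ∀ {a q} → Bd a ρ → Bd q ρ → ∃[ l ] Tends (poch a q) l
  poch-tends {a} {q} a≤ρ q≤ρ = tends (poch-bound a≤ρ q≤ρ) (λ n → Bd-resp
    (solve 2 (λ p x → :- (p :* x) := p :* (:1 :- x) :- p) refl (poch a q n) (a * q ^ n))
    (Bd-mono (ρ^-suc≤ n 0≤B) (Bd-neg (Bd-* (poch-bound a≤ρ q≤ρ n) (Bd-* a≤ρ (Bd-^ q≤ρ n))))))

  Negligible : (ℕ → Carrier) → Set (r ⊔ b)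
  Negligible f = ∃[ C ] ∀ n → Bd (f n) (C F.* ρ ^ᶠ n)

  negl-resp : ∀ {f g} → (∀ n → f n ≈ g n) → Negligible f → Negligible g
  negl-resp f≈g (C , bd) = C , λ n → Bd-resp (f≈g n) (bd n)

  negl-minus : ∀ {f g} → Negligible f → Negligible g → Negligible (λ n → f n - g n)
  negl-minus (C , bd) (C′ , bd′) = C F.+ C′ , λ n → Bd-≈ (F.sym (F.distribʳ _ C C′)) (Bd-minus (bd n) (bd′ n))

  negl-+ : ∀ {f g} → Negligible f → Negligible g → Negligible (λ n → f n + g n)
  negl-+ (C , bd) (C′ , bd′) = C F.+ C′ , λ n → Bd-≈ (F.sym (F.distribʳ _ C C′)) (Bd-+ (bd n) (bd′ n))

  negl-*ˡ : ∀ {f g : ℕ → Carrier} {A} → (∀ n → Bd (g n) A) → Negligible f → Negligible (λ n → g n * f n)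
  negl-*ˡ {A = A} g-bd (C , bd) = A F.* C , λ n → Bd-≈ (F.sym (F.*-assoc A C _)) (Bd-* (g-bd n) (bd n))

  tends-negl : ∀ {s l} → Tends s l → Negligible (λ n → s n - l)
  tends-negl t = Tends.C t , Tends.rate t

  tends-* : ∀ {s t l m} → Tends s l → Tends t m → Negligible (λ n → s n * t n - l * m)
  tends-* {s} {t} {l} {m} p r = negl-resp
    (λ n → solve 4 (λ s t l m → t :* (s :- l) :+ l :* (t :- m) := s :* t :- l :* m) refl (s n) (t n) l m)
    (negl-+ (negl-*ˡ (Tends.bound r) (tends-negl p)) (negl-*ˡ (λ _ → Tends.bound-l p) (tends-negl r)))

  negl-const : ∀ {z} → Negligible (λ _ → z) → z ≈ 0#
  negl-const (C , bd) = tight 0<ρ ρ<1 bd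

  module SmallBase (Q : QFactorial N.ring) (q≤ρ² : NormedRing.Bd N (QFactorial.q Q) (OrderedField._*_ (NormedRing.scalars N) ρ ρ)) where
    open QFactorial Q
    open QSeries N.ring Q
    open Resummation N.ring Q

    q≤ρ : Bd q ρ
    q≤ρ = Bd-mono (≤-resp F.refl (F.*-identityʳ ρ) (*-monoˡ-≤ (<⇒≤ 0<ρ) ρ≤1)) q≤ρ²

    Bd-q^ : ∀ e f → f ℕ.≤ e ℕ.+ e → Bd (q ^ e) (ρ ^ᶠ f)
    Bd-q^ e f f≤2e = Bd-mono (ρ^-anti f≤2e) (Bd-≈ (two e) (Bd-^ q≤ρ² e))
      where
      two : ∀ e → (ρ F.* ρ) ^ᶠ e F.≈ ρ ^ᶠ (e ℕ.+ e)
      two zero    = F.refl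
      two (suc e) = F.trans (F.*-congˡ (two e)) (F.trans (F.*-assoc _ _ _)
        (F.reflexive (≡.cong (λ k → ρ F.* ρ ^ᶠ k) (≡.sym (ℕ.+-suc e e)))))

    q^≤1 : ∀ e → Bd (q ^ e) F.1#
    q^≤1 e = Bd-q^ e 0 z≤n

    -- Start from `u n * qf n` = 1 ≤ B · (ρ;ρ)_n and strip one factor 1 - q^k from the left and 1 -
    -- ρ^k from the right at a time, by `Bd-cancel`. The auxiliary `nonneg` supplies the sign
    -- condition of each cancellation.
    u-bound : ∀ n → Bd (u n) B
    u-bound n = go n (Bd-resp (sym (trans (*-comm _ _) (qf*u n))) (Bd-mono (1≤B*euler⁻ n) Bd-1))
      where
      go : ∀ n {w s} → Bd (w * qf n) (s F.* euler⁻ n) → Bd w s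
      nonneg : ∀ n {w s} → Bd (w * qf (suc n)) (s F.* euler⁻ (suc n)) → F.0# ≤ s F.* euler⁻ n
      nonneg n {w} {s} bd = *-cancel-≤ (x<y⇒0<y-x (ρ^<1 n)) (≤-resp (F.sym (F.zeroˡ _)) (F.sym (F.*-assoc s _ _)) (Bd-nonneg bd))
      go zero    bd = Bd-resp (trans (*-congˡ qf-zero) (*-identityʳ _)) (Bd-≈ (F.*-identityʳ _) bd)
      go (suc n) {w} {s} bd = go n (Bd-cancel (Bd-^ q≤ρ (suc n)) (ρ^<1 n) (nonneg n bd)
        (Bd-resp (trans (*-congˡ (qf-suc n)) (sym (*-assoc _ _ _))) (Bd-≈ (F.sym (F.*-assoc s _ _)) bd)))

    abstract
      u-tends : ∃[ l ] Tends u l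
      u-tends = tends u-bound (λ n → Bd-resp
        (trans (solve 2 (λ v x → v :* x := v :- (:1 :- x) :* v) refl (u (suc n)) (q ^ suc n)) (+-congˡ (-‿cong (sym (u-suc n)))))
        (Bd-mono (ρ^-suc≤ n 0≤B) (Bd-* (u-bound (suc n)) (Bd-^ q≤ρ (suc n)))))

    qf-tends : ∃[ l ] Tends qf l
    qf-tends = proj₁ (poch-tends q≤ρ q≤ρ) , tends-resp poch≈qf (proj₂ (poch-tends q≤ρ q≤ρ))
      where
      poch≈qf : ∀ n → poch q q n ≈ qf n
      poch≈qf zero    = sym qf-zero
      poch≈qf (suc n) = trans (*-congʳ (poch≈qf n)) (sym (qf-suc n))

    -- This is 1/(q)_∞, obtained as the limit of 1/(q)_n; that it inverts (q)_∞ is shown later, by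
    -- `Q*R≈1`.
    R : Carrier
    R = proj₁ u-tends

    open Tends (proj₂ u-tends) public using () renaming (C to C; rate to u-rate; bound to u≤C; bound-l to R≤C)

    0≤C : F.0# ≤ C
    0≤C = Bd-nonneg R≤C

    um≤C : ∀ n i → Bd (um n i) C
    um≤C n       zero    = u≤C n
    um≤C zero    (suc i) = Bd-mono 0≤C Bd-0
    um≤C (suc n) (suc i) = um≤C n i

    -- The dependence on d is kept explicit because d grows with j. For d > M the left side is -R²
    -- and the truncated exponent is 0, so the same formula holds as a constant bound.
    D-limit : ∃[ C′ ] ∀ M d → Bd (D M d - R * R) (C′ F.* ρ ^ᶠ (M ∸ d))
    D-limit = C² , λ M d → bd M d (ℕ.≤-<-connex d M)
      where
      C² : F.Carrier
      C² = C F.* C F.+ C F.* C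
      near : ∀ d e → Bd (u (d ℕ.+ e ℕ.+ d) * u e - R * R) (C² F.* ρ ^ᶠ e)
      near d e = Bd-resp
        (solve 3 (λ v w R → (v :- R) :* w :+ R :* (w :- R) := v :* w :- R :* R) refl (u (d ℕ.+ e ℕ.+ d)) (u e) R)
        (Bd-mono (≤-trans
          (+-mono-≤ (*-monoʳ-≤ 0≤C (*-monoˡ-≤ 0≤C (ρ^-anti (ℕ.≤-trans (ℕ.m≤n+m e d) (ℕ.m≤m+n (d ℕ.+ e) d))))) ≤-refl)
          (≤-reflexive (FS.solve 2 (λ c x → c FS.:* x FS.:* c FS.:+ c FS.:* (c FS.:* x) FS.:= (c FS.:* c FS.:+ c FS.:* c) FS.:* x) F.refl C (ρ ^ᶠ e))))
          (Bd-+ (Bd-* (u-rate (d ℕ.+ e ℕ.+ d)) (u≤C e)) (Bd-* R≤C (u-rate e))))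
      far : Bd (0# - R * R) C²
      far = Bd-mono (+-mono-≤ (*-nonneg 0≤C 0≤C) ≤-refl) (Bd-minus Bd-0 (Bd-* R≤C R≤C))
      bd : ∀ M d → d ℕ.≤ M ⊎ M ℕ.< d → Bd (D M d - R * R) (C² F.* ρ ^ᶠ (M ∸ d))
      bd M d (inj₂ M<d) = Bd-resp (+-congʳ (sym (D-< M<d))) (≡.subst (λ k → Bd (0# - R * R) (C² F.* ρ ^ᶠ k))
        (≡.sym (ℕ.m≤n⇒m∸n≡0 (ℕ.<⇒≤ M<d))) (Bd-≈ (F.sym (F.*-identityʳ C²)) far))
      bd M d (inj₁ d≤M) = ≡.subst (λ k → Bd (D k d - R * R) (C² F.* ρ ^ᶠ (M ∸ d))) (ℕ.m+[n∸m]≡n d≤M)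
        (Bd-resp (+-congʳ (*-congˡ (reflexive (≡.sym (um-+ d (M ∸ d)))))) (near d (M ∸ d)))

    -- `D-bailey` gives the sum with weights 1/(q)_{M-L} exactly. Replacing each weight by its limit
    -- R costs O(ρ^(M-L)) in the term L, and |q^(L²)| ≤ ρ^(2L) turns this into ρ^M ρ^L, which can be
    -- summed over L.
    h-limit : ∃[ C′ ] ∀ M d → Bd (R * h M d - q ^ (d ℕ.* d) * (R * R)) (C′ F.* ρ ^ᶠ (M ∸ d))
    h-limit = C₁ F.* κ F.+ C₂ , bd
      where
      C₁ = C F.* (C F.* C)
      C₂ = proj₁ D-limit
      0≤C₁ = *-nonneg 0≤C (*-nonneg 0≤C 0≤C)
      term : ∀ M d L → L ℕ.< suc M → Bd (q ^ (L ℕ.* L) * ((R - u (M ∸ L)) * D L d)) (C₁ F.* ρ ^ᶠ M F.* ρ ^ᶠ L)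
      term M d L (s≤s L≤M) = Bd-≈ eq (Bd-* (Bd-q^ (L ℕ.* L) (L ℕ.+ L) (ℕ.+-mono-≤ (n≤n² L) (n≤n² L)))
        (Bd-* (Bd-resp (solve 2 (λ v R → :- (v :- R) := R :- v) refl (u (M ∸ L)) R) (Bd-neg (u-rate (M ∸ L))))
              (Bd-* (u≤C (L ℕ.+ d)) (um≤C L d))))
        where
        eq : ρ ^ᶠ (L ℕ.+ L) F.* (C F.* ρ ^ᶠ (M ∸ L) F.* (C F.* C)) F.≈ C₁ F.* ρ ^ᶠ M F.* ρ ^ᶠ L
        eq = F.trans (F.*-congʳ (^ᶠ-homo-* ρ L L))
          (F.trans (FS.solve 3 (λ l c m → l FS.:* l FS.:* (c FS.:* m FS.:* (c FS.:* c)) FS.:= c FS.:* (c FS.:* c) FS.:* (l FS.:* m) FS.:* l) F.refl (ρ ^ᶠ L) C (ρ ^ᶠ (M ∸ L)))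
          (F.*-congʳ (F.*-congˡ (F.sym (ρ^-split {M} {L} {M ∸ L} (≡.sym (ℕ.m+[n∸m]≡n L≤M)))))))
      diff : ∀ M d → R * h M d - q ^ (d ℕ.* d) * D M d ≈ ∑< (suc M) (λ L → q ^ (L ℕ.* L) * ((R - u (M ∸ L)) * D L d))
      diff M d = begin
        R * h M d - q ^ (d ℕ.* d) * D M d      ≈⟨ +-cong (∑-*ˡ (suc M) R _) (-‿cong (D-bailey M d)) ⟨
        _                                      ≈⟨ ∑-minus (suc M) _ _ ⟨
        _                                      ≈⟨ ∑-cong (suc M) (λ L → solve 4 (λ R p v x → R :* (p :* x) :- p :* (v :* x) := p :* ((R :- v) :* x)) refl R (q ^ (L ℕ.* L)) (u (M ∸ L)) (D L d)) ⟩
        ∑< (suc M) (λ L → q ^ (L ℕ.* L) * ((R - u (M ∸ L)) * D L d)) ∎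
      bd : ∀ M d → Bd (R * h M d - q ^ (d ℕ.* d) * (R * R)) ((C₁ F.* κ F.+ C₂) F.* ρ ^ᶠ (M ∸ d))
      bd M d = Bd-resp
        (trans (+-congʳ (sym (diff M d))) (solve 4 (λ h p x r → (h :- p :* x) :+ p :* (x :- r) := h :- p :* r) refl (R * h M d) (q ^ (d ℕ.* d)) (D M d) (R * R)))
        (Bd-mono (≤-trans
          (+-mono-≤ (≤-trans (≤-reflexive (FS.solve 3 (λ c m k → c FS.:* m FS.:* k FS.:= c FS.:* k FS.:* m) F.refl C₁ (ρ ^ᶠ M) κ))
                       (*-monoˡ-≤ (*-nonneg 0≤C₁ (<⇒≤ 0<κ)) (ρ^-anti (ℕ.m∸n≤m M d))))
                    (≤-reflexive (F.*-identityˡ _)))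
          (≤-reflexive (F.sym (F.distribʳ _ _ _))))
          (Bd-+ (Bd-∑ (suc M) (*-nonneg 0≤C₁ (0≤ρ^ M)) (term M d)) (Bd-* (q^≤1 (d ℕ.* d)) (proj₂ D-limit M d))))

-- Passage to the limit M → ∞

module Limit {c ℓ r ℓ₁ ℓ₂ b} (N : NormedRing c ℓ r ℓ₁ ℓ₂ b)
  (ρ : OrderedField.Carrier (NormedRing.scalars N))
  (0<ρ : OrderedField._<_ (NormedRing.scalars N) (OrderedField.0# (NormedRing.scalars N)) ρ)
  (ρ<1 : OrderedField._<_ (NormedRing.scalars N) ρ (OrderedField.1# (NormedRing.scalars N)))
  (Q P : QFactorial (NormedRing.ring N))
  (q≤ρ² : NormedRing.Bd N (QFactorial.q Q) (OrderedField._*_ (NormedRing.scalars N) ρ ρ))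
  (p≤ρ² : NormedRing.Bd N (QFactorial.q P) (OrderedField._*_ (NormedRing.scalars N) ρ ρ))
  (p≡q²¹ : QFactorial.q P ≡ Exp._^_ (CommutativeRing.semiring (NormedRing.ring N)) (QFactorial.q Q) 21)
  where
  private
    module N = NormedRing N
    module F = OrderedField N.scalars
    module FS = IntegerSolver (OrderedFieldProperties.realRing N.scalars)
  open N using (Bd; Bd-nonneg; Bd-mono; Bd-1; Bd-*; Bd-neg)
  open CommutativeRing N.ring
  open Order N.scalars using (_≤_; ≤-refl; ≤-trans; ≤-resp; ≤-reflexive; +-nonneg; *-monoˡ-≤; *-monoʳ-≤; +-mono-≤)
  open Order.Powers N.scalars ρ 0<ρ ρ<1
  open Estimates N ρ 0<ρ ρ<1
  open IntegerSolver N.ring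
  open FiniteSums N.ring
  open Exp semiring using (_^_; ^-homo-*; ^-assocʳ)
  open Exp (Order.semiring N.scalars) using () renaming (_^_ to _^ᶠ_; ^-homo-* to ^ᶠ-homo-*)
  open import Relation.Binary.Reasoning.Setoid setoid
  open QFactorial Q using (q)
  open QFactorial P using () renaming (q to p; qf to qfₚ; u to uₚ)
  open QSeries N.ring Q using (^-split)
  open QSeries N.ring P using () renaming (D to Dₚ)
  open Bressoud N.ring Q using (sgn; e₁; e₂)
  open Resummation N.ring Q using (h)
  open TripleSum N.ring Q using (α; β; triangle; summand; triangle-summand)
  open FiniteTripleProduct N.ring P using (theta; triple-product)
  module E = SmallBase Q q≤ρ²
  module Eₚ = SmallBase P p≤ρ²

  -- `Θ` is a partial sum of Σ_j (-1)^j q^((21j²+5j)/2): the exponents are (13j²+5j)/2 + (2j)² at j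
  -- = i and j = -1 - i.
  ϑ⁺ ϑ⁻ Θ : ℕ → Carrier
  ϑ⁺ i = sgn i * q ^ (α i ℕ.+ dbl i ℕ.* dbl i)
  ϑ⁻ i = sgn i * q ^ (β i ℕ.+ dbl (suc i) ℕ.* dbl (suc i))
  Θ n = ∑< n (λ i → ϑ⁺ i - ϑ⁻ i)

  private
    sgn≤1 : ∀ i → Bd (sgn i) F.1#
    sgn≤1 zero    = Bd-1
    sgn≤1 (suc i) = Bd-neg (sgn≤1 i)

    dbl≤α : ∀ i → dbl i ℕ.≤ α i
    dbl≤α i = ℕ.≤-trans (ℕ.m≤n+m (dbl i) (dbl i ℕ.* dbl i)) (ℕ.m≤n+m (dbl i ℕ.* dbl i ℕ.+ dbl i) (e₁ i))

    dbl≤β : ∀ i → dbl (suc i) ℕ.≤ β i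
    dbl≤β i = ℕ.≤-trans (ℕ.+-mono-≤ {1} {suc (dbl i) ℕ.* suc (dbl i)} {suc (dbl i)} {suc (dbl i)} (s≤s z≤n) ℕ.≤-refl) (ℕ.m≤n+m (suc (dbl i) ℕ.* suc (dbl i) ℕ.+ suc (dbl i)) (e₂ i))

    -- Of the factor ρ^(i+d), the part ρ^d restores ρ^(M-d) to at most ρ^M and the part ρ^i is left
    -- for the sum over i.
    decay : ∀ {z w C} M d i → Bd z (ρ ^ᶠ (i ℕ.+ d)) → Bd w (C F.* ρ ^ᶠ (M ∸ d)) → Bd (z * w) (C F.* ρ ^ᶠ M F.* ρ ^ᶠ i)
    decay {C = C} M d i z-bd w-bd = Bd-mono (≤-trans (≤-reflexive eq) (*-monoʳ-≤ (0≤ρ^ i) le)) (Bd-* z-bd w-bd)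
      where
      eq : ρ ^ᶠ (i ℕ.+ d) F.* (C F.* ρ ^ᶠ (M ∸ d)) F.≈ C F.* ρ ^ᶠ (M ∸ d) F.* ρ ^ᶠ d F.* ρ ^ᶠ i
      eq = F.trans (F.*-congʳ (^ᶠ-homo-* ρ i d)) (FS.solve 4 (λ i d c m → i FS.:* d FS.:* (c FS.:* m) FS.:= c FS.:* m FS.:* d FS.:* i) F.refl (ρ ^ᶠ i) (ρ ^ᶠ d) C (ρ ^ᶠ (M ∸ d)))
      0≤Cρ : F.0# ≤ C F.* ρ ^ᶠ (M ∸ d)
      0≤Cρ = Bd-nonneg w-bd
      0≤C : F.0# ≤ C
      0≤C = Order.*-cancel-≤ N.scalars (0<ρ^ (M ∸ d)) (≤-resp (F.sym (F.zeroˡ _)) F.refl 0≤Cρ)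
      le : C F.* ρ ^ᶠ (M ∸ d) F.* ρ ^ᶠ d ≤ C F.* ρ ^ᶠ M
      le = ≤-resp (F.trans (F.*-congˡ (^ᶠ-homo-* ρ (M ∸ d) d)) (F.sym (F.*-assoc _ _ _))) F.refl
        (*-monoˡ-≤ 0≤C (ρ^-anti (ℕ.≤-trans (ℕ.m≤n+m∸n M d) (ℕ.≤-reflexive (ℕ.+-comm d (M ∸ d))))))

    negl-∑ : ∀ {C} (f g : ℕ → ℕ → Carrier) → (∀ M i → Bd (f M i) (C F.* ρ ^ᶠ M F.* ρ ^ᶠ i)) →
             (∀ M i → Bd (g M i) (C F.* ρ ^ᶠ M F.* ρ ^ᶠ i)) → Negligible (λ M → ∑< (suc M) (λ i → f M i - g M i))
    negl-∑ {C} f g f-bd g-bd = (C F.+ C) F.* κ , λ M → Bd-≈ (FS.solve 3 (λ c m k → (c FS.:+ c) FS.:* m FS.:* k FS.:= (c FS.:+ c) FS.:* k FS.:* m) F.refl C (ρ ^ᶠ M) κ)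
      (Bd-∑ (suc M) (0≤CCρ M) (λ i _ → Bd-≈ (FS.solve 3 (λ c m i → c FS.:* m FS.:* i FS.:+ c FS.:* m FS.:* i FS.:= (c FS.:+ c) FS.:* m FS.:* i) F.refl C (ρ ^ᶠ M) (ρ ^ᶠ i)) (Bd-minus (f-bd M i) (g-bd M i))))
      where
      0≤CCρ : ∀ M → F.0# ≤ (C F.+ C) F.* ρ ^ᶠ M
      0≤CCρ M = ≤-resp F.refl (F.trans (F.+-cong (F.*-identityʳ _) (F.*-identityʳ _)) (F.sym (F.distribʳ _ C C)))
        (+-nonneg (Bd-nonneg (f-bd M 0)) (Bd-nonneg (g-bd M 0)))

  triangle-limit : Negligible (λ M → E.R * triangle summand M - E.R * E.R * Θ (suc M))
  triangle-limit = negl-resp (λ M → sym (diff M)) (negl-∑ {C′} _ _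
      (λ M i → bd M i (dbl i) (α i) (ℕ.+-mono-≤ (ℕ.≤-trans (n≤dbl i) (dbl≤α i)) (dbl≤α i)))
      (λ M i → bd M i (dbl (suc i)) (β i) (ℕ.+-mono-≤ (ℕ.≤-trans (ℕ.≤-trans (ℕ.n≤1+n i) (n≤dbl (suc i))) (dbl≤β i)) (dbl≤β i))))
    where
    C′ = proj₁ E.h-limit
    R² = E.R * E.R
    bd : ∀ M i d e → i ℕ.+ d ℕ.≤ e ℕ.+ e →
         Bd (sgn i * (q ^ e * (E.R * h M d - q ^ (d ℕ.* d) * R²))) (C′ F.* ρ ^ᶠ M F.* ρ ^ᶠ i)
    bd M i d e le = Bd-≈ (F.*-identityˡ _) (Bd-* (sgn≤1 i) (decay M d i (E.Bd-q^ e (i ℕ.+ d) le) (proj₂ E.h-limit M d)))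
    diff : ∀ M → E.R * triangle summand M - R² * Θ (suc M) ≈ ∑< (suc M) (λ i →
      sgn i * (q ^ α i * (E.R * h M (dbl i) - q ^ (dbl i ℕ.* dbl i) * R²))
      - sgn i * (q ^ β i * (E.R * h M (dbl (suc i)) - q ^ (dbl (suc i) ℕ.* dbl (suc i)) * R²)))
    diff M = begin
      E.R * triangle summand M - R² * Θ (suc M)
        ≈⟨ +-cong (*-congˡ (triangle-summand M M ℕ.≤-refl)) refl ⟩
      _ ≈⟨ +-cong (∑-*ˡ (suc M) E.R _) (-‿cong (∑-*ˡ (suc M) R² _)) ⟨
      _ ≈⟨ ∑-minus (suc M) _ _ ⟨
      _ ≈⟨ ∑-cong (suc M) (λ i → trans
             (+-congˡ (-‿cong (*-congˡ (+-cong (*-congˡ (^-homo-* q (α i) _)) (-‿cong (*-congˡ (^-homo-* q (β i) _)))))))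
             (solve 9 (λ R r s a b h k x y → R :* (s :* (a :* h) :- s :* (b :* k)) :- r :* (s :* (a :* x) :- s :* (b :* y))
               := s :* (a :* (R :* h :- x :* r)) :- s :* (b :* (R :* k :- y :* r))) refl E.R R² (sgn i) (q ^ α i) (q ^ β i) (h M (dbl i)) (h M (dbl (suc i))) (q ^ (dbl i ℕ.* dbl i)) (q ^ (dbl (suc i) ℕ.* dbl (suc i))))) ⟩
      _ ∎

  -- 13 and 8 are fixed by 21 j(j-1)/2 + 13j = (21j²+5j)/2 and 13 + 8 = 21.
  x y : Carrier
  x = q ^ 13
  y = q ^ 8

  private
    p^ : ∀ i → p ^ i ≈ q ^ (21 ℕ.* i)
    p^ i = trans (reflexive (≡.cong (_^ i) p≡q²¹)) (^-assocʳ q 21 i)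

    xy≈p : x * y ≈ p
    xy≈p = trans (sym (^-homo-* q 13 8)) (reflexive (≡.sym p≡q²¹))

    theta-suc : ∀ z {s} i e a e′ → e ℕ.+ (a ℕ.+ 21 ℕ.* i) ≡ e′ → z ≈ q ^ a → theta z i ≈ s * q ^ e → theta z (suc i) ≈ - s * q ^ e′
    theta-suc z {s} i e a e′ eq z≈ th = begin
      - (theta z i * (z * p ^ i))             ≈⟨ -‿cong (*-cong th (*-cong z≈ (p^ i))) ⟩
      - (s * q ^ e * (q ^ a * q ^ (21 ℕ.* i)))   ≈⟨ solve 4 (λ s e a i → :- (s :* e :* (a :* i)) := :- s :* (e :* (a :* i))) refl s _ _ _ ⟩
      - s * (q ^ e * (q ^ a * q ^ (21 ℕ.* i)))   ≈⟨ *-congˡ (trans (^-split e _ (≡.sym eq)) (*-congˡ (^-homo-* q a _))) ⟨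
      - s * q ^ e′ ∎

    theta-x : ∀ i → theta x i ≈ ϑ⁺ i
    theta-x zero    = sym (*-identityˡ 1#)
    theta-x (suc i) = theta-suc x i (α i ℕ.+ dbl i ℕ.* dbl i) 13 (α (suc i) ℕ.+ dbl (suc i) ℕ.* dbl (suc i)) expo refl (theta-x i)
      where
      expo′ : ∀ i t → i ℕ.* i ℕ.+ i ℕ.* i ℕ.+ t ℕ.+ ((i ℕ.+ i) ℕ.* (i ℕ.+ i) ℕ.+ (i ℕ.+ i)) ℕ.+ (i ℕ.+ i) ℕ.* (i ℕ.+ i) ℕ.+ (13 ℕ.+ 21 ℕ.* i)
        ≡ suc i ℕ.* suc i ℕ.+ suc i ℕ.* suc i ℕ.+ (t ℕ.+ suc i) ℕ.+ ((2 ℕ.+ (i ℕ.+ i)) ℕ.* (2 ℕ.+ (i ℕ.+ i)) ℕ.+ (2 ℕ.+ (i ℕ.+ i))) ℕ.+ (2 ℕ.+ (i ℕ.+ i)) ℕ.* (2 ℕ.+ (i ℕ.+ i))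
      expo′ i t = ℕ-solve (i ∷ t ∷ [])
      expo : α i ℕ.+ dbl i ℕ.* dbl i ℕ.+ (13 ℕ.+ 21 ℕ.* i) ≡ α (suc i) ℕ.+ dbl (suc i) ℕ.* dbl (suc i)
      expo rewrite dbl≡+ i = expo′ i (tri i)

    theta-y : ∀ i → theta y (suc i) ≈ - ϑ⁻ i
    theta-y i = trans (go i) (solve 2 (λ s x → :- s :* x := :- (s :* x)) refl (sgn i) _)
      where
      expo′ : ∀ i t → (suc i ℕ.* suc i ℕ.+ suc i ℕ.* suc i ℕ.+ t ℕ.+ (suc (i ℕ.+ i) ℕ.* suc (i ℕ.+ i) ℕ.+ suc (i ℕ.+ i))) ℕ.+ (2 ℕ.+ (i ℕ.+ i)) ℕ.* (2 ℕ.+ (i ℕ.+ i)) ℕ.+ (8 ℕ.+ 21 ℕ.* suc i)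
        ≡ (2 ℕ.+ i) ℕ.* (2 ℕ.+ i) ℕ.+ (2 ℕ.+ i) ℕ.* (2 ℕ.+ i) ℕ.+ (t ℕ.+ suc i) ℕ.+ ((3 ℕ.+ (i ℕ.+ i)) ℕ.* (3 ℕ.+ (i ℕ.+ i)) ℕ.+ (3 ℕ.+ (i ℕ.+ i))) ℕ.+ (4 ℕ.+ (i ℕ.+ i)) ℕ.* (4 ℕ.+ (i ℕ.+ i))
      expo′ i t = ℕ-solve (i ∷ t ∷ [])
      expo : ∀ i → β i ℕ.+ dbl (suc i) ℕ.* dbl (suc i) ℕ.+ (8 ℕ.+ 21 ℕ.* suc i) ≡ β (suc i) ℕ.+ dbl (suc (suc i)) ℕ.* dbl (suc (suc i))
      expo i rewrite dbl≡+ i = expo′ i (tri i)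
      go : ∀ i → theta y (suc i) ≈ - sgn i * q ^ (β i ℕ.+ dbl (suc i) ℕ.* dbl (suc i))
      go zero    = theta-suc y 0 0 8 8 ≡.refl refl (sym (*-identityˡ 1#))
      go (suc i) = theta-suc y (suc i) (β i ℕ.+ dbl (suc i) ℕ.* dbl (suc i)) 8 (β (suc i) ℕ.+ dbl (suc (suc i)) ℕ.* dbl (suc (suc i))) (expo i) refl (go i)

  px py : ℕ → Carrier
  px = poch x p
  py = poch y p

  triple-product-limit : Negligible (λ M → px M * py M * uₚ (M ℕ.+ M) - Eₚ.R * Eₚ.R * Θ (suc M))
  triple-product-limit = negl-resp (λ M → sym (diff M)) (negl-∑ {C′} _ _
      (λ M i → decay M i i (bd i (α i ℕ.+ dbl i ℕ.* dbl i) (i ℕ.+ i) (ℕ.+-mono-≤ (i≤ i) (i≤ i))) (proj₂ Eₚ.D-limit M i))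
      (λ M i → decay M (suc i) i (bd i (β i ℕ.+ dbl (suc i) ℕ.* dbl (suc i)) (i ℕ.+ suc i) (ℕ.+-mono-≤ (ℕ.≤-trans (ℕ.n≤1+n i) (i≤′ i)) (i≤′ i))) (proj₂ Eₚ.D-limit M (suc i))))
    where
    C′ = proj₁ Eₚ.D-limit
    R² = Eₚ.R * Eₚ.R
    i≤ : ∀ i → i ℕ.≤ α i ℕ.+ dbl i ℕ.* dbl i
    i≤ i = ℕ.≤-trans (n≤dbl i) (ℕ.≤-trans (dbl≤α i) (ℕ.m≤m+n _ _))
    i≤′ : ∀ i → suc i ℕ.≤ β i ℕ.+ dbl (suc i) ℕ.* dbl (suc i)
    i≤′ i = ℕ.≤-trans (n≤dbl (suc i)) (ℕ.≤-trans (dbl≤β i) (ℕ.m≤m+n _ _))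
    bd : ∀ i e f → f ℕ.≤ e ℕ.+ e → Bd (sgn i * q ^ e) (ρ ^ᶠ f)
    bd i e f le = Bd-≈ (F.*-identityˡ _) (Bd-* (sgn≤1 i) (E.Bd-q^ e f le))
    diff : ∀ M → px M * py M * uₚ (M ℕ.+ M) - R² * Θ (suc M) ≈
      ∑< (suc M) (λ i → ϑ⁺ i * (Dₚ M i - R²) - ϑ⁻ i * (Dₚ M (suc i) - R²))
    diff M = begin
      px M * py M * uₚ (M ℕ.+ M) - R² * Θ (suc M)
        ≈⟨ +-cong (triple-product x y xy≈p px py refl (λ _ → refl) refl (λ _ → refl) M M ℕ.≤-refl) (-‿cong (sym (∑-*ˡ (suc M) R² _))) ⟩
      _ ≈⟨ ∑-minus (suc M) _ _ ⟨
      _ ≈⟨ ∑-cong (suc M) (λ i → trans (+-congʳ (+-cong (*-congʳ (theta-x i)) (*-congʳ (theta-y i))))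
             (solve 5 (λ s t d e r → (s :* d :+ :- t :* e) :- r :* (s :- t) := s :* (d :- r) :- t :* (e :- r)) refl (ϑ⁺ i) (ϑ⁻ i) (Dₚ M i) (Dₚ M (suc i)) R²)) ⟩
      _ ∎

  private
    -- The products `qf n * u n` are constantly 1 and tend to Qₗ R, so the constant 1 - Qₗ R is
    -- negligible and hence zero.
    unit : ∀ {Q′ : QFactorial N.ring} {Qₗ R} → Tends (QFactorial.qf Q′) Qₗ → Tends (QFactorial.u Q′) R → Qₗ * R ≈ 1#
    unit {Q′} {Qₗ} {R} t s = sym (begin
      1#                     ≈⟨ solve 1 (λ z → :1 := (:1 :- z) :+ z) refl (Qₗ * R) ⟩
      (1# - Qₗ * R) + Qₗ * R   ≈⟨ +-congʳ (negl-const (negl-resp (λ n → +-congʳ (QFactorial.qf*u Q′ n)) (tends-* t s))) ⟩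
      0# + Qₗ * R             ≈⟨ +-identityˡ _ ⟩
      Qₗ * R                  ∎)

  module _ {Qₗ Pₗ X Y : Carrier} (Q→ : Tends (QFactorial.qf Q) Qₗ) (P→ : Tends qfₚ Pₗ) (X→ : Tends px X) (Y→ : Tends py Y) where

    Q*R≈1 : Qₗ * E.R ≈ 1#
    Q*R≈1 = unit {Q} Q→ (proj₂ E.u-tends)

    private
      product-limit : Negligible (λ M → px M * py M * uₚ (M ℕ.+ M) - X * Y * Eₚ.R)
      product-limit = negl-resp
        (λ M → solve 5 (λ a b v z R → v :* (a :* b :- z) :+ z :* (v :- R) := a :* b :* v :- z :* R) refl (px M) (py M) (uₚ (M ℕ.+ M)) (X * Y) Eₚ.R)
        (negl-+ (negl-*ˡ (λ M → Eₚ.u≤C (M ℕ.+ M)) (tends-* X→ Y→))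
                (negl-*ˡ (λ _ → Bd-* (Tends.bound-l X→) (Tends.bound-l Y→))
                  (Eₚ.C , λ M → Bd-mono (*-monoˡ-≤ Eₚ.0≤C (ρ^-anti (ℕ.m≤m+n M M))) (Eₚ.u-rate (M ℕ.+ M)))))

    -- In the limit R A = R² Θ, where A stands for the triangle sum, while the triple product gives
    -- Rₚ² Θ = X Y Rₚ. Combining them with factors Rₚ² and R² cancels Θ, for which no limit has to
    -- be known; multiplication by Pₗ² Qₗ, the inverse of Rₚ² R, then isolates A.
    summand-limit : Negligible (λ M → triangle summand M - Pₗ * Y * X * E.R)
    summand-limit = negl-resp (λ M → final (triangle summand M) (Θ (suc M)) (px M * py M * uₚ (M ℕ.+ M)))
      (negl-*ˡ (λ _ → Bd-* (Bd-* P≤ P≤) (Tends.bound-l Q→))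
        (negl-minus (negl-*ˡ (λ _ → Bd-* Eₚ.R≤C Eₚ.R≤C) triangle-limit)
                (negl-*ˡ (λ _ → Bd-* E.R≤C E.R≤C) (negl-minus triple-product-limit product-limit))))
      where
      P≤ = Tends.bound-l P→
      R = E.R
      Rₚ = Eₚ.R
      final : ∀ A θ J → Pₗ * Pₗ * Qₗ * (Rₚ * Rₚ * (R * A - R * R * θ) - R * R * ((J - Rₚ * Rₚ * θ) - (J - X * Y * Rₚ)))
              ≈ A - Pₗ * Y * X * R
      final A θ J = begin
        _ ≈⟨ solve 9 (λ P Q R S A t J X Y → P :* P :* Q :* (S :* S :* (R :* A :- R :* R :* t) :- R :* R :* ((J :- S :* S :* t) :- (J :- X :* Y :* S)))
              := (P :* S) :* (P :* S) :* (Q :* R) :* A :- (Q :* R) :* (P :* S) :* (P :* Y :* X :* R)) refl Pₗ Qₗ R Rₚ A θ J X Y ⟩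
        (Pₗ * Rₚ) * (Pₗ * Rₚ) * (Qₗ * R) * A - (Qₗ * R) * (Pₗ * Rₚ) * (Pₗ * Y * X * R)
          ≈⟨ +-cong (*-congʳ (*-cong (*-cong P*R≈1 P*R≈1) Q*R≈1)) (-‿cong (*-congʳ (*-cong Q*R≈1 P*R≈1))) ⟩
        1# * 1# * 1# * A - 1# * 1# * (Pₗ * Y * X * R)
          ≈⟨ solve 2 (λ a b → :1 :* :1 :* :1 :* a :- :1 :* :1 :* b := a :- b) refl A _ ⟩
        A - Pₗ * Y * X * R ∎
        where P*R≈1 = unit {P} P→ (proj₂ Eₚ.u-tends)

-- Unconditional summation

sigma : ∀ {a b} {A : Set a} {B : Set b} → List A → (A → List B) → List (A × B)
sigma []       ys = []
sigma (x ∷ xs) ys = map (x ,_) (ys x) ++ sigma xs ys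

module _ {a b} {A : Set a} {B : Set b} where

  ∈-sigma⁺ : ∀ {xs} {ys : A → List B} {x y} → x ∈ xs → y ∈ ys x → (x , y) ∈ sigma xs ys
  ∈-sigma⁺ (here ≡.refl) y∈                    = ∈-++⁺ˡ (∈-map⁺ _ y∈)
  ∈-sigma⁺ {x′ ∷ xs} {ys} (there x∈) y∈ = ∈-++⁺ʳ (map (x′ ,_) (ys x′)) (∈-sigma⁺ x∈ y∈)

  ∈-sigma⁻ : ∀ xs {ys : A → List B} {x y} → (x , y) ∈ sigma xs ys → x ∈ xs
  ∈-sigma⁻ (x′ ∷ xs) {ys} t∈ with ∈-++⁻ (map (x′ ,_) (ys x′)) t∈
  ... | inj₂ t∈′ = there (∈-sigma⁻ xs t∈′)
  ... | inj₁ t∈′ with ∈-map⁻ _ t∈′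
  ...   | _ , _ , ≡.refl = here ≡.refl

  sigma-unique : ∀ {xs} {ys : A → List B} → Unique xs → (∀ x → Unique (ys x)) → Unique (sigma xs ys)
  sigma-unique []          _   = []
  sigma-unique {x ∷ xs} {ys} (x∉ ∷ xs!) ys! = Unique.++⁺ (Unique.map⁺ (λ { ≡.refl → ≡.refl }) (ys! x)) (sigma-unique xs! ys!)
    λ (t∈₁ , t∈₂) → disjoint (∈-map⁻ (x ,_) t∈₁) t∈₂
    where
    disjoint : ∀ {t ys′} → ∃[ y ] (y ∈ ys′ × t ≡ (x , y)) → ¬ (t ∈ sigma xs ys)
    disjoint (_ , _ , ≡.refl) t∈ = All.lookup x∉ (∈-sigma⁻ xs t∈) ≡.refl

module ListSums {c ℓ} (K : CommutativeRing c ℓ) where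
  open CommutativeRing K
  open IntegerSolver K
  open FiniteSums K
  open import Relation.Binary.Reasoning.Setoid setoid

  ∑ₗ : ∀ {a} {A : Set a} → List A → (A → Carrier) → Carrier
  ∑ₗ []       f = 0#
  ∑ₗ (x ∷ xs) f = f x + ∑ₗ xs f

  module _ {a} {A : Set a} where

    ∑ₗ-++ : ∀ (xs : List A) {ys} f → ∑ₗ (xs ++ ys) f ≈ ∑ₗ xs f + ∑ₗ ys f
    ∑ₗ-++ []       f = sym (+-identityˡ _)
    ∑ₗ-++ (x ∷ xs) f = trans (+-congˡ (∑ₗ-++ xs f)) (sym (+-assoc _ _ _))

    ∑ₗ-map : ∀ {b} {B : Set b} (g : B → A) ys f → ∑ₗ (map g ys) f ≈ ∑ₗ ys (λ y → f (g y))
    ∑ₗ-map g []       f = refl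
    ∑ₗ-map g (y ∷ ys) f = +-congˡ (∑ₗ-map g ys f)

  module _ {a} {A : Set a} where

    ∑ₗ-sigma : ∀ {b} {B : Set b} (xs : List A) (ys : A → List B) f → ∑ₗ (sigma xs ys) f ≈ ∑ₗ xs (λ x → ∑ₗ (ys x) (λ y → f (x , y)))
    ∑ₗ-sigma []       ys f = refl
    ∑ₗ-sigma (x ∷ xs) ys f = trans (∑ₗ-++ (map (x ,_) (ys x)) f) (+-cong (∑ₗ-map (x ,_) (ys x) f) (∑ₗ-sigma xs ys f))

    -- The entry to be taken out is located by a proof of membership, so equality on `A` need not be
    -- decided.
    record Removed (x : A) (xs : List A) : Set (a ⊔ c ⊔ ℓ) where
      field
        rest     : List A
        ∑-rest   : ∀ f → ∑ₗ xs f ≈ f x + ∑ₗ rest f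
        rest⊆    : rest ⊆ xs
        ∈-rest   : ∀ {y} → y ∈ xs → y ≡ x ⊎ y ∈ rest
        unique   : Unique xs → Unique rest × x ∉ rest

      ⊆-rest : ∀ {ys} → Unique (x ∷ ys) → (x ∷ ys) ⊆ xs → ys ⊆ rest
      ⊆-rest (x∉ ∷ _) sub y∈ with ∈-rest (sub (there y∈))
      ... | inj₁ ≡.refl = contradiction ≡.refl (All.lookup x∉ y∈)
      ... | inj₂ y∈rest = y∈rest

    remove : ∀ {x xs} → x ∈ xs → Removed x xs
    remove {xs = x ∷ xs} (here ≡.refl) = record
      { rest = xs ; ∑-rest = λ f → refl ; rest⊆ = there
      ; ∈-rest = λ { (here eq) → inj₁ eq ; (there y∈) → inj₂ y∈ }
      ; unique = λ { (x∉ ∷ xs!) → xs! , λ x∈ → All.lookup x∉ x∈ ≡.refl } }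
    remove {x} {z ∷ xs} (there x∈) = record
      { rest = z ∷ rest
      ; ∑-rest = λ f → trans (+-congˡ (∑-rest f)) (solve 3 (λ a b c → a :+ (b :+ c) := b :+ (a :+ c)) refl (f z) (f x) (∑ₗ rest f))
      ; rest⊆ = λ { (here eq) → here eq ; (there y∈) → there (rest⊆ y∈) }
      ; ∈-rest = λ { (here eq) → inj₂ (here eq) ; (there y∈) → map₂ there (∈-rest y∈) }
      ; unique = λ { (z∉ ∷ xs!) → (All.tabulate (λ y∈ → All.lookup z∉ (rest⊆ y∈)) ∷ proj₁ (unique xs!))
                   , λ { (here ≡.refl) → All.lookup z∉ x∈ ≡.refl ; (there x∈′) → proj₂ (unique xs!) x∈′ } } }
      where open Removed (remove x∈)

    complement : ∀ {xs ys : List A} → Unique xs → Unique ys → xs ⊆ ys →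
      ∃[ zs ] (Unique zs × zs ⊆ ys × (∀ {z} → z ∈ zs → z ∉ xs) × (∀ f → ∑ₗ ys f ≈ ∑ₗ xs f + ∑ₗ zs f))
    complement {[]} {ys} _ ys! _ = ys , ys! , (λ z∈ → z∈) , (λ _ ()) , λ f → sym (+-identityˡ _)
    complement {x ∷ xs} x∷xs!@(x∉ ∷ xs!) ys! sub = zs , zs! , (λ z∈ → rest⊆ (zs⊆ z∈)) ,
      (λ { z∈ (here ≡.refl) → proj₂ (unique ys!) (zs⊆ z∈) ; z∈ (there z∈xs) → zs∉ z∈ z∈xs }) ,
      λ f → trans (∑-rest f) (trans (+-congˡ (zs-∑ f)) (sym (+-assoc _ _ _)))
      where
      open Removed (remove (sub (here ≡.refl)))
      IH = complement xs! (proj₁ (unique ys!)) (⊆-rest x∷xs! sub)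
      zs = proj₁ IH
      zs! = proj₁ (proj₂ IH)
      zs⊆ = proj₁ (proj₂ (proj₂ IH))
      zs∉ = proj₁ (proj₂ (proj₂ (proj₂ IH)))
      zs-∑ = proj₂ (proj₂ (proj₂ (proj₂ IH)))

  ∑ₗ-downFrom : ∀ n f → ∑ₗ (downFrom n) f ≈ ∑< n f
  ∑ₗ-downFrom zero    f = refl
  ∑ₗ-downFrom (suc n) f = +-congˡ (∑ₗ-downFrom n f)

  box : ℕ → (ℕ → ℕ) → ℕ → List (ℕ × ℕ × ℕ)
  box a b c = sigma (downFrom a) (λ m → sigma (downFrom (b m)) (λ _ → downFrom c))

  ∑ₗ-box : ∀ a b c f → ∑ₗ (box a b c) f ≈ ∑< a (λ m → ∑< (b m) (λ k → ∑< c (λ n → f (m , k , n))))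
  ∑ₗ-box a b c f = trans (∑ₗ-sigma (downFrom a) _ f) (trans (∑ₗ-downFrom a _) (∑-cong a (λ m →
    trans (∑ₗ-sigma (downFrom (b m)) _ _) (trans (∑ₗ-downFrom (b m) _) (∑-cong (b m) (λ k → ∑ₗ-downFrom c _))))))

  box-unique : ∀ a b c → Unique (box a b c)
  box-unique a b c = sigma-unique (Unique.downFrom⁺ a) (λ m → sigma-unique (Unique.downFrom⁺ (b m)) (λ _ → Unique.downFrom⁺ c))

  ∈-box : ∀ {a b c m k n} → m ℕ.< a → k ℕ.< b m → n ℕ.< c → (m , k , n) ∈ box a b c
  ∈-box m< k< n< = ∈-sigma⁺ (∈-downFrom⁺ m<) (∈-sigma⁺ (∈-downFrom⁺ k<) (∈-downFrom⁺ n<))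

  ⊆-box : ∀ (T : List (ℕ × ℕ × ℕ)) → ∃[ b ] T ⊆ box b (λ _ → b) b
  ⊆-box T = proj₁ (bounds T) , λ t∈ → let m< , k< , n< = proj₂ (bounds T) t∈ in ∈-box m< k< n<
    where
    bounds : ∀ T → ∃[ b ] (∀ {m k n} → (m , k , n) ∈ T → m ℕ.< b × k ℕ.< b × n ℕ.< b)
    bounds [] = 0 , λ ()
    bounds ((m , k , n) ∷ T) = s ℕ.+ b , λ
      { (here ≡.refl) → ℕ.≤-trans (s≤s (ℕ.m≤m+n m (k ℕ.+ n))) s≤ , ℕ.≤-trans (s≤s (ℕ.≤-trans (ℕ.m≤m+n k n) (ℕ.m≤n+m _ m))) s≤
                      , ℕ.≤-trans (s≤s (ℕ.≤-trans (ℕ.m≤n+m n k) (ℕ.m≤n+m _ m))) s≤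
      ; (there t∈) → let m< , k< , n< = b-bound t∈ in ℕ.≤-trans m< b≤ , ℕ.≤-trans k< b≤ , ℕ.≤-trans n< b≤ }
      where
      s = suc (m ℕ.+ (k ℕ.+ n))
      b = proj₁ (bounds T)
      b-bound = proj₂ (bounds T)
      s≤ : s ℕ.≤ s ℕ.+ b
      s≤ = ℕ.m≤m+n s b
      b≤ : b ℕ.≤ s ℕ.+ b
      b≤ = ℕ.m≤n+m b s

module Unconditional {c ℓ r ℓ₁ ℓ₂ b} (N : NormedRing c ℓ r ℓ₁ ℓ₂ b)
  (ρ : OrderedField.Carrier (NormedRing.scalars N))
  (0<ρ : OrderedField._<_ (NormedRing.scalars N) (OrderedField.0# (NormedRing.scalars N)) ρ)
  (ρ<1 : OrderedField._<_ (NormedRing.scalars N) ρ (OrderedField.1# (NormedRing.scalars N)))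
  where
  private
    module N = NormedRing N
    module F = OrderedField N.scalars
    module FS = IntegerSolver (OrderedFieldProperties.realRing N.scalars)
    module FL = ListSums (OrderedFieldProperties.realRing N.scalars)
    module F∑ = FiniteSums (OrderedFieldProperties.realRing N.scalars)
  open N using (Bd; Bd-nonneg; Bd-resp; Bd-mono; Bd-0; Bd-+; Bd-*)
  open CommutativeRing N.ring
  open Order N.scalars using (_≤_; ≤-refl; ≤-trans; ≤-resp; ≤-reflexive; <⇒≤; *-nonneg; +-nonneg; *-monoˡ-≤; *-mono-≤; +-mono-≤)
  open Order.Powers N.scalars ρ 0<ρ ρ<1
  open Estimates N ρ 0<ρ ρ<1
  open IntegerSolver N.ring
  open FiniteSums N.ring
  open ListSums N.ring
  open Exp (Order.semiring N.scalars) using () renaming (_^_ to _^ᶠ_; ^-homo-* to ^ᶠ-homo-*)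

  private
    Index : Set
    Index = ℕ × ℕ × ℕ

  weight : Index → F.Carrier
  weight (m , k , n) = ρ ^ᶠ m F.* (ρ ^ᶠ k F.* ρ ^ᶠ n)

  private
    0≤weight : ∀ t → F.0# ≤ weight t
    0≤weight (m , k , n) = *-nonneg (0≤ρ^ m) (*-nonneg (0≤ρ^ k) (0≤ρ^ n))

    ∑-mono : ∀ {xs ys : List Index} → Unique xs → xs ⊆ ys → FL.∑ₗ xs weight ≤ FL.∑ₗ ys weight
    ∑-mono {[]} {ys} _ _ = nonneg ys
      where
      nonneg : ∀ ys → F.0# ≤ FL.∑ₗ ys weight
      nonneg []       = ≤-refl
      nonneg (y ∷ ys) = +-nonneg (0≤weight y) (nonneg ys)
    ∑-mono {x ∷ xs} x∷xs!@(x∉ ∷ xs!) sub = ≤-trans (+-mono-≤ ≤-refl (∑-mono xs! (⊆-rest x∷xs! sub))) (≤-reflexive (F.sym (∑-rest weight)))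
      where
      open FL.Removed (FL.remove (sub (here ≡.refl)))

    κ³ : F.Carrier
    κ³ = κ F.* (κ F.* κ)

    -- A list without duplicates lies in some cube [0,b)³, and there the sum of the weights factors
    -- into three geometric sums.
    ∑-weight≤ : ∀ {xs} → Unique xs → FL.∑ₗ xs weight ≤ κ³
    ∑-weight≤ {xs} xs! = ≤-trans (∑-mono xs! (proj₂ (FL.⊆-box xs))) (≤-resp (F.sym (product (proj₁ (FL.⊆-box xs)))) F.refl (cube (proj₁ (FL.⊆-box xs))))
      where
      ∑ρ : ∀ b → F∑.∑< b (ρ ^ᶠ_) F.≈ geom b
      ∑ρ zero    = F.sym geom-zero
      ∑ρ (suc b) = F.trans (F.+-congˡ (∑ρ b)) (geom-suc b)
      product : ∀ b → FL.∑ₗ (FL.box b (λ _ → b) b) weight F.≈ geom b F.* (geom b F.* geom b)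
      product b = F.trans (FL.∑ₗ-box b (λ _ → b) b weight) (F.trans
        (F∑.∑-cong b (λ m → F.trans (F∑.∑-cong b (λ k → F.trans (F∑.∑-*ˡ b _ _) (F.*-congˡ (F.trans (F∑.∑-*ˡ b _ _) (F.*-congˡ (∑ρ b))))))
          (F.trans (F∑.∑-*ˡ b _ _) (F.*-congˡ (F.trans (F∑.∑-*ʳ b _ _) (F.*-congʳ (∑ρ b)))))))
        (F.trans (F∑.∑-*ʳ b _ _) (F.*-congʳ (∑ρ b))))
      0≤geom : ∀ b → F.0# ≤ geom b
      0≤geom zero    = ≤-reflexive (F.sym geom-zero)
      0≤geom (suc b) = ≤-resp F.refl (geom-suc b) (+-nonneg (0≤ρ^ b) (0≤geom b))
      cube : ∀ b → geom b F.* (geom b F.* geom b) ≤ κ³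
      cube b = *-mono-≤ (*-nonneg (0≤geom b) (0≤geom b)) (<⇒≤ 0<κ) (geom≤κ b) (*-mono-≤ (0≤geom b) (<⇒≤ 0<κ) (geom≤κ b) (geom≤κ b))

    Bd-∑ₗ : ∀ {C} xs f → F.0# ≤ C → (∀ {t} → t ∈ xs → Bd (f t) (C F.* weight t)) → Bd (∑ₗ xs f) (C F.* FL.∑ₗ xs weight)
    Bd-∑ₗ []       f 0≤C bd = Bd-≈ (F.sym (F.zeroʳ _)) Bd-0
    Bd-∑ₗ (x ∷ xs) f 0≤C bd = Bd-≈ (F.sym (F.distribˡ _ _ _)) (Bd-+ (bd (here ≡.refl)) (Bd-∑ₗ xs f 0≤C (λ t∈ → bd (there t∈))))

  -- A finite set T containing S M splits into S M and a rest outside S M. On the rest each term is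
  -- at most C ρ^M times its weight, and the weights sum to at most κ³ whatever T is.
  unconditional : ∀ {f s C} (S : ℕ → List Index) → (∀ M → Unique (S M)) → F.0# ≤ C →
    (∀ M {t} → t ∉ S M → Bd (f t) (C F.* ρ ^ᶠ M F.* weight t)) →
    Negligible (λ M → ∑ₗ (S M) f - s) →
    ∃[ C′ ] F.0# ≤ C′ × (∀ M {T} → Unique T → S M ⊆ T → Bd (∑ₗ T f - s) (C′ F.* ρ ^ᶠ M))
  unconditional {f} {s} {C} S S! 0≤C tail (C₁ , bd) = C₁ F.+ C F.* κ³ , +-nonneg 0≤C₁ (*-nonneg 0≤C 0≤κ³) , λ M {T} T! S⊆T →
    let zs , zs! , _ , zs∉ , split = complement (S! M) T! S⊆T
        0≤Cρ = *-nonneg 0≤C (0≤ρ^ M)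
    in Bd-resp
      (trans (solve 3 (λ a b s → (a :- s) :+ b := a :+ b :- s) refl (∑ₗ (S M) f) (∑ₗ zs f) s) (+-congʳ (sym (split f))))
      (Bd-mono (≤-trans (+-mono-≤ ≤-refl (*-monoˡ-≤ 0≤Cρ (∑-weight≤ zs!)))
                 (≤-reflexive (FS.solve 4 (λ a c m k → a FS.:* m FS.:+ c FS.:* m FS.:* k FS.:= (a FS.:+ c FS.:* k) FS.:* m) F.refl C₁ C (ρ ^ᶠ M) κ³)))
        (Bd-+ (bd M) (Bd-∑ₗ zs f 0≤Cρ (λ z∈ → tail M (zs∉ z∈)))))
    where
    0≤C₁ : F.0# ≤ C₁
    0≤C₁ = ≤-resp F.refl (F.*-identityʳ C₁) (Bd-nonneg (bd 0))
    0≤κ³ : F.0# ≤ κ³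
    0≤κ³ = *-nonneg (<⇒≤ 0<κ) (*-nonneg (<⇒≤ 0<κ) (<⇒≤ 0<κ))

  module Summand (Q : QFactorial N.ring) (q≤ρ² : NormedRing.Bd N (QFactorial.q Q) (OrderedField._*_ (NormedRing.scalars N) ρ ρ)) where
    open QFactorial Q
    open Bressoud N.ring Q using (bin; bin-<)
    open TripleSum N.ring Q using (triangle; summand)
    open SmallBase Q q≤ρ²
    open Exp semiring using (_^_; ^-homo-*)
    open import Relation.Binary.Reasoning.Setoid setoid

    term : Index → Carrier
    term (m , k , n) = q ^ (tri m ℕ.+ tri (m ℕ.+ k) ℕ.+ n ℕ.* n) * (u m * u k) * bin ⌊ k /2⌋ n

    simplex : ℕ → List Index
    simplex M = box (suc M) (λ m → suc (dbl (M ∸ m))) (suc M)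

    -- The box cuts n off at M, which loses nothing: 2m + k ≤ 2M implies ⌊k/2⌋ ≤ M, and the
    -- q-binomial vanishes for n > ⌊k/2⌋.
    ∑-simplex : ∀ M → ∑ₗ (simplex M) term ≈ triangle summand M
    ∑-simplex M = trans (∑ₗ-box (suc M) (λ m → suc (dbl (M ∸ m))) (suc M) term) (∑-cong (suc M) (λ m → ∑-cong< (suc (dbl (M ∸ m))) (λ k k< → row m k (half m k k<))))
      where
      half : ∀ m k → k ℕ.< suc (dbl (M ∸ m)) → ⌊ k /2⌋ ℕ.≤ M
      half m k (s≤s k≤) = ℕ.≤-trans (ℕ.⌊n/2⌋-mono k≤) (ℕ.≤-trans (ℕ.≤-reflexive (⌊dbl/2⌋ (M ∸ m))) (ℕ.m∸n≤m M m))
      truncate : ∀ L d g → (∀ n → L ℕ.< n → g n ≈ 0#) → ∑< (suc (d ℕ.+ L)) g ≈ ∑< (suc L) g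
      truncate L zero    g g≈0 = refl
      truncate L (suc d) g g≈0 = trans (∑-drop-last _ g (g≈0 _ (s≤s (ℕ.m≤n+m L d)))) (truncate L d g g≈0)
      row : ∀ m k → ⌊ k /2⌋ ℕ.≤ M → ∑< (suc M) (λ n → term (m , k , n)) ≈ summand m k
      row m k L≤M = begin
        ∑< (suc M) (λ n → term (m , k , n))
          ≈⟨ ∑-cong (suc M) (λ n → trans (*-congʳ (*-congʳ (^-homo-* q e (n ℕ.* n))))
               (trans (solve 5 (λ a b c d e → a :* b :* (c :* d) :* e := (a :* c :* d) :* (b :* e)) refl (q ^ e) (q ^ (n ℕ.* n)) (u m) (u k) (bin L n))
                 (*-congˡ (*-congʳ (reflexive (≡.cong (q ^_) (≡.sym (ℕ.+-identityʳ (n ℕ.* n)))))))) ) ⟩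
        ∑< (suc M) (λ n → q ^ e * u m * u k * (q ^ (n ℕ.* n ℕ.+ 0) * bin L n))
          ≈⟨ ∑-*ˡ (suc M) _ _ ⟩
        q ^ e * u m * u k * ∑< (suc M) (λ n → q ^ (n ℕ.* n ℕ.+ 0) * bin L n)
          ≡⟨ ≡.cong (λ x → q ^ e * u m * u k * ∑< (suc x) (λ n → q ^ (n ℕ.* n ℕ.+ 0) * bin L n)) (≡.sym (ℕ.m∸n+n≡m L≤M)) ⟩
        q ^ e * u m * u k * ∑< (suc (M ∸ L ℕ.+ L)) (λ n → q ^ (n ℕ.* n ℕ.+ 0) * bin L n)
          ≈⟨ *-congˡ (truncate L (M ∸ L) _ (λ n L<n → trans (*-congˡ (bin-< L<n)) (zeroʳ _))) ⟩
        q ^ e * u m * u k * ∑< (suc L) (λ n → q ^ (n ℕ.* n ℕ.+ 0) * bin L n)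
          ≈⟨ solve 4 (λ a b c d → a :* b :* c :* d := a :* (b :* (d :* c))) refl _ _ _ _ ⟩
        summand m k ∎
        where
        e = tri m ℕ.+ tri (m ℕ.+ k)
        L = ⌊ k /2⌋

    -- The exponent e of q is at least 2m + k + n, which is at least M outside the simplex and
    -- always at least m + k + n. Since |q^e| ≤ ρ^(2e), one copy of e yields ρ^M and the other
    -- yields the weight.
    term-tail : ∀ {A} → (∀ n → Bd (qf n) A) → ∃[ C′ ] (F.0# ≤ C′ × ∀ M {t} → t ∉ simplex M → Bd (term t) (C′ F.* ρ ^ᶠ M F.* weight t))
    term-tail {A} qf≤A = C′ , Bd-nonneg (coeff-bd 0 0 0) , bound
      where
      C′ = C F.* C F.* (A F.* (C F.* C))
      coeff-bd : ∀ m k n → Bd (u m * u k * bin ⌊ k /2⌋ n) C′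
      coeff-bd m k n = Bd-* (Bd-* (u≤C m) (u≤C k)) (Bd-* (qf≤A ⌊ k /2⌋) (Bd-* (u≤C n) (um≤C ⌊ k /2⌋ n)))

      n≤tri : ∀ n → n ℕ.≤ tri n
      n≤tri zero    = z≤n
      n≤tri (suc n) = ℕ.m≤n+m (suc n) (tri n)

      outside : ∀ M m k n → (m , k , n) ∉ simplex M → M ℕ.≤ m ℕ.+ (m ℕ.+ k) ℕ.+ n
      outside M m k n t∉ = ℕ.≮⇒≥ (λ lt → t∉ (∈-box {suc M} {λ m → suc (dbl (M ∸ m))} {suc M} (s≤s (m≤ lt)) (s≤s (k≤ lt)) (s≤s (n≤ lt))))
        where
        m≤ : m ℕ.+ (m ℕ.+ k) ℕ.+ n ℕ.< M → m ℕ.≤ M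
        m≤ lt = ℕ.≤-trans (ℕ.m≤m+n m (m ℕ.+ k)) (ℕ.≤-trans (ℕ.m≤m+n _ n) (ℕ.<⇒≤ lt))
        n≤ : m ℕ.+ (m ℕ.+ k) ℕ.+ n ℕ.< M → n ℕ.≤ M
        n≤ lt = ℕ.≤-trans (ℕ.m≤n+m n _) (ℕ.<⇒≤ lt)
        m+k≤ : m ℕ.+ (m ℕ.+ k) ℕ.+ n ℕ.< M → m ℕ.+ k ℕ.≤ M
        m+k≤ lt = ℕ.≤-trans (ℕ.m≤n+m (m ℕ.+ k) m) (ℕ.≤-trans (ℕ.m≤m+n _ n) (ℕ.<⇒≤ lt))
        k≤ : m ℕ.+ (m ℕ.+ k) ℕ.+ n ℕ.< M → k ℕ.≤ dbl (M ∸ m)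
        k≤ lt rewrite dbl≡+ (M ∸ m) = ℕ.≤-trans (ℕ.≤-trans (ℕ.≤-reflexive (≡.sym (ℕ.m+n∸m≡n m k))) (ℕ.∸-monoˡ-≤ m (m+k≤ lt))) (ℕ.m≤m+n _ _)

      bound : ∀ M {t} → t ∉ simplex M → Bd (term t) (C′ F.* ρ ^ᶠ M F.* weight t)
      bound M {m , k , n} t∉ = Bd-resp (sym (*-assoc _ _ _)) (Bd-≈ eq (Bd-* (Bd-q^ e (M ℕ.+ (m ℕ.+ (k ℕ.+ n))) le) (coeff-bd m k n)))
        where
        e = tri m ℕ.+ tri (m ℕ.+ k) ℕ.+ n ℕ.* n
        w = m ℕ.+ (m ℕ.+ k) ℕ.+ n
        w≤e : w ℕ.≤ e
        w≤e = ℕ.+-mono-≤ (ℕ.+-mono-≤ (n≤tri m) (n≤tri (m ℕ.+ k))) (n≤n² n)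
        le : M ℕ.+ (m ℕ.+ (k ℕ.+ n)) ℕ.≤ e ℕ.+ e
        le = ℕ.+-mono-≤ (ℕ.≤-trans (outside M m k n t∉) w≤e)
          (ℕ.≤-trans (ℕ.≤-reflexive (≡.sym (ℕ.+-assoc m k n))) (ℕ.≤-trans (ℕ.+-monoˡ-≤ n (ℕ.m≤n+m (m ℕ.+ k) m)) w≤e))
        eq : ρ ^ᶠ (M ℕ.+ (m ℕ.+ (k ℕ.+ n))) F.* C′ F.≈ C′ F.* ρ ^ᶠ M F.* (ρ ^ᶠ m F.* (ρ ^ᶠ k F.* ρ ^ᶠ n))
        eq = F.trans (F.*-comm _ _) (F.trans (F.*-congˡ (F.trans (^ᶠ-homo-* ρ M _) (F.*-congˡ (F.trans (^ᶠ-homo-* ρ m _) (F.*-congˡ (^ᶠ-homo-* ρ k n))))))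
          (F.sym (F.*-assoc _ _ _)))

-- The complex numbers

module RealLimits {c ℓ₁ ℓ₂} (ℝ : CompleteOrderedField c ℓ₁ ℓ₂) where
  open CompleteOrderedField ℝ
  open OrderedFieldProperties orderedField using (realRing; <-irrefl; <-respˡ; <-respʳ; x<y⇒0<y-x; 0<1; x*x≮0)
  open Order orderedField
  open IntegerSolver realRing
  open Exp (Order.semiring orderedField) using (_^_)

  module _ {ρ : Carrier} (0<ρ : 0# < ρ) (ρ<1 : ρ < 1#) where
    open Order.Powers orderedField ρ 0<ρ ρ<1

    Cρ^-small : ∀ {C} → 0# ≤ C → ∀ ε → 0# < ε → ∃[ N ] C * ρ ^ N < ε
    Cρ^-small {C} 0≤C ε 0<ε = N , <-≤-trans lt (≤-reflexive eq)
      where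
      -- C need not be apart from 0, so ε is divided by C + 1 instead of C.
      0<C+1 : 0# < C + 1#
      0<C+1 = ≤-<-trans 0≤C (<-respˡ (+-identityˡ C) (<-respʳ (+-comm 1# C) (+-monoˡ-< C 0<1)))
      inv = inverse-pos 0<C+1
      δ = proj₁ inv
      0<δ = proj₁ (proj₂ inv)
      small = ρ^-small archimedean (ε * δ) (*-pos 0<ε 0<δ)
      N = proj₁ small
      lt : C * ρ ^ N < (C + 1#) * (ε * δ)
      lt = ≤-<-trans (*-monoʳ-≤ (0≤ρ^ N) (≤-resp (+-identityʳ C) refl (+-mono-≤ ≤-refl 0≤1)))
        (0<y-x⇒x<y (<-respʳ (solve 3 (λ c e r → c :* (e :- r) := c :* e :- c :* r) refl (C + 1#) (ε * δ) (ρ ^ N))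
          (*-pos 0<C+1 (x<y⇒0<y-x (proj₂ small)))))
      eq : (C + 1#) * (ε * δ) ≈ ε
      eq = trans (solve 3 (λ c e d → c :* (e :* d) := e :* (d :* c)) refl (C + 1#) ε δ)
        (trans (*-congˡ (proj₂ (proj₂ inv))) (*-identityʳ ε))

    Cρ^-zero : ∀ {C x} → 0# ≤ x → (∀ n → x ≤ C * ρ ^ n) → ¬ (0# < x)
    Cρ^-zero {C} {x} 0≤x x≤ 0<x = x≤ N lt
      where
      0≤C : 0# ≤ C
      0≤C = ≤-trans 0≤x (≤-resp refl (*-identityʳ C) (x≤ 0))
      N = proj₁ (Cρ^-small 0≤C x 0<x)
      lt = proj₂ (Cρ^-small 0≤C x 0<x)

    real-limit : ∀ {C} → 0# ≤ C → (s : ℕ → Carrier) →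
      (∀ n d → s (n ℕ.+ d) ≤ s n + C * ρ ^ n × s n ≤ s (n ℕ.+ d) + C * ρ ^ n) →
      ∃[ l ] ∀ n → l ≤ s n + C * ρ ^ n × s n ≤ l + C * ρ ^ n
    real-limit {C} 0≤C s close = l , λ n → upper n , lower n
      where
      close′ : ∀ N m → N ℕ.≤ m → s m ≤ s N + C * ρ ^ N × s N ≤ s m + C * ρ ^ N
      close′ N m N≤m = ≡.subst (λ k → s k ≤ s N + C * ρ ^ N × s N ≤ s k + C * ρ ^ N) (ℕ.m+[n∸m]≡n N≤m) (close N (m ∸ N))
      cauchy : Cauchy s
      cauchy ε 0<ε = N , λ m n N≤m N≤n → ≤-<-trans
        (≤-trans (proj₁ (close′ N m N≤m)) (+-monoʳ-≤ _ (proj₂ (close′ N n N≤n))))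
        (<-respˡ (solve 3 (λ c r s → (c :+ c) :* r :+ s := s :+ c :* r :+ c :* r) refl C (ρ ^ N) (s n))
          (<-respʳ (+-comm ε (s n)) (+-monoˡ-< (s n) small)))
        where
        N = proj₁ (Cρ^-small (+-nonneg 0≤C 0≤C) ε 0<ε)
        small : (C + C) * ρ ^ N < ε
        small = proj₂ (Cρ^-small (+-nonneg 0≤C 0≤C) ε 0<ε)
      l = proj₁ (complete s cauchy)
      converges : ConvergesTo s l
      converges = proj₂ (complete s cauchy)
      upper : ∀ n → l ≤ s n + C * ρ ^ n
      upper n lt = <-irrefl refl (<-≤-trans (proj₂ (close-l m m≥N))
          (≤-resp refl (solve 2 (λ x l → x :+ (l :- x) := l) refl (s n + C * ρ ^ n) l)
            (+-monoʳ-≤ ε (proj₁ (close′ n m m≥n)))))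
        where
        -- The assumed violation is itself the tolerance: s comes closer to l than this gap at an
        -- index that is also at least n, which contradicts the bound there.
        ε = l - (s n + C * ρ ^ n)
        close-l = proj₂ (converges ε (x<y⇒0<y-x lt))
        N = proj₁ (converges ε (x<y⇒0<y-x lt))
        m = N ℕ.+ n
        m≥N = ℕ.m≤m+n N n
        m≥n = ℕ.m≤n+m n N
      lower : ∀ n → s n ≤ l + C * ρ ^ n
      lower n lt = <-irrefl refl (<-≤-trans
          (<-respˡ (+-comm _ _) (<-respʳ (+-comm _ _) (+-monoˡ-< (C * ρ ^ n) (proj₁ (close-l m m≥N)))))
          (≤-resp refl refl (≤-trans (≤-reflexive (solve 3 (λ l x s → x :+ (l :+ (s :- (l :+ x))) := s) refl l (C * ρ ^ n) (s n)))
            (≤-resp refl (+-comm _ _) (proj₂ (close′ n m m≥n))))))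
        where
        ε = s n - (l + C * ρ ^ n)
        close-l = proj₂ (converges ε (x<y⇒0<y-x lt))
        N = proj₁ (converges ε (x<y⇒0<y-x lt))
        m = N ℕ.+ n
        m≥N = ℕ.m≤m+n N n
        m≥n = ℕ.m≤n+m n N

  0≤x*x : ∀ {x} → 0# ≤ x * x
  0≤x*x = x*x≮0

  square≤ : ∀ {x y e} → x ≤ y + e → y ≤ x + e → (x - y) * (x - y) ≤ e * e
  square≤ {x} {y} {e} p r = 0≤y-x⇒x≤y (≤-resp refl
    (solve 3 (λ x y e → (y :+ e :- x) :* (x :+ e :- y) := e :* e :- (x :- y) :* (x :- y)) refl x y e)
    (*-nonneg (0≤y-x p) (0≤y-x r)))

  ≤square : ∀ {x y e} → 0# ≤ e → (x - y) * (x - y) ≤ e * e → x ≤ y + e × y ≤ x + e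
  ≤square {x} {y} {e} 0≤e p =
      ≤-resp (solve 2 (λ x y → x :- y :+ y := x) refl x y) (+-comm e y) (+-monoʳ-≤ y (square-cancel-≤ 0≤e p))
    , ≤-resp (solve 2 (λ x y → y :- x :+ x := y) refl x y) (+-comm e x) (+-monoʳ-≤ x (square-cancel-≤ 0≤e
        (≤-resp (solve 2 (λ x y → (x :- y) :* (x :- y) := (y :- x) :* (y :- x)) refl x y) refl p)))

module ComplexNorm {c ℓ₁ ℓ₂} (ℝ : CompleteOrderedField c ℓ₁ ℓ₂) where
  private module R = CompleteOrderedField ℝ
  open R using (orderedField; _≈_; _+_; _*_; -_; _-_; 0#; 1#; _<_; refl; sym; trans; +-cong; *-cong; +-identityʳ; +-identityˡ; *-identityʳ; zeroˡ; *-pos)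
    renaming (Carrier to Real)
  open OrderedFieldProperties orderedField using (realRing; x<y⇒0<y-x)
  open Order orderedField
  open IntegerSolver realRing
  open RealLimits ℝ
  open Complex ℝ using (ℂ; _+i_; ∣_∣²; complexRing; *-∣∣²)
  private module C = CommutativeRing complexRing
  open Exp (Order.semiring orderedField) using (_^_)

  Bounded : ℂ → Real → Set ℓ₂
  Bounded z r = 0# ≤ r × ∣ z ∣² ≤ r * r

  private
    0≤∣∣² : ∀ z → 0# ≤ ∣ z ∣²
    0≤∣∣² (a +i b) = +-nonneg 0≤x*x 0≤x*x

    re² : ∀ z → ℂ.re z * ℂ.re z ≤ ∣ z ∣²
    re² (a +i b) = ≤-resp (+-identityʳ _) refl (+-mono-≤ ≤-refl 0≤x*x)

    im² : ∀ z → ℂ.im z * ℂ.im z ≤ ∣ z ∣²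
    im² (a +i b) = ≤-resp (+-identityˡ _) refl (+-mono-≤ 0≤x*x ≤-refl)

    bounded-resp : ∀ {z w r} → z C.≈ w → Bounded z r → Bounded w r
    bounded-resp (p , q) (0≤r , bd) = 0≤r , ≤-resp (+-cong (*-cong p p) (*-cong q q)) refl bd

    bounded-+ : ∀ {z w r s} → Bounded z r → Bounded w s → Bounded (z C.+ w) (r + s)
    bounded-+ {a +i b} {a′ +i b′} {r} {s} (0≤r , p) (0≤s , q) = +-nonneg 0≤r 0≤s ,
      ≤-trans (≤-reflexive (solve 4 (λ a b c d → (a :+ c) :* (a :+ c) :+ (b :+ d) :* (b :+ d)
          := (a :* a :+ b :* b) :+ (c :* c :+ d :* d) :+ (a :* c :+ b :* d :+ (a :* c :+ b :* d))) refl a b a′ b′))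
        (≤-trans (+-mono-≤ (+-mono-≤ p q) (+-mono-≤ cauchy-schwarz cauchy-schwarz))
          (≤-reflexive (solve 2 (λ r s → r :* r :+ s :* s :+ (r :* s :+ r :* s) := (r :+ s) :* (r :+ s)) refl r s)))
      where
      -- By Lagrange's identity (ac + bd)² + (ad - bc)² = (a² + b²)(c² + d²).
      cauchy-schwarz : a * a′ + b * b′ ≤ r * s
      cauchy-schwarz = square-cancel-≤ (*-nonneg 0≤r 0≤s) (≤-trans
        (≤-trans (≤-resp (+-identityʳ _) refl (+-mono-≤ ≤-refl (0≤x*x {a * b′ - b * a′})))
          (≤-reflexive (solve 4 (λ a b c d → (a :* c :+ b :* d) :* (a :* c :+ b :* d) :+ (a :* d :- b :* c) :* (a :* d :- b :* c)
            := (a :* a :+ b :* b) :* (c :* c :+ d :* d)) refl a b a′ b′)))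
        (≤-trans (*-mono-≤ (0≤∣∣² (a′ +i b′)) 0≤x*x p q)
          (≤-reflexive (solve 2 (λ r s → r :* r :* (s :* s) := r :* s :* (r :* s)) refl r s))))

    bounded-* : ∀ {z w r s} → Bounded z r → Bounded w s → Bounded (z C.* w) (r * s)
    bounded-* {z} {w} {r} {s} (0≤r , p) (0≤s , q) = *-nonneg 0≤r 0≤s ,
      ≤-trans (≤-reflexive (*-∣∣² z w)) (≤-trans (*-mono-≤ (0≤∣∣² w) 0≤x*x p q)
        (≤-reflexive (solve 2 (λ r s → r :* r :* (s :* s) := r :* s :* (r :* s)) refl r s)))

    -- The real part suffices: Re z ≤ s < 1, hence |1 - z| ≥ 1 - Re z ≥ 1 - s.
    ∣1-z∣≥ : ∀ {s} z → Bounded z s → s < 1# → (1# - s) * (1# - s) ≤ ∣ C.1# C.- z ∣²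
    ∣1-z∣≥ {s} (a +i b) (0≤s , bd) s<1 = 0≤y-x⇒x≤y (≤-resp refl
      (solve 3 (λ s a b → (s :- a) :* ((:1 :- s) :+ (:1 :- a)) :+ b :* b
        := ((:1 :- a) :* (:1 :- a) :+ (:0 :- b) :* (:0 :- b)) :- (:1 :- s) :* (:1 :- s)) refl s a b)
      (+-nonneg (*-nonneg (0≤y-x a≤s) (+-nonneg (0≤y-x (<⇒≤ s<1)) (0≤y-x (≤-trans a≤s (<⇒≤ s<1))))) 0≤x*x))
      where
      a≤s : a ≤ s
      a≤s = square-cancel-≤ 0≤s (≤-trans (re² (a +i b)) bd)

    bounded-cancel : ∀ {z w r s} → Bounded z s → s < 1# → 0# ≤ r → Bounded (w C.* (C.1# C.- z)) (r * (1# - s)) → Bounded w r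
    bounded-cancel {z} {w} {r} {s} z≤s s<1 0≤r (_ , bd) = 0≤r , *-cancel-≤ (*-pos 0<1-s 0<1-s)
      (≤-trans (*-monoˡ-≤ (0≤∣∣² w) (∣1-z∣≥ z z≤s s<1))
        (≤-trans (≤-reflexive (sym (*-∣∣² w (C.1# C.- z))))
          (≤-trans bd (≤-reflexive (solve 2 (λ r x → r :* x :* (r :* x) := r :* r :* (x :* x)) refl r (1# - s))))))
      where 0<1-s = x<y⇒0<y-x s<1

    -- The square of each component is at most C² ρ^n for every n, so the component cannot be apart
    -- from 0; tightness of apartness makes it equal to 0.
    tight′ : ∀ {ρ C z} → 0# < ρ → ρ < 1# → (∀ n → Bounded z (C * ρ ^ n)) → z C.≈ C.0#
    tight′ {ρ} {C} {z} 0<ρ ρ<1 bd = vanishes (re² z) , vanishes (im² z)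
      where
      open Order.Powers orderedField ρ 0<ρ ρ<1
      vanishes : ∀ {x} → x * x ≤ ∣ z ∣² → x ≈ 0#
      vanishes {x} x²≤ = proj₁ (R.tight x 0#) λ x#0 →
        Cρ^-zero 0<ρ ρ<1 {C * C} 0≤x*x
          (λ n → ≤-trans x²≤ (≤-trans (proj₂ (bd n)) (≤-trans
            (≤-reflexive (solve 2 (λ c r → c :* r :* (c :* r) := c :* c :* r :* r) refl C (ρ ^ n)))
            (≤-resp refl (*-identityʳ _) (*-monoˡ-≤ (*-nonneg 0≤x*x (0≤ρ^ n)) (ρ^≤1 n))))))
          (OrderedFieldProperties.#0⇒0<x*x orderedField x#0)

    limit′ : ∀ {ρ C} → 0# < ρ → ρ < 1# → (s : ℕ → ℂ) → (∀ n d → Bounded (s (n ℕ.+ d) C.- s n) (C * ρ ^ n)) →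
      ∃[ l ] ∀ n → Bounded (s n C.- l) ((C + C) * ρ ^ n)
    limit′ {ρ} {C} 0<ρ ρ<1 s bd = proj₁ re-limit +i proj₁ im-limit , λ n →
        let e = C * ρ ^ n
            0≤e = *-nonneg 0≤C (0≤ρ^ n)
            re-upper , re-lower = proj₂ re-limit n
            im-upper , im-lower = proj₂ im-limit n
        in *-nonneg (+-nonneg 0≤C 0≤C) (0≤ρ^ n) ,
           ≤-trans (+-mono-≤ (square≤ re-lower re-upper) (square≤ im-lower im-upper))
             (0≤y-x⇒x≤y (≤-resp refl (solve 2 (λ c r → c :* r :* (c :* r) :+ c :* r :* (c :* r) := (c :+ c) :* r :* ((c :+ c) :* r) :- (c :* r :* (c :* r) :+ c :* r :* (c :* r))) refl C (ρ ^ n))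
               (+-nonneg 0≤x*x 0≤x*x)))
      where
      open Order.Powers orderedField ρ 0<ρ ρ<1
      0≤C : 0# ≤ C
      0≤C = ≤-resp refl (*-identityʳ C) (proj₁ (bd 0 0))
      re-limit = real-limit 0<ρ ρ<1 0≤C (λ n → ℂ.re (s n)) (λ n d → ≤square (proj₁ (bd n d)) (≤-trans (re² (s (n ℕ.+ d) C.- s n)) (proj₂ (bd n d))))
      im-limit = real-limit 0<ρ ρ<1 0≤C (λ n → ℂ.im (s n)) (λ n d → ≤square (proj₁ (bd n d)) (≤-trans (im² (s (n ℕ.+ d) C.- s n)) (proj₂ (bd n d))))

  complexNormedRing : NormedRing c ℓ₁ c ℓ₁ ℓ₂ ℓ₂
  complexNormedRing = record
    { ring = complexRing
    ; scalars = orderedField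
    ; archimedean = R.archimedean
    ; Bd = Bounded
    ; Bd-nonneg = proj₁
    ; Bd-resp = λ {z} {w} {r} → bounded-resp {z} {w} {r}
    ; Bd-mono = λ r≤s (0≤r , bd) → ≤-trans 0≤r r≤s , ≤-trans bd (*-mono-≤ 0≤r (≤-trans 0≤r r≤s) r≤s r≤s)
    ; Bd-0 = ≤-refl , ≤-reflexive (trans (+-cong (zeroˡ 0#) (zeroˡ 0#)) (trans (+-identityʳ 0#) (sym (zeroˡ 0#))))
    ; Bd-1 = 0≤1 , ≤-reflexive (solve 0 (:1 :* :1 :+ :0 :* :0 := :1 :* :1) refl)
    ; Bd-+ = λ {z} {w} → bounded-+ {z} {w}
    ; Bd-* = λ {z} {w} → bounded-* {z} {w}
    ; Bd-neg = λ { {a +i b} (0≤r , bd) → 0≤r , ≤-resp (solve 2 (λ a b → a :* a :+ b :* b := :- a :* :- a :+ :- b :* :- b) refl a b) refl bd }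
    ; Bd-cancel = λ {z} {w} → bounded-cancel {z} {w}
    ; tight = λ {ρ} {C} {z} → tight′ {ρ} {C} {z}
    ; limit = limit′
    }

-- From the general estimates to the series over the complex numbers

T≡tri : ∀ j → T j ≡ tri j
T≡tri j = ≡.trans (≡.cong (ℕ._/ 2) eq) (ℕ.m*n/n≡m (tri j) 2)
  where
  open ≡.≡-Reasoning
  eq : j ℕ.* (j ℕ.+ 1) ≡ tri j ℕ.* 2
  eq = begin
    j ℕ.* (j ℕ.+ 1)        ≡⟨ ≡.cong (j ℕ.*_) (ℕ.+-comm j 1) ⟩
    j ℕ.* suc j            ≡⟨ ℕ.*-suc j j ⟩
    j ℕ.+ j ℕ.* j          ≡⟨ ℕ.+-comm j _ ⟩
    j ℕ.* j ℕ.+ j          ≡⟨ tri+tri j ⟨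
    tri j ℕ.+ tri j        ≡⟨ ≡.cong (tri j ℕ.+_) (ℕ.+-identityʳ (tri j)) ⟨
    2 ℕ.* tri j            ≡⟨ ℕ.*-comm 2 (tri j) ⟩
    tri j ℕ.* 2            ∎

module _ {c ℓ} (K : CommutativeRing c ℓ) where
  open CommutativeRing K
  open IntegerSolver K
  open import Relation.Binary.Reasoning.Setoid setoid

  inverse-unique : ∀ {x y z} → x * y ≈ 1# → x * z ≈ 1# → y ≈ z
  inverse-unique {x} {y} {z} xy≈1 xz≈1 = begin
    y              ≈⟨ *-identityʳ y ⟨
    y * 1#         ≈⟨ *-congˡ xz≈1 ⟨
    y * (x * z)    ≈⟨ solve 3 (λ x y z → y :* (x :* z) := x :* y :* z) refl x y z ⟩
    x * y * z      ≈⟨ *-congʳ xy≈1 ⟩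
    1# * z         ≈⟨ *-identityˡ z ⟩
    z              ∎

module Evaluation {c ℓ r ℓ₁ ℓ₂ b} (N : NormedRing c ℓ r ℓ₁ ℓ₂ b)
  (ρ : OrderedField.Carrier (NormedRing.scalars N))
  (0<ρ : OrderedField._<_ (NormedRing.scalars N) (OrderedField.0# (NormedRing.scalars N)) ρ)
  (ρ<1 : OrderedField._<_ (NormedRing.scalars N) ρ (OrderedField.1# (NormedRing.scalars N)))
  (Q P : QFactorial (NormedRing.ring N))
  (q≤ρ² : NormedRing.Bd N (QFactorial.q Q) (OrderedField._*_ (NormedRing.scalars N) ρ ρ))
  (p≤ρ² : NormedRing.Bd N (QFactorial.q P) (OrderedField._*_ (NormedRing.scalars N) ρ ρ))
  where
  private
    module N = NormedRing N
    module F = OrderedField N.scalars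
  open CommutativeRing N.ring
  open Estimates N ρ 0<ρ ρ<1
  open Unconditional N ρ 0<ρ ρ<1
  open ListSums N.ring using (∑ₗ; box-unique)
  open Summand Q q≤ρ² using (term; simplex; term-tail; ∑-simplex)
  open Exp semiring using (_^_)
  open Exp (Order.semiring N.scalars) using () renaming (_^_ to _^ᶠ_)
  open Order N.scalars using (_≤_)
  open QFactorial Q using (q; qf)
  open QFactorial P using () renaming (q to p; qf to qfₚ)
  private
    module E = SmallBase Q q≤ρ²
    module Eₚ = SmallBase P p≤ρ²

  record Evaluated (x y : Carrier) : Set (c ⊔ ℓ ⊔ r ⊔ ℓ₂ ⊔ b) where
    field
      Qₗ R Pₗ X Y : Carrier
      Q→  : Tends qf Qₗ
      P→  : Tends qfₚ Pₗ
      X→  : Tends (poch x p) X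
      Y→  : Tends (poch y p) Y
      Q*R : Qₗ * R ≈ 1#
      sum : ∃[ C ] F.0# ≤ C × (∀ M {T} → Unique T → simplex M ⊆ T → N.Bd (∑ₗ T term - Pₗ * Y * X * R) (C F.* ρ ^ᶠ M))

  -- The exponents are variables because q ^ 21, with q complex, gets unfolded
  -- in comparisons of types.
  evaluated : ∀ a b d → a ≡ 21 → b ≡ 8 → d ≡ 13 → p ≡ q ^ a → Evaluated (q ^ d) (q ^ b)
  evaluated _ _ _ ≡.refl ≡.refl ≡.refl p≡q²¹ = record
    { Q→ = Q→ ; P→ = P→ ; X→ = X→ ; Y→ = Y→ ; Q*R = Q*R≈1 Q→ P→ X→ Y→
    ; sum = unconditional simplex (λ M → box-unique (suc M) (λ m → suc (dbl (M ∸ m))) (suc M)) (proj₁ (proj₂ tail)) (proj₂ (proj₂ tail))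
        (negl-resp (λ M → +-congʳ (sym (∑-simplex M))) (summand-limit Q→ P→ X→ Y→)) }
    where
    open Limit N ρ 0<ρ ρ<1 Q P q≤ρ² p≤ρ² p≡q²¹ using (Q*R≈1; summand-limit)
    ρ≤1 = Order.<⇒≤ N.scalars ρ<1
    Q→ = proj₂ E.qf-tends
    P→ = proj₂ Eₚ.qf-tends
    X→ = proj₂ (poch-tends (Bd-^-pos E.q≤ρ ρ≤1 13 (s≤s z≤n)) Eₚ.q≤ρ)
    Y→ = proj₂ (poch-tends (Bd-^-pos E.q≤ρ ρ≤1 8 (s≤s z≤n)) Eₚ.q≤ρ)
    tail = term-tail (Tends.bound Q→)

module SquareRootBound {c ℓ₁ ℓ₂} (F : OrderedField c ℓ₁ ℓ₂) where
  open OrderedField F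
  open OrderedFieldProperties F using (realRing; 0<1; +-pos; x<y⇒0<y-x)
  open Order F
  open IntegerSolver realRing

  -- The arithmetic mean of 1 and t bounds √t.
  mean : ∀ t → 0# ≤ t → t < 1# → ∃[ m ] (0# < m × m < 1# × t ≤ m * m)
  mean t 0≤t t<1 = m , *-pos 0<1+t 0<h , 0<y-x⇒x<y (<-resp eq₁ (*-pos (x<y⇒0<y-x t<1) 0<h)) ,
    0≤y-x⇒x≤y (≤-resp refl eq₂ (*-nonneg 0≤d 0≤d))
    where
    inv = inverse-pos (+-pos 0<1 0<1)
    h = proj₁ inv
    0<h = proj₁ (proj₂ inv)
    h*2≈1 : h * (1# + 1#) ≈ 1#
    h*2≈1 = proj₂ (proj₂ inv)
    m = (1# + t) * h
    0<1+t : 0# < 1# + t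
    0<1+t = <-≤-trans 0<1 (≤-resp (+-identityʳ 1#) refl (+-mono-≤ ≤-refl 0≤t))
    <-resp : ∀ {x y} → x ≈ y → 0# < x → 0# < y
    <-resp = OrderedFieldProperties.<-respʳ F
    0≤d : 0# ≤ (1# - t) * h
    0≤d = *-nonneg (0≤y-x (<⇒≤ t<1)) (<⇒≤ 0<h)
    eq₁ : (1# - t) * h ≈ 1# - m
    eq₁ = trans (solve 2 (λ t h → (:1 :- t) :* h := h :* (:1 :+ :1) :- (:1 :+ t) :* h) refl t h) (+-congʳ h*2≈1)
    eq₂ : (1# - t) * h * ((1# - t) * h) ≈ m * m - t
    eq₂ = trans (solve 2 (λ t h → (:1 :- t) :* h :* ((:1 :- t) :* h) := (:1 :+ t) :* h :* ((:1 :+ t) :* h) :- t :* (h :* (:1 :+ :1) :* (h :* (:1 :+ :1)))) refl t h)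
      (+-congˡ (-‿cong (trans (*-congˡ (trans (*-cong h*2≈1 h*2≈1) (*-identityˡ 1#))) (*-identityʳ t))))

module ComplexLimits {c ℓ₁ ℓ₂} (ℝ : CompleteOrderedField c ℓ₁ ℓ₂) where
  private module R = CompleteOrderedField ℝ
  open Complex ℝ
  open ComplexNorm ℝ
  open RealLimits ℝ using (Cρ^-small)
  open Order R.orderedField using (_≤_; ≤-trans; ≤-<-trans; ≤-resp; <⇒≤; *-monoˡ-≤; *-mono-≤; square-mono-<; +-nonneg; 0≤⇒#0⇒0<)
  open Exp (Order.semiring R.orderedField) using () renaming (_^_ to _^ᴿ_)
  private
    module P = OrderedFieldProperties R.orderedField
    module K = CommutativeRing complexRing

  0≤∣∣² : ∀ z → R.0# ≤ ∣ z ∣²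
  0≤∣∣² (a +i b) = +-nonneg P.x*x≮0 P.x*x≮0

  factorial : ∀ q → ∣ q ∣< R.1# → QFactorial complexRing
  factorial q ∣q∣<1 = record
    { q = q ; qf = qfac ; u = 1/qfac ; qf-zero = K.refl ; qf-suc = λ _ → K.refl
    ; qf*u = λ n → *-recip (qfac n) (qfac#0 n) }
    where open UnitDisc q ∣q∣<1

  -- |z|² |w|² = 1 makes |z|² invertible, hence apart from 0, and it is nonnegative.
  unit#0 : ∀ {z w} → z K.* w K.≈ K.1# → z #0
  unit#0 {z} {w} zw≈1@(re≈ , im≈) = 0≤⇒#0⇒0< (0≤∣∣² z) (P.inverse⇒# (R.trans (R.sym (*-∣∣² z w))
    (R.trans (R.+-cong (R.*-cong re≈ re≈) (R.*-cong im≈ im≈))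
      (R.trans (R.+-cong (R.*-identityˡ R.1#) (R.zeroˡ R.0#)) (R.+-identityʳ R.1#)))))

  module _ (ρ : R.Carrier) (0<ρ : R.0# R.< ρ) (ρ<1 : ρ R.< R.1#) where
    open Order.Powers R.orderedField ρ 0<ρ ρ<1
    open Estimates complexNormedRing ρ 0<ρ ρ<1 using (Tends) renaming (poch to poch′)

    bounded-< : ∀ {z C ε} N n → N ℕ.≤ n → R.0# ≤ C → C R.* ρ ^ᴿ N R.< ε → Bounded z (C R.* ρ ^ᴿ n) → ∣ z ∣< ε
    bounded-< {z} {C} {ε} N n N≤n 0≤C lt (0≤Cρ , bd) = ≤-<-trans bd (square-mono-< 0≤Cρ (≤-<-trans (*-monoˡ-≤ 0≤C (ρ^-anti N≤n)) lt))

    tends⇒⟶ : ∀ {s l} → Tends s l → s ⟶ l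
    tends⇒⟶ {s} {l} t ε 0<ε = proj₁ small , λ n N≤n → bounded-< {s n - l} (proj₁ small) n N≤n 0≤C (proj₂ small) (Tends.rate t n)
      where
      0≤C = proj₁ (Tends.bound-l t)
      small = Cρ^-small 0<ρ ρ<1 0≤C ε 0<ε

    poch≡ : ∀ a q n → poch′ a q n ≡ poch a q n
    poch≡ a q zero    = ≡.refl
    poch≡ a q (suc n) = ≡.cong (K._* (K.1# K.- a K.* q ^ n)) (poch≡ a q n)

  -- Taking the mean with 1 twice gives |q|² ≤ m² and m ≤ ρ², hence |q| ≤ ρ² without a square root.
  -- Both means are positive even for q = 0.
  module WithBase (q : ℂ) (∣q∣<1 : ∣ q ∣< R.1#) (e : ℕ) (0<e : 0 ℕ.< e) where
    private
      mean = SquareRootBound.mean R.orderedField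
      ∣q∣²<1 : ∣ q ∣² R.< R.1#
      ∣q∣²<1 = P.<-respʳ (R.*-identityˡ R.1#) ∣q∣<1
      M₁ = mean ∣ q ∣² (0≤∣∣² q) ∣q∣²<1
      m = proj₁ M₁
      0<m = proj₁ (proj₂ M₁)
      M₂ = mean m (<⇒≤ 0<m) (proj₁ (proj₂ (proj₂ M₁)))
      m≤ρ² : m ≤ proj₁ M₂ R.* proj₁ M₂
      m≤ρ² = proj₂ (proj₂ (proj₂ M₂))

    ρ : R.Carrier
    ρ = proj₁ M₂
    0<ρ : R.0# R.< ρ
    0<ρ = proj₁ (proj₂ M₂)
    ρ<1 : ρ R.< R.1#
    ρ<1 = proj₁ (proj₂ (proj₂ M₂))

    private
      0≤ρ² : R.0# ≤ ρ R.* ρ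
      0≤ρ² = <⇒≤ (R.*-pos 0<ρ 0<ρ)
      ρ²≤ρ : ρ R.* ρ ≤ ρ
      ρ²≤ρ = ≤-resp R.refl (R.*-identityʳ ρ) (*-monoˡ-≤ (<⇒≤ 0<ρ) (<⇒≤ ρ<1))

    q≤ρ² : Bounded q (ρ R.* ρ)
    q≤ρ² = 0≤ρ² , ≤-trans (proj₂ (proj₂ (proj₂ M₁))) (*-mono-≤ (<⇒≤ 0<m) 0≤ρ² m≤ρ² m≤ρ²)

    p≤ρ² : Bounded (q ^ e) (ρ R.* ρ)
    p≤ρ² = Estimates.Bd-^-pos complexNormedRing ρ 0<ρ ρ<1 {q} q≤ρ² (≤-trans ρ²≤ρ (<⇒≤ ρ<1)) e 0<e

    ∣p∣<1 : ∣ q ^ e ∣< R.1#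
    ∣p∣<1 = ≤-<-trans (proj₂ p≤ρ²) (square-mono-< 0≤ρ² (≤-<-trans ρ²≤ρ ρ<1))

    module L = Evaluation complexNormedRing ρ 0<ρ ρ<1 (factorial q ∣q∣<1) (factorial (q ^ e) ∣p∣<1) q≤ρ² p≤ρ²

module TripleSeries {c ℓ₁ ℓ₂} (ℝ : CompleteOrderedField c ℓ₁ ℓ₂) where
  open Complex ℝ
  open ComplexNorm ℝ
  open ComplexLimits ℝ
  private
    module R = CompleteOrderedField ℝ
    module K = CommutativeRing complexRing
    module N = NormedRing complexNormedRing
  open RealLimits ℝ using (Cρ^-small)
  open Order R.orderedField using (_≤_)
  open ListSums complexRing using (∑ₗ)

  ∑≈∑ₗ : ∀ {I : Set} {f g : I → ℂ} → (∀ i → f i ≈ g i) → ∀ is → ∑[ is ] f ≈ ∑ₗ is g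
  ∑≈∑ₗ f≈g []       = K.refl {0#}
  ∑≈∑ₗ {f = f} {g} f≈g (i ∷ is) = K.+-cong {f i} {g i} {∑[ is ] f} {∑ₗ is g} (f≈g i) (∑≈∑ₗ f≈g is)

  recip-unique : ∀ {z w} (z#0 : z #0) → z * w ≈ 1# → w ≈ recip z z#0
  recip-unique {z} {w} z#0 zw≈1 = inverse-unique complexRing {z} {w} {recip z z#0} zw≈1 (*-recip z z#0)

  module _ (q : ℂ) (∣q∣<1 : ∣ q ∣< R.1#) where
    open UnitDisc q ∣q∣<1
    private
      Qf = factorial q ∣q∣<1
      module QS = QSeries complexRing Qf
    open Bressoud complexRing Qf using (bin; bin-<)

    qbinom≈bin : ∀ A B → qbinom A B ≈ bin A B
    qbinom≈bin A B with B ℕ.≤? A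
    ... | yes B≤A = K.reflexive (≡.cong (λ x → qfac A * (1/qfac B * x)) (≡.sym (QS.um-≤ B≤A)))
    ... | no  B≰A = K.sym {bin A B} {0#} (bin-< (ℕ.≰⇒> B≰A))

    summand≈ : ∀ m k n →
      q ^ (T m ℕ.+ T (m ℕ.+ k) ℕ.+ n ℕ.* n) * (1/qfac m * 1/qfac k) * qbinom ⌊ k /2⌋ n
      ≈ q ^ (tri m ℕ.+ tri (m ℕ.+ k) ℕ.+ n ℕ.* n) * (1/qfac m * 1/qfac k) * bin ⌊ k /2⌋ n
    summand≈ m k n rewrite T≡tri m | T≡tri (m ℕ.+ k) =
      K.*-congˡ {q ^ (tri m ℕ.+ tri (m ℕ.+ k) ℕ.+ n ℕ.* n) * (1/qfac m * 1/qfac k)} {qbinom ⌊ k /2⌋ n} {bin ⌊ k /2⌋ n} (qbinom≈bin ⌊ k /2⌋ n)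

    -- That (q)_∞ is apart from 0 is read off from Qₗ R = 1, and uniqueness of inverses identifies R
    -- with its reciprocal.
    summand-hasSum : ∀ a b d → a ≡ 21 → b ≡ 8 → d ≡ 13 →
      ∃[ P₂₁ ] ∃[ P₈ ] ∃[ P₁₃ ] ∃[ Q ] Σ[ Q#0 ∈ Q #0 ]
        IsPoch∞ (q ^ a) (q ^ a) P₂₁ × IsPoch∞ (q ^ b) (q ^ a) P₈ × IsPoch∞ (q ^ d) (q ^ a) P₁₃ × IsPoch∞ q q Q ×
        HasSum {I = ℕ × ℕ × ℕ}
          (λ (m , k , n) → q ^ (T m ℕ.+ T (m ℕ.+ k) ℕ.+ n ℕ.* n) * (1/qfac m * 1/qfac k) * qbinom ⌊ k /2⌋ n)
          (P₂₁ * P₈ * P₁₃ * recip Q Q#0)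
    summand-hasSum a b d a≡21 b≡8 d≡13 = C.Pₗ , C.Y , C.X , C.Qₗ , Q#0 ,
      tends⇒⟶ ρ 0<ρ ρ<1 C.P→ , poch⟶ C.Y→ , poch⟶ C.X→ , tends⇒⟶ ρ 0<ρ ρ<1 C.Q→ , hasSum
      where
      0<a : 0 ℕ.< a
      0<a = ≡.subst (0 ℕ.<_) (≡.sym a≡21) (s≤s z≤n)
      open WithBase q ∣q∣<1 a 0<a
      module C = L.Evaluated (L.evaluated a b d a≡21 b≡8 d≡13 ≡.refl)
      Q#0 : C.Qₗ #0
      Q#0 = unit#0 {C.Qₗ} {C.R} C.Q*R
      poch⟶ : ∀ {z l} → Estimates.Tends complexNormedRing ρ 0<ρ ρ<1 (Estimates.poch complexNormedRing ρ 0<ρ ρ<1 z (q ^ a)) l → poch z (q ^ a) ⟶ l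
      poch⟶ {z} {l} t ε 0<ε = let M , close = tends⇒⟶ ρ 0<ρ ρ<1 t ε 0<ε in
        M , λ n M≤n → ≡.subst (λ w → ∣ w - l ∣< ε) (poch≡ ρ 0<ρ ρ<1 z (q ^ a) n) (close n M≤n)
      s = C.Pₗ * C.Y * C.X * C.R
      s′ = C.Pₗ * C.Y * C.X * recip C.Qₗ Q#0
      s≈s′ : s ≈ s′
      s≈s′ = K.*-congˡ {C.Pₗ * C.Y * C.X} {C.R} {recip C.Qₗ Q#0} (recip-unique Q#0 C.Q*R)
      hasSum : HasSum _ s′
      hasSum ε 0<ε = _ , λ T T! S⊆T → bounded-< ρ 0<ρ ρ<1 M M ℕ.≤-refl 0≤A small
        (N.Bd-resp (K.+-cong (K.sym (∑≈∑ₗ (λ (m , k , n) → summand≈ m k n) T)) (K.-‿cong {s} {s′} s≈s′)) (proj₂ (proj₂ C.sum) M T! S⊆T))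
        where
        A = proj₁ C.sum
        0≤A : R.0# ≤ A
        0≤A = proj₁ (proj₂ C.sum)
        M = proj₁ (Cρ^-small 0<ρ ρ<1 0≤A ε 0<ε)
        small = proj₂ (Cρ^-small 0<ρ ρ<1 0≤A ε 0<ε)

mainTheorem5 : ∀ {c ℓ₁ ℓ₂} (ℝ : CompleteOrderedField c ℓ₁ ℓ₂) →
    let open Complex ℝ in
    (q : ℂ) (∣q∣<1 : ∣ q ∣< CompleteOrderedField.1# ℝ) →
    let open UnitDisc q ∣q∣<1 in
    ∃[ P₂₁ ] ∃[ P₈ ] ∃[ P₁₃ ] ∃[ Q ] Σ[ Q#0 ∈ Q #0 ]
    IsPoch∞ (q ^ 21) (q ^ 21) P₂₁ ×
    IsPoch∞ (q ^ 8) (q ^ 21) P₈ ×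
    IsPoch∞ (q ^ 13) (q ^ 21) P₁₃ ×
    IsPoch∞ q q Q ×
    HasSum {I = ℕ × ℕ × ℕ}
    (λ (m , k , n) →
    q ^ (T m ℕ.+ T (m ℕ.+ k) ℕ.+ n ℕ.* n) * (1/qfac m * 1/qfac k) * qbinom ⌊ k /2⌋ n)
    (P₂₁ * P₈ * P₁₃ * recip Q Q#0)
mainTheorem5 ℝ q ∣q∣<1 = TripleSeries.summand-hasSum ℝ q ∣q∣<1 21 8 13 ≡.refl ≡.refl ≡.refl
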